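{- (Intuitionistic Function Extensionality.) Let $A,B$ be games and $\sigma,\tau\in\mathrm{Str}(A\Rightarrow B)$. Then $$\sigma\lesssim_{A\Rightarrow B}\tau\iff\text{for all }x:\mathbf 1\Rightarrow A\text{ and }\beta:B\Rightarrow\Sigma,\ \ \beta\circ\sigma\circ x\downarrow\ \text{ implies }\ \beta\circ\tau\circ x\downarrow .$$
   Context: Sequences. $X^\star$ is the set of finite sequences over $X$, $\epsilon$ the empty sequence; concatenation is juxtaposition. For sequences over a disjoint union, $s\upharpoonright i$ (or $s\upharpoonright A$) is the subsequence of elements in that component, with tags removed, and $\mathtt{fst}^\star(s)$ is the sequence of component tags of $s$. Games. A game is $A=(M_A,\lambda_A,P_A,\approx_A)$: $M_A$ is a set of moves; $\lambda_A=\langle\lambda_A^{PO},\lambda_A^{QA}\rangle:M_A\to\{P,O\}\times\{Q,A\}$ (Player/Opponent, question/answer), with $M_A^P,M_A^O,M_A^Q,M_A^A$ the corresponding sets of moves; $P_A$ is a non-empty prefix-closed subset of $M_A^{\circledast}$, the set of finite sequences $s$ of moves such that (p1) if $s\ne\epsilon$ its first move is an $O$-move, (p2) consecutive moves have opposite $P/O$ labels, (p3) every prefix of $s$ contains at most as many answers as questions; and $\approx_A$ is an equivalence relation on $P_A$ with (e1) $s\approx_A t\Rightarrow\lambda_A^\star(s)=\lambda_A^\star(t)$, (e2) $s\approx_A t$ implies $s'\approx_A t'$ for prefixes $s'$ of $s$, $t'$ of $t$ of equal length, (e3) $s\approx_A t$ and $sa\in P_A$ imply $sa\approx_A tb$ for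 some $b$. Reading questions as "(" and answers as ")", each answer corresponds to the most recent unanswered question. Strategies. A strategy on $A$ is a non-empty set $\sigma$ of even-length positions such that $\overline\sigma=\sigma\cup\mathrm{dom}(\sigma)$ is prefix-closed, where $\mathrm{dom}(\sigma)=\{sa\in P_A: |sa|\text{ odd},\exists b.\,sab\in\sigma\}$, and which is history-free: $sab,tac\in\sigma\Rightarrow b=c$; and $sab,t\in\sigma$, $ta\in P_A\Rightarrow tab\in\sigma$. A partial function $f:M_A^O\rightharpoonup M_A^P$ induces $\sigma_f=\mathrm{traces}(f)$, the least set containing $\epsilon$ and with each $s$ all $sab$ such that $sa\in P_A$, $f(a)=b$ (provided it is contained in $P_A$). Write $\sigma\stackrel{\sqsubset}{\approx}\tau$ iff whenever $sab\in\sigma$, $s'\in\tau$, $sa\approx_A s'a'$, there is $b'$ with $s'a'b'\in\tau$ and $sab\approx_A s'a'b'$; $\sigma\approx\tau$ iff $\sigma\stackrel{\sqsubset}{\approx}\tau$ and $\tau\stackrel{\sqsubset}{\approx}\sigma$. $\mathrm{Str}(A)$ is the set of strategies with $\sigma\approx\sigma$. Constructions. $A\multimap B$ has moves $M_A+M_B$; labels $[\overline{\lambda_A},\lambda_B]$ (where $\overline{\lambda_A}$ exchanges $P$ and $O$); positions all $s\in M^\circledast$ whose restrictions to $A$ and $B$ are in $P_A$, $P_B$ and in which every answer is in the same component as its corresponding question; $s\approx t$ iff the restrictions to $A$ and to $B$ are equivalent and $\mathtt{fst}^\star(s)=\mathtt{fst}^\star(t)$. $\mathbf 1=I$ is the game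 with no moves. $!A$ has moves $\omega\times M_A$, $\lambda(i,a)=\lambda_A(a)$, positions all $s\in M_{!A}^\circledast$ with $s\upharpoonright i\in P_A$ for all $i$ and every answer having the same index as its corresponding question; $s\approx t$ iff for some permutation $\pi$ of $\omega$, $s\upharpoonright i\approx_A t\upharpoonright\pi(i)$ for all $i$ and applying $\pi$ to the index sequence of $s$ gives that of $t$. $A\Rightarrow B$ is $!A\multimap B$; note $!I=I$. Composition. For $\sigma$ on $A\multimap B$ and $\tau$ on $B\multimap C$, $\sigma;\tau=\{s\upharpoonright A,C: s\in(M_A+M_B+M_C)^\star,\ s\upharpoonright A,B\in\overline\sigma,\ s\upharpoonright B,C\in\overline\tau\}$ restricted to even length. For $\sigma=\sigma_f$ on $!A\multimap B$ and an injection $p:\omega\times\omega\to\omega$, the promotion $\sigma^\dagger$ on $!A\multimap !B$ is induced by $f^\dagger(p(i,j),a)=(p(i,j'),a')$ if $f(j,a)=(j',a')$, $=(i,b)$ if $f(j,a)=b$; $f^\dagger(i,b)=(p(i,j),a)$ if $f(b)=(j,a)$, $=(i,b')$ if $f(b)=b'$ (up to $\approx$ it does not depend on $p$). For $\sigma\in\mathrm{Str}(A\Rightarrow B)$, $\tau\in\mathrm{Str}(B\Rightarrow C)$, $\tau\circ\sigma=\sigma^\dagger;\tau$. Here $x:\mathbf 1\Rightarrow A$ means $x\in\mathrm{Str}(\mathbf 1\Rightarrow A)$, and similarly for $\beta$. Intrinsic preorder. $\Sigma$ is the game with moves $q$ (label $OQ$), $a$ (label $PA$), positions $\epsilon,q,qa$,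 identity equivalence; $\top=\{\epsilon,qa\}$ and $x\downarrow$ means $x=\top$. For $x,y\in\mathrm{Str}(A)$: $x\lesssim_A y$ iff for all $\alpha\in\mathrm{Str}(A\multimap\Sigma)$, $x;\alpha\downarrow$ implies $y;\alpha\downarrow$ (strategies on $A$ being viewed as strategies on $I\multimap A$). -}

module Defs where

open import Data.Bool.Base using (Bool; true; false)
open import Data.Empty using (⊥)
open import Data.List.Base
  using (List; []; _∷_; _++_; _∷ʳ_; map; mapMaybe; filter; length; foldl; drop; head)
open import Data.Maybe.Base using (Maybe; just; nothing)
open import Data.List.Relation.Unary.Linked using (Linked)
open import Data.Nat.Base using (ℕ; _≤_)
open import Data.Nat.Properties using (_≟_)
open import Data.Nat.Divisibility using (_∣_; _∤_)
open import Data.Product.Base using (_×_; _,_; proj₁; proj₂; ∃; ∃-syntax; Σ-syntax; map₁)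
open import Data.Sum.Base using (_⊎_; inj₁; inj₂; [_,_])
open import Data.Sum using (isInj₁; isInj₂)
open import Function.Base using (_∘′_; const)
open import Function.Bundles using (_↔_; _↣_; Inverse; Injection)
open import Level using (0ℓ)
open import Relation.Binary.Core using (Rel)
open import Relation.Binary.Definitions using (DecidableEquality; Symmetric; Transitive)
open import Relation.Binary.PropositionalEquality.Core using (_≡_; _≢_; refl)
open import Relation.Nullary.Decidable using (yes; no)
open import Relation.Unary using (Pred; Satisfiable; _⊆_; _≐_; _∪_)

data PO : Set where
  player opponent : PO

data QA : Set where
  question answer : QA

opposite : PO → PO
opposite player   = opponent
opposite opponent = player

_≟QA_ : DecidableEquality QA
question ≟QA question = yes refl
question ≟QA answer   = no λ ()
answer   ≟QA question = no λ ()
answer   ≟QA answer   = yes refl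

-- Sequences are lists whose head is the first move.

record RawGame : Set₁ where
  no-eta-equality
  infix 4 _≈_
  field
    Move  : Set
    label : Move → PO × QA
    Pos   : Pred (List Move) 0ℓ
    _≈_   : Rel (List Move) 0ℓ

open RawGame public using (Move; label; Pos)

module _ {M : Set} (label : M → PO × QA) where

  private
    po : M → PO
    po = proj₁ ∘′ label

    qa : M → QA
    qa = proj₂ ∘′ label

  #[_] : QA → List M → ℕ
  #[ k ] s = length (filter (λ m → qa m ≟QA k) s)

  -- The sequences satisfying (p1)-(p3), i.e. M^⊛.
  record Legal (s : List M) : Set where
    field
      O-starts    : ∀ {m t} → s ≡ m ∷ t → po m ≡ opponent
      alternating : Linked (λ m n → po m ≢ po n) s
      bracketed   : ∀ {t u} → s ≡ t ++ u → #[ answer ] t ≤ #[ question ] t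

  updatePending : List M → M → List M
  updatePending qs m with qa m
  ... | question = m ∷ qs
  ... | answer   = drop 1 qs

  -- The unanswered questions of a sequence, most recent first.
  pending : List M → List M
  pending = foldl updatePending []

  -- Every answer has the same tag as the question it corresponds to.
  Matching : {I : Set} → (M → I) → List M → Set
  Matching tag s =
    ∀ {t a u q} → s ≡ t ++ a ∷ u → qa a ≡ answer → head (pending t) ≡ just q →
    tag a ≡ tag q

-- An equivalence relation on the subset Pos is a symmetric, transitive
-- relation on sequences whose domain of reflexivity is exactly Pos.

record IsGame (G : RawGame) : Set where
  open RawGame G using (_≈_)
  field
    legal         : Pos G ⊆ Legal (label G)
    nonEmpty      : Satisfiable (Pos G)
    prefix-closed : ∀ {s t} → Pos G (s ++ t) → Pos G s
    ≈⇒Pos         : ∀ {s t} → s ≈ t → Pos G s × Pos G t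
    ≈-refl        : ∀ {s} → Pos G s → s ≈ s
    ≈-sym         : Symmetric _≈_
    ≈-trans       : Transitive _≈_
    e1            : ∀ {s t} → s ≈ t → map (label G) s ≡ map (label G) t
    e2            : ∀ {s s′ t t′} → s ++ s′ ≈ t ++ t′ → length s ≡ length t → s ≈ t
    e3            : ∀ {s t a} → s ≈ t → Pos G (s ∷ʳ a) → ∃[ b ] (s ∷ʳ a) ≈ (t ∷ʳ b)

-- An arbitrary set of sequences, so that composition and promotion can be
-- defined set-theoretically; the axioms of strategies are in `IsStrategy`.

record RawStrategy (G : RawGame) : Set₁ where
  constructor ⟪_⟫
  field
    plays : Pred (List (Move G)) 0ℓ

open RawStrategy public

module _ {G : RawGame} (σ : RawStrategy G) where

  dom : Pred (List (Move G)) 0ℓ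
  dom t = Pos G t × 2 ∤ length t ×
          ∃[ s ] ∃[ a ] ∃[ b ] t ≡ s ∷ʳ a × plays σ (s ++ a ∷ b ∷ [])

  closure : Pred (List (Move G)) 0ℓ
  closure = plays σ ∪ dom

  record IsStrategy : Set where
    field
      nonEmpty       : Satisfiable (plays σ)
      positions      : plays σ ⊆ Pos G
      even           : ∀ {s} → plays σ s → 2 ∣ length s
      prefix-closed  : ∀ {s t} → closure (s ++ t) → closure s
      history-free   : ∀ {s t a b c} →
                       plays σ (s ++ a ∷ b ∷ []) → plays σ (t ++ a ∷ c ∷ []) → b ≡ c
      history-free-∃ : ∀ {s t a b} →
                       plays σ (s ++ a ∷ b ∷ []) → plays σ t → Pos G (t ∷ʳ a) →
                       plays σ (t ++ a ∷ b ∷ [])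

  -- The graph of the least partial function f with traces(f) = σ, when σ is a
  -- (history-free) strategy.
  fun : Rel (Move G) 0ℓ
  fun a b = ∃[ s ] plays σ (s ++ a ∷ b ∷ [])

data Traces (G : RawGame) (f : Rel (Move G) 0ℓ) : List (Move G) → Set where
  ε    : Traces G f []
  step : ∀ {s a b} → Traces G f s → Pos G (s ∷ʳ a) → f a b →
         Traces G f (s ++ a ∷ b ∷ [])

infix 4 _⊏≈_ _≈ₛ_

_⊏≈_ : {G : RawGame} → Rel (RawStrategy G) 0ℓ
_⊏≈_ {G} σ τ =
  ∀ {s a b s′ a′} → plays σ (s ++ a ∷ b ∷ []) → plays τ s′ → (s ∷ʳ a) ≈ (s′ ∷ʳ a′) →
  ∃[ b′ ] plays τ (s′ ++ a′ ∷ b′ ∷ []) × (s ++ a ∷ b ∷ []) ≈ (s′ ++ a′ ∷ b′ ∷ [])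
  where open RawGame G using (_≈_)

_≈ₛ_ : {G : RawGame} → Rel (RawStrategy G) 0ℓ
σ ≈ₛ τ = σ ⊏≈ τ × τ ⊏≈ σ

record Str (G : RawGame) : Set₁ where
  field
    raw        : RawStrategy G
    isStrategy : IsStrategy raw
    self-≈     : raw ≈ₛ raw

open Str public using (raw)

-- Both the tensor unit I and the terminal game 1.
𝟏 : RawGame
𝟏 .Move             = ⊥
𝟏 .label            ()
𝟏 .Pos s            = s ≡ []
𝟏 .RawGame._≈_ s t = s ≡ [] × t ≡ []

component : {X Y : Set} → X ⊎ Y → Bool
component = [ const false , const true ]

infixr 5 _⊸_ _⇒_

_⊸_ : RawGame → RawGame → RawGame
(G ⊸ H) .Move  = Move G ⊎ Move H
(G ⊸ H) .label = [ map₁ opposite ∘′ label G , label H ]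
(G ⊸ H) .Pos s =
  Legal (label (G ⊸ H)) s ×
  Pos G (mapMaybe isInj₁ s) ×
  Pos H (mapMaybe isInj₂ s) ×
  Matching (label (G ⊸ H)) component s
(G ⊸ H) .RawGame._≈_ s t =
  Pos (G ⊸ H) s × Pos (G ⊸ H) t ×
  (mapMaybe isInj₁ s G.≈ mapMaybe isInj₁ t) ×
  (mapMaybe isInj₂ s H.≈ mapMaybe isInj₂ t) ×
  map component s ≡ map component t
  where
  module G = RawGame G
  module H = RawGame H

infixl 8 _↾_

_↾_ : {M : Set} → List (ℕ × M) → ℕ → List M
s ↾ i = map proj₂ (filter (λ m → proj₁ m ≟ i) s)

! : RawGame → RawGame
! G .Move            = ℕ × Move G
! G .label (i , a)   = label G a
! G .Pos s           =
  Legal (label (! G)) s ×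
  (∀ i → Pos G (s ↾ i)) ×
  Matching (label (! G)) proj₁ s
! G .RawGame._≈_ s t =
  Pos (! G) s × Pos (! G) t ×
  Σ[ π ∈ (ℕ ↔ ℕ) ] (∀ i → s ↾ i G.≈ t ↾ Inverse.to π i) ×
    map (Inverse.to π ∘′ proj₁) s ≡ map proj₁ t
  where
  module G = RawGame G

_⇒_ : RawGame → RawGame → RawGame
G ⇒ H = ! G ⊸ H

module _ {X Y Z : Set} where

  onXY : X ⊎ Y ⊎ Z → Maybe (X ⊎ Y)
  onXY (inj₁ x)        = just (inj₁ x)
  onXY (inj₂ (inj₁ y)) = just (inj₂ y)
  onXY (inj₂ (inj₂ z)) = nothing

  onYZ : X ⊎ Y ⊎ Z → Maybe (Y ⊎ Z)
  onYZ = isInj₂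

  onXZ : X ⊎ Y ⊎ Z → Maybe (X ⊎ Z)
  onXZ (inj₁ x)        = just (inj₁ x)
  onXZ (inj₂ (inj₁ y)) = nothing
  onXZ (inj₂ (inj₂ z)) = just (inj₂ z)

infixl 6 _⨾_

_⨾_ : {G H K : RawGame} →
      RawStrategy (G ⊸ H) → RawStrategy (H ⊸ K) → RawStrategy (G ⊸ K)
plays (σ ⨾ τ) t =
  2 ∣ length t ×
  ∃[ s ] closure σ (mapMaybe onXY s) × closure τ (mapMaybe onYZ s) × t ≡ mapMaybe onXZ s

module Promotion (p : (ℕ × ℕ) ↣ ℕ) where

  private
    ⟨_,_⟩ : ℕ → ℕ → ℕ
    ⟨ i , j ⟩ = Injection.to p (i , j)

  -- The graph of f†, for f given by its graph.
  data Promote {M N : Set} (f : Rel ((ℕ × M) ⊎ N) 0ℓ) :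
               Rel ((ℕ × M) ⊎ (ℕ × N)) 0ℓ where
    left-left   : ∀ {i j j′ a a′} → f (inj₁ (j , a)) (inj₁ (j′ , a′)) →
                  Promote f (inj₁ (⟨ i , j ⟩ , a)) (inj₁ (⟨ i , j′ ⟩ , a′))
    left-right  : ∀ {i j a b} → f (inj₁ (j , a)) (inj₂ b) →
                  Promote f (inj₁ (⟨ i , j ⟩ , a)) (inj₂ (i , b))
    right-left  : ∀ {i j a b} → f (inj₂ b) (inj₁ (j , a)) →
                  Promote f (inj₂ (i , b)) (inj₁ (⟨ i , j ⟩ , a))
    right-right : ∀ {i b b′} → f (inj₂ b) (inj₂ b′) →
                  Promote f (inj₂ (i , b)) (inj₂ (i , b′))

  infixl 10 _†

  _† : {G H : RawGame} → RawStrategy (G ⇒ H) → RawStrategy (! G ⊸ ! H)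
  _† {G} {H} σ = ⟪ Traces (! G ⊸ ! H) (Promote (fun σ)) ⟫

  infixr 9 _∘_

  _∘_ : {G H K : RawGame} →
        RawStrategy (H ⇒ K) → RawStrategy (G ⇒ H) → RawStrategy (G ⇒ K)
  τ ∘ σ = σ † ⨾ τ

data SierpińskiMove : Set where
  ask done : SierpińskiMove

𝕊 : RawGame
𝕊 .Move    = SierpińskiMove
𝕊 .label ask  = opponent , question
𝕊 .label done = player , answer
𝕊 .Pos s   = s ≡ [] ⊎ s ≡ ask ∷ [] ⊎ s ≡ ask ∷ done ∷ []
𝕊 .RawGame._≈_ s t = Pos 𝕊 s × s ≡ t

⊤𝕊 : RawStrategy 𝕊
plays ⊤𝕊 s = s ≡ [] ⊎ s ≡ ask ∷ done ∷ []

-- A strategy on G viewed as one on X ⊸ G; used when X is 𝟏 or ! 𝟏, which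
-- have no moves, so that this is only a retagging.
point : (X : RawGame) {G : RawGame} → RawStrategy G → RawStrategy (X ⊸ G)
plays (point X σ) t = ∃[ s ] plays σ s × t ≡ map inj₂ s

infix 4 _↓

_↓ : {X : RawGame} → RawStrategy (X ⊸ 𝕊) → Set
_↓ {X} σ = plays σ ≐ plays (point X ⊤𝕊)

infix 4 _≲_

_≲_ : {G : RawGame} → Str G → Str G → Set₁
_≲_ {G} x y = (α : Str (G ⊸ 𝕊)) → point 𝟏 (raw x) ⨾ raw α ↓ → point 𝟏 (raw y) ⨾ raw α ↓

{-# OPTIONS --safe #-}
module Submission where

-- A test α on A ⇒ B must open with a move b₁ of B; afterwards the switching
-- condition makes it answer every move of ! A in the same thread and every move
-- of B in B. So it splits into a test γ on B and, for each i, a strategy for the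
-- thread i of ! A; self-equivalence of α under exchanging i with 0 shows that
-- all these strategies are equivalent to the one x for thread 0. Hence α is
-- equivalent to the test built from x and γ, and σ;α converges iff σ ∘ x
-- converges against γ, i.e. iff γ (used once, by dereliction) ∘ σ ∘ x does.
--
-- Conversely β may use several copies of σ ∘ x, whereas ≲ only allows linear
-- tests. In a convergent play of β against copies of σ ∘ x these are replaced by
-- τ ∘ x one at a time, the last opened first. The linear test for a copy j plays
-- β with σ ∘ x in the copies opened before j and τ ∘ x in all others. It is
-- self-equivalent because the play up to the opening of j is the same in all its
-- plays, so the index permutations relating two of them fix the former copies.

open import Data.Bool.Base
  using (false; true)
open import Data.Empty
  using (⊥; ⊥-elim)
open import Data.List.Base
  using (List; []; _++_; _∷_; _∷ʳ_; drop; filter; foldr; head; length; map; mapMaybe;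
         reverse)
open import Data.List.Membership.DecPropositional
  using (_∈?_)
open import Data.List.Membership.Propositional
  using (_∈_; _∉_)
open import Data.List.Properties
  using (++-assoc; ++-identityʳ; filter-++; filter-accept; filter-reject; length-++;
         length-map; length-reverse; map-++; map-injective; mapMaybe-++;
         mapMaybeIsInj₁∘mapInj₂; mapMaybeIsInj₂∘mapInj₂; reverse-++; reverse-foldl;
         reverse-injective; reverse-involutive; reverse-map; unfold-reverse; ∷-injectiveʳ;
         ∷-injectiveˡ)
open import Data.List.Relation.Unary.Any
  using (here; there)
open import Data.List.Relation.Unary.Linked as Linked
  using (Linked)
open import Data.Maybe.Base
  using (Maybe; just; nothing)
  renaming (map to mapₘ)
open import Data.Maybe.Properties
  using (just-injective)
open import Data.Nat.Base
  using (_+_; _≤_; suc; ℕ)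
open import Data.Nat.Divisibility
  using (_∣0; _∣_; _∤_; ∣-refl; ∣1⇒≡1; ∣m+n∣m⇒∣n; ∣m∣n⇒∣m+n)
open import Data.Nat.Properties
  using (+-cancelʳ-≡; +-comm; +-identityʳ; +-suc; <-irrefl; _≟_; m≤m+n; suc-injective;
         ≤-reflexive; ≤-trans)
open import Data.Product.Base
  using (_,_; _×_; proj₁; proj₂; ∃-syntax)
open import Data.Sum
  using (isInj₁; isInj₂)
open import Data.Sum.Base
  using (_⊎_; inj₁; inj₂)
open import Data.Sum.Properties
  using (inj₂-injective)
open import Data.Unit.Base
  using (tt; ⊤)
open import Defs
open import Function.Base
  using (_∘′_; flip)
open import Function.Bundles
  using (Inverse; _↔_; _↣_; _⇔_; mk↔ₛ′; mk⇔)
open import Function.Construct.Identity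
  using (↔-id)
open import Relation.Binary.PropositionalEquality
  using (_≡_; _≢_; cong; cong₂; module ≡-Reasoning; refl; subst; subst₂; sym; trans)
open import Relation.Nullary.Decidable
  using (Dec; no; yes)

-- Legal sequences

-- Two constructions hide part of a play: `σ ∘ x` hides the moves in `! A`, and the linear test for
-- one copy hides all other copies of `B`. Both are instances of one construction, an agent whose
-- hidden moves are answered by a history-free environment. The obstacle there is self-equivalence:
-- the hypothesis compares visible parts only, so the equivalence of the hidden parts has to be
-- rebuilt round by round, together with its permutation of indices. Such a permutation might carry
-- a copy played by `σ ∘ x` to one played by `τ ∘ x`; fixing an initial play rules this out. The
-- order of replacement has the same origin: a replacement may change everything played after the
-- opening of the copy, so only copies opened earlier can be kept for later stages. In every
-- promotion that occurs the source is `𝟏`, which has no moves, so to promote is to play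
-- independently in each thread.

opposite-involutive : ∀ x → opposite (opposite x) ≡ x
opposite-involutive player   = refl
opposite-involutive opponent = refl

opposite-adjoint : ∀ {x y} → opposite x ≡ y → x ≡ opposite y
opposite-adjoint {player}   refl = refl
opposite-adjoint {opponent} refl = refl

opposite-≢ : ∀ {x} → opposite x ≢ x
opposite-≢ {player} ()
opposite-≢ {opponent} ()

≢⇒opposite : ∀ {x y} → x ≢ y → x ≡ opposite y
≢⇒opposite {player}   {player}   x≢y = ⊥-elim (x≢y refl)
≢⇒opposite {player}   {opponent} _   = refl
≢⇒opposite {opponent} {player}   _   = refl
≢⇒opposite {opponent} {opponent} x≢y = ⊥-elim (x≢y refl)

player≢opponent : player ≢ opponent
player≢opponent ()

answer≢question : answer ≢ question
answer≢question ()

-- Throughout, sequences are kept in reverse order: the head is the latest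
-- move.

turn : {M : Set} → List M → PO
turn []      = opponent
turn (_ ∷ r) = opposite (turn r)

module _ {X : Set} where

  reverse-split : ∀ {r t u : List X} → reverse r ≡ t ++ u → r ≡ reverse u ++ reverse t
  reverse-split {r} {t} {u} eq =
    trans (sym (reverse-involutive r)) (trans (cong reverse eq) (reverse-++ t u))

  reverse-split-∷ : ∀ {r t : List X} {a u} → reverse r ≡ t ++ a ∷ u →
                    r ≡ reverse u ++ a ∷ reverse t
  reverse-split-∷ {r} {t} {a} {u} eq = trans (reverse-split {r} {t} eq)
    (trans (cong (_++ reverse t) (unfold-reverse a u)) (++-assoc (reverse u) _ _))

  reverse-∷∷ : ∀ (b a : X) r → reverse (b ∷ a ∷ r) ≡ reverse r ++ a ∷ b ∷ []
  reverse-∷∷ b a r = trans (unfold-reverse b (a ∷ r))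
    (trans (cong (_∷ʳ b) (unfold-reverse a r)) (++-assoc (reverse r) _ _))

  linked⁺ : ∀ {R : X → X → Set} s → (∀ {t a b u} → s ≡ t ++ a ∷ b ∷ u → R a b) → Linked R s
  linked⁺ []          _ = Linked.[]
  linked⁺ (_ ∷ [])    _ = Linked.[-]
  linked⁺ (x ∷ y ∷ s) f = f {[]} refl Linked.∷ linked⁺ (y ∷ s) λ {t} eq → f {x ∷ t} (cong (x ∷_) eq)

  linked⁻ : ∀ {R : X → X → Set} t {a b u} → Linked R (t ++ a ∷ b ∷ u) → R a b
  linked⁻ []          (r Linked.∷ _) = r
  linked⁻ (_ ∷ [])    (_ Linked.∷ l) = linked⁻ [] l
  linked⁻ (_ ∷ y ∷ t) (_ Linked.∷ l) = linked⁻ (y ∷ t) l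

  linked-init : ∀ {R : X → X → Set} s {m} → Linked R (s ∷ʳ m) → Linked R s
  linked-init {R} s {m} l = linked⁺ s λ {t} {a} {b} {u} eq →
    linked⁻ {R} t (subst (Linked R) (trans (cong (_∷ʳ m) eq) (++-assoc t (a ∷ b ∷ u) _)) l)

module Sequence {M : Set} (label : M → PO × QA) where

  po : M → PO
  po m = proj₁ (label m)

  qa : M → QA
  qa m = proj₂ (label m)

  pend : List M → List M
  pend = foldr (flip (updatePending label)) []

  updatePending-question : ∀ qs {m} → qa m ≡ question → updatePending label qs m ≡ m ∷ qs
  updatePending-question qs {m} eq with proj₂ (label m)
  updatePending-question qs refl | question = refl

  updatePending-answer : ∀ qs {m} → qa m ≡ answer → updatePending label qs m ≡ drop 1 qs
  updatePending-answer qs {m} eq with proj₂ (label m)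
  updatePending-answer qs refl | answer = refl

  pending-reverse : ∀ r → pending label (reverse r) ≡ pend r
  pending-reverse = reverse-foldl (updatePending label) []

  #-∷ʳ-hit : ∀ k s {m} → qa m ≡ k → #[_] label k (s ∷ʳ m) ≡ suc (#[_] label k s)
  #-∷ʳ-hit k s {m} eq = begin
    length (filter is (s ∷ʳ m))                    ≡⟨ cong length (filter-++ is s _) ⟩
    length (filter is s ++ filter is (m ∷ []))     ≡⟨ length-++ (filter is s) ⟩
    #[_] label k s + length (filter is (m ∷ []))   ≡⟨ cong (λ l → _ + length l) (filter-accept is eq) ⟩
    #[_] label k s + 1                             ≡⟨ +-comm _ 1 ⟩
    suc (#[_] label k s)                           ∎
    where open ≡-Reasoning
          is = λ n → qa n ≟QA k

  #-∷ʳ-miss : ∀ k s {m} → qa m ≢ k → #[_] label k (s ∷ʳ m) ≡ #[_] label k s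
  #-∷ʳ-miss k s {m} neq = begin
    length (filter is (s ∷ʳ m))                    ≡⟨ cong length (filter-++ is s _) ⟩
    length (filter is s ++ filter is (m ∷ []))     ≡⟨ length-++ (filter is s) ⟩
    #[_] label k s + length (filter is (m ∷ []))   ≡⟨ cong (λ l → _ + length l) (filter-reject is neq) ⟩
    #[_] label k s + 0                             ≡⟨ +-identityʳ _ ⟩
    #[_] label k s                                 ∎
    where open ≡-Reasoning
          is = λ n → qa n ≟QA k

  module Tagged {I : Set} (tag : M → I) where

    data Fits (m : M) (r : List M) : Set where
      asks    : qa m ≡ question → Fits m r
      answers : ∀ {q qs} → qa m ≡ answer → pend r ≡ q ∷ qs → tag m ≡ tag q → Fits m r

    -- `Legal` and `Matching` quantify over all decompositions of a sequence; here each move is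
    -- checked against its past only. Polarity is fixed by parity, and asking for a pending question
    -- under each answer replaces (p3). With a constant tag this is `Legal` alone.
    data OK : List M → Set where
      []  : OK []
      cons : ∀ {m r} → po m ≡ turn r → Fits m r → OK r → OK (m ∷ r)

    OK-suffix : ∀ u {r} → OK (u ++ r) → OK r
    OK-suffix []      ok            = ok
    OK-suffix (_ ∷ u) (cons _ _ ok) = OK-suffix u ok

    -- Links the counting condition (p3) to the stack: the surplus of questions over answers is the
    -- height of the stack.
    count : ∀ {r} → OK r →
            #[_] label question (reverse r) ≡ #[_] label answer (reverse r) + length (pend r)
    count [] = refl
    count {m ∷ r} (cons _ (asks eq) ok)
      rewrite unfold-reverse m r
            | #-∷ʳ-hit question (reverse r) eq
            | #-∷ʳ-miss answer (reverse r) (λ eq′ → answer≢question (trans (sym eq′) eq))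
            | updatePending-question (pend r) eq
      = trans (cong suc (count ok)) (sym (+-suc _ _))
    count {m ∷ r} (cons _ (answers {q} {qs} eq peq _) ok)
      rewrite unfold-reverse m r
            | #-∷ʳ-hit answer (reverse r) eq
            | #-∷ʳ-miss question (reverse r) (λ eq′ → answer≢question (trans (sym eq) eq′))
            | updatePending-answer (pend r) eq
      = trans (count ok) (trans (cong (λ l → #A + length l) peq)
          (trans (+-suc #A (length qs)) (cong (λ l → suc (#A + length (drop 1 l))) (sym peq))))
      where #A = #[_] label answer (reverse r)

    Legal-init : ∀ s {m} → Legal label (s ∷ʳ m) → Legal label s
    Legal-init s {m} l = record
      { O-starts    = λ eq → O-starts (cong (_∷ʳ m) eq)
      ; alternating = linked-init s alternating
      ; bracketed   = λ {t} {u} eq → bracketed {t} (trans (cong (_∷ʳ m) eq) (++-assoc t u _))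
      } where open Legal l

    Matching-init : ∀ s {m} → Matching label tag (s ∷ʳ m) → Matching label tag s
    Matching-init s {m} f {t} {a} {u} eq = f (trans (cong (_∷ʳ m) eq) (++-assoc t (a ∷ u) _))

    toOK : ∀ r → Legal label (reverse r) → Matching label tag (reverse r) → OK r
    toOK []      _ _ = []
    toOK (m ∷ r) legal match = cons (po-ok r refl) fits ok
      where
      eqr = unfold-reverse m r
      legal′ = subst (Legal label) eqr legal
      match′ : Matching label tag (reverse r ∷ʳ m)
      match′ = subst (λ s → Matching label tag s) eqr (λ {t} {a} {u} {q} → match {t} {a} {u} {q})
      ok = toOK r (Legal-init (reverse r) legal′)
                  (λ {t} {a} {u} {q} → Matching-init (reverse r) match′ {t} {a} {u} {q})
      po-ok : ∀ r′ → r′ ≡ r → po m ≡ turn r′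
      po-ok []       refl = Legal.O-starts legal′ refl
      po-ok (n ∷ r′) refl with ok
      ... | cons n-ok _ _ = trans (≢⇒opposite (λ eq → linked⁻ (reverse r′)
              (subst (Linked _) (reverse-∷∷ m n r′) (Legal.alternating legal)) (sym eq)))
              (cong opposite n-ok)
      fits : Fits m r
      fits with qa m in eq
      ... | question = asks eq
      ... | answer with pend r in peq | count ok
      ...   | q ∷ qs | _ = answers eq peq
                (match′ refl eq (cong head (trans (pending-reverse r) peq)))
      -- With an empty stack, `count` makes questions and answers equal in number before `m`, so the
      -- answer `m` would violate (p3).
      ...   | [] | ceq = ⊥-elim (<-irrefl refl (subst₂ _≤_ (#-∷ʳ-hit answer (reverse r) eq)
                (trans (#-∷ʳ-miss question (reverse r) (λ eq′ → answer≢question (trans (sym eq) eq′)))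
                       (trans ceq (+-identityʳ _)))
                (Legal.bracketed legal′ {reverse r ∷ʳ m} (sym (++-identityʳ _)))))

    OK⇒Legal : ∀ {r} → OK r → Legal label (reverse r)
    OK⇒Legal {r} ok = record
      { O-starts    = λ {m} {t} eq → first (OK-suffix (reverse t)
                        (subst OK (reverse-split-∷ {r = r} {t = []} eq) ok))
      ; alternating = linked⁺ (reverse r) λ {t} {a} {b} {u} eq → alternate (OK-suffix (reverse u)
                        (subst OK (trans (reverse-split {r = r} {t = t} eq)
                          (trans (cong (_++ reverse t) (reverse-∷∷∷ʳ a b u))
                                 (++-assoc (reverse u) _ _))) ok))
      ; bracketed   = λ {t} {u} eq → subst (λ s → #[_] label answer s ≤ #[_] label question s)
                        (reverse-involutive t)
                        (≤-trans (m≤m+n _ _) (≤-reflexive (sym (count (OK-suffix (reverse u)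
                          (subst OK (reverse-split {r = r} {t = t} eq) ok))))))
      }
      where
      first : ∀ {m} → OK (m ∷ []) → po m ≡ opponent
      first (cons eq _ _) = eq
      alternate : ∀ {a b r} → OK (b ∷ a ∷ r) → po a ≢ po b
      alternate (cons eq _ (cons eq′ _ _)) eq″ =
        opposite-≢ (trans (sym eq) (trans (sym eq″) eq′))
      reverse-∷∷∷ʳ : ∀ (a b : M) u → reverse (a ∷ b ∷ u) ≡ reverse u ++ b ∷ a ∷ []
      reverse-∷∷∷ʳ = reverse-∷∷

    OK⇒Matching : ∀ {r} → OK r → Matching label tag (reverse r)
    OK⇒Matching {r} ok {t} {a} {u} {q} eq a-answer hd
      with OK-suffix (reverse u) (subst OK (reverse-split-∷ {r = r} {t = t} eq) ok)
    ... | cons _ (asks a-question) _ with () ← trans (sym a-answer) a-question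
    ... | cons _ (answers {q′} _ peq tags) _ = trans tags (cong tag (just-injective
            (trans (cong head (sym peq))
              (trans (cong head (trans (sym (pending-reverse (reverse t)))
                                       (cong (pending label) (reverse-involutive t)))) hd))))

open Sequence
open Tagged

opposite-≢⇒≡ : ∀ {x y} → opposite x ≢ y → x ≡ y
opposite-≢⇒≡ ne = trans (sym (opposite-involutive _)) (trans (cong opposite (≢⇒opposite ne)) (opposite-involutive _))

module _ {M I J : Set} {label : M → PO × QA} {tag : M → I} (f : I → J) where

  OK-retag : ∀ {r} → OK label tag r → OK label (f ∘′ tag) r
  OK-retag [] = []
  OK-retag (cons p (asks q) ok) = cons p (asks q) (OK-retag ok)
  OK-retag (cons p (answers a eq t) ok) = cons p (answers a eq (cong f t)) (OK-retag ok)

module _ {M M′ I : Set} {label : M′ → PO × QA} {tag : M′ → I} (f : M → M′) where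

  turn-map : ∀ r → turn (map f r) ≡ turn r
  turn-map []      = refl
  turn-map (_ ∷ r) = cong opposite (turn-map r)

  pend-map : ∀ r → pend label (map f r) ≡ map f (pend (label ∘′ f) r)
  pend-map [] = refl
  pend-map (m ∷ r) rewrite pend-map r with proj₂ (label (f m)) | pend (label ∘′ f) r
  ... | question | _      = refl
  ... | answer   | []     = refl
  ... | answer   | _ ∷ _  = refl

  OK-map⁺ : ∀ {r} → OK (label ∘′ f) (tag ∘′ f) r → OK label tag (map f r)
  OK-map⁺ [] = []
  OK-map⁺ {m ∷ r} (cons p (asks q) ok) = cons (trans p (sym (turn-map r))) (asks q) (OK-map⁺ ok)
  OK-map⁺ {m ∷ r} (cons p (answers a eq t) ok) =
    cons (trans p (sym (turn-map r))) (answers a (trans (pend-map r) (cong (map f) eq)) t) (OK-map⁺ ok)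

-- The stack of pending questions of a sequence in which one player, the
-- follower, always moves with the same tag as the preceding move.
module _ {M I : Set} {label : M → PO × QA} {tag : M → I} (follower : PO) where

  Follows : List M → Set
  Follows []          = ⊤
  Follows (_ ∷ [])    = ⊤
  Follows (m ∷ n ∷ r) = (turn (n ∷ r) ≡ follower → tag m ≡ tag n) × Follows (n ∷ r)

  -- The shape of the stack after a move of the follower: each pending question of the follower lies
  -- on a question of the leader with the same tag. If the follower opens the play, the opening
  -- question is left alone at the bottom.
  data Paired : List M → Set where
    []   : Paired []
    [_]  : ∀ q → Paired (q ∷ [])
    pair : ∀ {m q qs} → tag m ≡ tag q → Paired qs → Paired (m ∷ q ∷ qs)

  data Top (l : M) : List M → Set where
    []  : Top l []
    top : ∀ {q qs} → tag q ≡ tag l → Paired qs → Top l (q ∷ qs)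

  StackInv : List M → Set
  StackInv []      = ⊤
  StackInv (l ∷ r) = (turn (l ∷ r) ≢ follower → Paired (pend label (l ∷ r))) ×
                     (turn (l ∷ r) ≡ follower → Top l (pend label (l ∷ r)))

  private

    pop : ∀ {m qs} → Paired qs → ∀ {q qs′} → qs ≡ q ∷ qs′ → tag m ≡ tag q → Top m (drop 1 qs)
    pop [ q ]        refl eq = []
    pop (pair eq′ p) refl eq = top (sym (trans eq eq′)) p

    lead : ∀ {m r} → Fits label tag m r → Paired (pend label r) → Top m (pend label (m ∷ r))
    lead {m} {r} (asks q) p rewrite updatePending-question label (pend label r) q = top refl p
    lead {m} {r} (answers a peq t) p rewrite updatePending-answer label (pend label r) a = pop p peq t

    follow : ∀ {l m r} → Fits label tag m r → tag m ≡ tag l → Top l (pend label r) →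
             Paired (pend label (m ∷ r))
    follow {l} {m} {r} (asks q) eq t rewrite updatePending-question label (pend label r) q
      with pend label r | t
    ... | _ | []        = [ _ ]
    ... | _ | top eq′ p = pair (trans eq (sym eq′)) p
    follow {l} {m} {r} (answers a _ _) eq t rewrite updatePending-answer label (pend label r) a
      with pend label r | t
    ... | _ | []      = []
    ... | _ | top _ p = p

  stackInv : ∀ {r} → OK label tag r → Follows r → StackInv r
  stackInv [] _ = tt
  stackInv {m ∷ []} (cons _ fits []) _ =
    (λ _ → first fits) , λ _ → lead fits []
    where
    first : Fits label tag m [] → Paired (pend label (m ∷ []))
    first (asks q) rewrite updatePending-question label [] {m} q = [ _ ]
  stackInv {m ∷ n ∷ r} (cons _ fits ok) (f , fs) with stackInv ok fs
  ... | led , followed =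
    (λ ne → let e = opposite-≢⇒≡ ne in follow fits (f e) (followed e)) ,
    (λ e → lead fits (led λ e′ → opposite-≢ (trans e (sym e′))))

  -- This is why bracketing may be checked inside one component: an answer of the follower, given
  -- where the last move was made, meets a pending question from the same place.
  top-tag : ∀ {l r q qs} → OK label tag (l ∷ r) → Follows (l ∷ r) → turn (l ∷ r) ≡ follower →
            pend label (l ∷ r) ≡ q ∷ qs → tag q ≡ tag l
  top-tag ok fs eq peq with stackInv ok fs
  ... | _ , followed with subst (Top _) peq (followed eq)
  ...   | top eq′ _ = eq′

module _ {M M′ I : Set} (label : M → PO × QA) (tag : M → I) (label′ : M′ → PO × QA) (c : I) where

  -- Covers both the components of `⊸` and the threads of `!`. Only the question/answer labels are
  -- compared, since the left component of `⊸` has its polarities reversed.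
  data Restricts : List M → List M′ → Set where
    []   : Restricts [] []
    hit  : ∀ {m r m′ r′} → tag m ≡ c → qa label m ≡ qa label′ m′ → Restricts r r′ →
           Restricts (m ∷ r) (m′ ∷ r′)
    miss : ∀ {m r r′} → tag m ≢ c → Restricts r r′ → Restricts (m ∷ r) r′

  private

    drop-hit : ∀ {q qs r′} → tag q ≡ c → Restricts (q ∷ qs) r′ → Restricts qs (drop 1 r′)
    drop-hit _  (hit _ _ rs) = rs
    drop-hit eq (miss ne _)  = ⊥-elim (ne eq)

    drop-miss : ∀ {q qs r′} → tag q ≢ c → Restricts (q ∷ qs) r′ → Restricts qs r′
    drop-miss ne (hit eq _ _) = ⊥-elim (ne eq)
    drop-miss _  (miss _ rs)  = rs

  -- An answer removes a question with its own tag, so taking the stack commutes with restriction to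
  -- a tag.
  pend-restricts : ∀ {r r′} → OK label tag r → Restricts r r′ →
                   Restricts (pend label r) (pend label′ r′)
  pend-restricts [] [] = []
  pend-restricts {m ∷ r} {m′ ∷ r′} (cons _ (asks q) ok) (hit eq qeq rs)
    rewrite updatePending-question label (pend label r) {m} q
          | updatePending-question label′ (pend label′ r′) {m′} (trans (sym qeq) q)
    = hit eq qeq (pend-restricts ok rs)
  pend-restricts {m ∷ r} {r′} (cons _ (asks q) ok) (miss ne rs)
    rewrite updatePending-question label (pend label r) {m} q = miss ne (pend-restricts ok rs)
  pend-restricts {m ∷ r} {m′ ∷ r′} (cons _ (answers a peq t) ok) (hit eq qeq rs)
    rewrite updatePending-answer label (pend label r) {m} a
          | updatePending-answer label′ (pend label′ r′) {m′} (trans (sym qeq) a)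
    with pend label r | peq | pend-restricts ok rs
  ... | _ | refl | rs′ = drop-hit (trans (sym t) eq) rs′
  pend-restricts {m ∷ r} {r′} (cons _ (answers a peq t) ok) (miss ne rs)
    rewrite updatePending-answer label (pend label r) {m} a
    with pend label r | peq | pend-restricts ok rs
  ... | _ | refl | rs′ = drop-miss (λ eq → ne (trans t eq)) rs′

  pend-restricts-[] : ∀ {r r′} → OK label tag r → Restricts r r′ → pend label r ≡ [] →
                      pend label′ r′ ≡ []
  pend-restricts-[] {r} {r′} ok rs eq with pend label r | pend-restricts ok rs
  pend-restricts-[] ok rs refl | _ | rs′ = empty rs′
    where empty : ∀ {u} → Restricts [] u → u ≡ []
          empty [] = refl

-- Positions of games and their constructions

-- A record, so that the type determines `r`, which `Pos G (reverse r)` by itself does not.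
record Position (G : RawGame) (r : List (Move G)) : Set where
  constructor ⟨_⟩
  field position : Pos G (reverse r)

record Equiv (G : RawGame) (r r′ : List (Move G)) : Set where
  constructor ⟨_⟩
  field equiv : RawGame._≈_ G (reverse r) (reverse r′)

open Position
open Equiv

-- Consequences of the game axioms that `⊸` and `!` inherit from their arguments; compound games are
-- handled through them instead of through `IsGame`.
record Laws (G : RawGame) : Set where
  field
    ok     : ∀ {r} → Position G r → OK (label G) (λ _ → tt) r
    init   : ∀ {m r} → Position G (m ∷ r) → Position G r
    nil    : Position G []
    ≈-pos₁ : ∀ {r r′} → Equiv G r r′ → Position G r
    ≈-pos₂ : ∀ {r r′} → Equiv G r r′ → Position G r′
    ≈-refl : ∀ {r} → Position G r → Equiv G r r
    ≈-length : ∀ {r r′} → Equiv G r r′ → length r ≡ length r′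

  polarity : ∀ {m r} → Position G (m ∷ r) → po (label G) m ≡ turn r
  polarity p with ok p
  ... | cons eq _ _ = eq

  nonempty-pend : ∀ {m r} → Position G (m ∷ r) → qa (label G) m ≡ answer → pend (label G) r ≢ []
  nonempty-pend p a eq with ok p
  ... | cons _ (asks q) _ = answer≢question (trans (sym a) q)
  ... | cons _ (answers _ peq _) _ with () ← trans (sym eq) peq

module _ {G : RawGame} (isGame : IsGame G) where

  private module G = IsGame isGame

  game-≈-length : ∀ {r r′} → Equiv G r r′ → length r ≡ length r′
  game-≈-length {r} {r′} ⟨ e ⟩ = trans (sym (len r)) (trans (cong length (G.e1 e)) (len r′))
    where len : ∀ r → length (map (label G) (reverse r)) ≡ length r
          len r = trans (length-map _ (reverse r)) (length-reverse r)

  game-laws : Laws G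
  game-laws = record
    { ok     = λ {r} (⟨ p ⟩) → toOK _ _ r (G.legal p) (λ _ _ _ → refl)
    ; init   = λ {m} {r} (⟨ p ⟩) → ⟨ G.prefix-closed (subst (Pos G) (unfold-reverse m r) p) ⟩
    ; nil    = ⟨ G.prefix-closed (proj₂ G.nonEmpty) ⟩
    ; ≈-pos₁ = λ (⟨ e ⟩) → ⟨ proj₁ (G.≈⇒Pos e) ⟩
    ; ≈-pos₂ = λ (⟨ e ⟩) → ⟨ proj₂ (G.≈⇒Pos e) ⟩
    ; ≈-refl = λ (⟨ p ⟩) → ⟨ G.≈-refl p ⟩
    ; ≈-length = game-≈-length
    }

  ≈-init : ∀ {m r m′ r′} → Equiv G (m ∷ r) (m′ ∷ r′) → Equiv G r r′
  ≈-init {m} {r} {m′} {r′} e = ⟨ G.e2 (subst₂ (RawGame._≈_ G) (unfold-reverse m r) (unfold-reverse m′ r′) (equiv e))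
    (trans (length-reverse r) (trans (suc-injective (game-≈-length e)) (sym (length-reverse r′)))) ⟩

module _ {X Y : Set} where

  left : List (X ⊎ Y) → List X
  left = mapMaybe isInj₁

  right : List (X ⊎ Y) → List Y
  right = mapMaybe isInj₂

mapMaybe-reverse : {X Y : Set} (f : X → Maybe Y) → ∀ r → mapMaybe f (reverse r) ≡ reverse (mapMaybe f r)
mapMaybe-reverse f [] = refl
mapMaybe-reverse f (m ∷ r) = trans (cong (mapMaybe f) (unfold-reverse m r))
  (trans (mapMaybe-++ f (reverse r) (m ∷ [])) (trans (cong (_++ mapMaybe f (m ∷ [])) (mapMaybe-reverse f r)) lemma))
  where
  lemma : reverse (mapMaybe f r) ++ mapMaybe f (m ∷ []) ≡ reverse (mapMaybe f (m ∷ r))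
  lemma with f m
  ... | just y  = sym (unfold-reverse y (mapMaybe f r))
  ... | nothing = ++-identityʳ _

module _ {M : Set} where

  ↾-hit : ∀ i (m : M) r → ((i , m) ∷ r) ↾ i ≡ m ∷ r ↾ i
  ↾-hit i m r = cong (map proj₂) (filter-accept (λ m → proj₁ m ≟ i) refl)

  ↾-miss : ∀ {i k} (m : M) r → i ≢ k → ((i , m) ∷ r) ↾ k ≡ r ↾ k
  ↾-miss {k = k} m r i≢k = cong (map proj₂) (filter-reject (λ m → proj₁ m ≟ k) i≢k)

  ↾-++ : ∀ k (r u : List (ℕ × M)) → (r ++ u) ↾ k ≡ r ↾ k ++ u ↾ k
  ↾-++ k r u = trans (cong (map proj₂) (filter-++ (λ m → proj₁ m ≟ k) r u)) (map-++ proj₂ (filter _ r) _)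

  ↾-reverse : ∀ k (r : List (ℕ × M)) → reverse r ↾ k ≡ reverse (r ↾ k)
  ↾-reverse k [] = refl
  ↾-reverse k ((i , m) ∷ r) = lemma (i ≟ k)
    where
    unfolded = trans (cong (_↾ k) (unfold-reverse (i , m) r)) (↾-++ k (reverse r) _)
    lemma : Dec (i ≡ k) → reverse ((i , m) ∷ r) ↾ k ≡ reverse (((i , m) ∷ r) ↾ k)
    lemma (yes refl) = trans unfolded (trans (cong₂ _++_ (↾-reverse k r) (↾-hit i m []))
      (sym (trans (cong reverse (↾-hit i m r)) (unfold-reverse m (r ↾ k)))))
    lemma (no i≢k) = trans unfolded (trans (cong₂ _++_ (↾-reverse k r) (↾-miss m [] i≢k))
      (trans (++-identityʳ _) (sym (cong reverse (↾-miss m r i≢k)))))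

-- Linear function space: switching and extension of positions

module _ {G H : RawGame} where

  ⊸-split : ∀ {r} → Position (G ⊸ H) r →
            OK (label (G ⊸ H)) component r × Position G (left r) × Position H (right r)
  ⊸-split {r} ⟨ l , g , h , m ⟩ = toOK _ _ r l (λ {t} {a} {u} {q} → m {t} {a} {u} {q}) ,
    ⟨ subst (Pos G) (mapMaybe-reverse isInj₁ r) g ⟩ , ⟨ subst (Pos H) (mapMaybe-reverse isInj₂ r) h ⟩

  ⊸-join : ∀ {r} → OK (label (G ⊸ H)) component r → Position G (left r) → Position H (right r) →
           Position (G ⊸ H) r
  ⊸-join {r} ok ⟨ g ⟩ ⟨ h ⟩ = ⟨ OK⇒Legal _ _ ok , subst (Pos G) (sym (mapMaybe-reverse isInj₁ r)) g ,
    subst (Pos H) (sym (mapMaybe-reverse isInj₂ r)) h ,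
    (λ {t} {a} {u} {q} → OK⇒Matching _ _ ok {t} {a} {u} {q}) ⟩

  record ⊸-Equiv (r r′ : List (Move G ⊎ Move H)) : Set where
    constructor equivs
    field
      pos₁    : Position (G ⊸ H) r
      pos₂    : Position (G ⊸ H) r′
      lefts   : Equiv G (left r) (left r′)
      rights  : Equiv H (right r) (right r′)
      tags    : map component r ≡ map component r′

  ⊸-≈-split : ∀ {r r′} → Equiv (G ⊸ H) r r′ → ⊸-Equiv r r′
  ⊸-≈-split {r} {r′} ⟨ p , p′ , l , h , t ⟩ = equivs ⟨ p ⟩ ⟨ p′ ⟩
    ⟨ subst₂ (RawGame._≈_ G) (mapMaybe-reverse isInj₁ r) (mapMaybe-reverse isInj₁ r′) l ⟩
    ⟨ subst₂ (RawGame._≈_ H) (mapMaybe-reverse isInj₂ r) (mapMaybe-reverse isInj₂ r′) h ⟩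
    (reverse-injective (trans (sym (reverse-map component r)) (trans t (reverse-map component r′))))

  ⊸-≈-join : ∀ {r r′} → ⊸-Equiv r r′ → Equiv (G ⊸ H) r r′
  ⊸-≈-join {r} {r′} (equivs ⟨ p ⟩ ⟨ p′ ⟩ ⟨ l ⟩ ⟨ h ⟩ t) = ⟨ p , p′ ,
    subst₂ (RawGame._≈_ G) (sym (mapMaybe-reverse isInj₁ r)) (sym (mapMaybe-reverse isInj₁ r′)) l ,
    subst₂ (RawGame._≈_ H) (sym (mapMaybe-reverse isInj₂ r)) (sym (mapMaybe-reverse isInj₂ r′)) h ,
    trans (reverse-map component r) (trans (cong reverse t) (sym (reverse-map component r′))) ⟩

  module Lolli (LG : Laws G) (LH : Laws H) where

    private
      module LG = Laws LG
      module LH = Laws LH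
      L : Move G ⊎ Move H → PO × QA
      L = label (G ⊸ H)

    init-⊸ : ∀ {m r} → Position (G ⊸ H) (m ∷ r) → Position (G ⊸ H) r
    init-⊸ {inj₁ g} p with ⊸-split p
    ... | cons _ _ ok , pg , ph = ⊸-join ok (LG.init pg) ph
    init-⊸ {inj₂ h} p with ⊸-split p
    ... | cons _ _ ok , pg , ph = ⊸-join ok pg (LH.init ph)

    ⊸-laws : Laws (G ⊸ H)
    ⊸-laws = record
      { ok     = λ p → OK-retag (λ _ → tt) (proj₁ (⊸-split p))
      ; init   = init-⊸
      ; nil    = ⊸-join [] LG.nil LH.nil
      ; ≈-pos₁ = λ e → ⊸-Equiv.pos₁ (⊸-≈-split e)
      ; ≈-pos₂ = λ e → ⊸-Equiv.pos₂ (⊸-≈-split e)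
      ; ≈-refl = λ p → ⊸-≈-join (equivs p p (LG.≈-refl (proj₁ (proj₂ (⊸-split p))))
                                            (LH.≈-refl (proj₂ (proj₂ (⊸-split p)))) refl)
      ; ≈-length = λ {r} {r′} e → trans (sym (length-map component r))
          (trans (cong length (⊸-Equiv.tags (⊸-≈-split e))) (length-map component r′))
      }

    -- Whose turn it is in G ⊸ H, in G and in H.
    data State : PO → PO → PO → Set where
      both-even : State opponent opponent opponent
      in-play   : State player   opponent player
      both-odd  : State opponent player   player

    private

      step-left : ∀ {x t a b} → State t a b → opposite x ≡ t → x ≡ a → State (opposite t) (opposite a) b
      step-left both-even () refl
      step-left in-play   _ _ = both-odd
      step-left both-odd  _ _ = in-play

      step-right : ∀ {x t a b} → State t a b → x ≡ t → x ≡ b → State (opposite t) a (opposite b)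
      step-right both-even _ _ = in-play
      step-right in-play   _ _ = both-even
      step-right both-odd refl ()

      po-⊸ : ∀ {m r} → Position (G ⊸ H) (m ∷ r) → po L m ≡ turn r
      po-⊸ p with proj₁ (⊸-split p)
      ... | cons eq _ _ = eq

      po-left : ∀ {g r} → Position (G ⊸ H) (inj₁ g ∷ r) → po (label G) g ≡ turn (left r)
      po-left p = LG.polarity (proj₁ (proj₂ (⊸-split p)))

      po-right : ∀ {h r} → Position (G ⊸ H) (inj₂ h ∷ r) → po (label H) h ≡ turn (right r)
      po-right p = LH.polarity (proj₂ (proj₂ (⊸-split p)))

    -- Three of the eight combinations are reachable. In the two of them where Opponent moves,
    -- polarity leaves a single component, namely that of the last move: this is the switching
    -- condition.
    state : ∀ {r} → Position (G ⊸ H) r → State (turn r) (turn (left r)) (turn (right r))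
    state {[]}         p = both-even
    state {inj₁ g ∷ r} p = step-left (state (init-⊸ p)) (po-⊸ p) (po-left p)
    state {inj₂ h ∷ r} p = step-right (state (init-⊸ p)) (po-⊸ p) (po-right p)

    private

      after-left : ∀ {t a b} → State t a b → t ≡ player → State (opposite t) (opposite a) b → opposite a ≡ player
      after-left in-play _ _ = refl

      after-right : ∀ {t a b} → State t a b → t ≡ player → State (opposite t) a (opposite b) → opposite b ≡ opponent
      after-right in-play _ _ = refl

    turn-left : ∀ {g r} → Position (G ⊸ H) (inj₁ g ∷ r) → turn (inj₁ g ∷ r) ≡ opponent →
                turn (g ∷ left r) ≡ player
    turn-left {g} {r} p eq = after-left (state (init-⊸ p)) (opposite-adjoint eq) (state p)

    turn-right : ∀ {h r} → Position (G ⊸ H) (inj₂ h ∷ r) → turn (inj₂ h ∷ r) ≡ opponent →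
                 turn (h ∷ right r) ≡ opponent
    turn-right {h} {r} p eq = after-right (state (init-⊸ p)) (opposite-adjoint eq) (state p)

    private

      oo-left : ∀ {x t a b} → State t a b → t ≡ opponent → a ≡ player → x ≡ t → x ≡ b → ⊥
      oo-left both-odd _ _ refl ()

      oo-right : ∀ {x t a b} → State t a b → t ≡ opponent → b ≡ opponent → opposite x ≡ t → x ≡ a → ⊥
      oo-right both-even _ _ () refl

    next-left : ∀ {m g r} → Position (G ⊸ H) (m ∷ inj₁ g ∷ r) → turn (inj₁ g ∷ r) ≡ opponent →
                ∃[ g′ ] m ≡ inj₁ g′
    next-left {inj₁ g′} p eq = g′ , refl
    next-left {inj₂ h}  p eq = ⊥-elim (oo-left (state (init-⊸ p)) eq (turn-left (init-⊸ p) eq) (po-⊸ p) (po-right p))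

    next-right : ∀ {m h r} → Position (G ⊸ H) (m ∷ inj₂ h ∷ r) → turn (inj₂ h ∷ r) ≡ opponent →
                 ∃[ h′ ] m ≡ inj₂ h′
    next-right {inj₂ h′} p eq = h′ , refl
    next-right {inj₁ g}  p eq = ⊥-elim (oo-right (state (init-⊸ p)) eq (turn-right (init-⊸ p) eq) (po-⊸ p) (po-left p))

    first-right : ∀ {m} → Position (G ⊸ H) (m ∷ []) → ∃[ h ] m ≡ inj₂ h
    first-right {inj₂ h} p = h , refl
    first-right {inj₁ g} p = ⊥-elim (oo-right (state (init-⊸ p)) refl refl (po-⊸ p) (po-left p))

    follows-⊸ : ∀ {r} → Position (G ⊸ H) r → Follows {label = L} {tag = component} opponent r
    follows-⊸ {[]} _ = tt
    follows-⊸ {_ ∷ []} _ = tt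
    follows-⊸ {m ∷ inj₁ g ∷ r} p = (λ eq → cong component (proj₂ (next-left p eq))) , follows-⊸ (init-⊸ p)
    follows-⊸ {m ∷ inj₂ h ∷ r} p = (λ eq → cong component (proj₂ (next-right p eq))) , follows-⊸ (init-⊸ p)

    restricts-left : ∀ r → Restricts L component (label G) false r (left r)
    restricts-left []           = []
    restricts-left (inj₁ g ∷ r) = hit refl refl (restricts-left r)
    restricts-left (inj₂ h ∷ r) = miss (λ ()) (restricts-left r)

    restricts-right : ∀ r → Restricts L component (label H) true r (right r)
    restricts-right []           = []
    restricts-right (inj₁ g ∷ r) = miss (λ ()) (restricts-right r)
    restricts-right (inj₂ h ∷ r) = hit refl refl (restricts-right r)

    -- Legality inside `G` is enough: `turn-left` gives the polarity, and an answer has a partner in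
    -- `G` because, by `top-tag`, the topmost pending question of the whole play lies in the
    -- component of the last move.
    ext-left : ∀ {g′ g r} → Position (G ⊸ H) (inj₁ g ∷ r) → turn (inj₁ g ∷ r) ≡ opponent →
               Position G (g′ ∷ g ∷ left r) → Position (G ⊸ H) (inj₁ g′ ∷ inj₁ g ∷ r)
    ext-left {g′} {g} {r} p eq pg with ⊸-split p
    ... | ok , _ , ph = ⊸-join (cons (trans (cong opposite (trans (LG.polarity pg) (turn-left p eq))) (sym eq)) fits ok) pg ph
      where
      fits : Fits L component (inj₁ g′) (inj₁ g ∷ r)
      fits with qa (label G) g′ in qeq
      ... | question = asks qeq
      ... | answer with pend L (inj₁ g ∷ r) in peq
      -- An empty stack of the whole play restricts to an empty stack in `G`, where the answer would
      -- be illegal.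
      ...   | []     = ⊥-elim (LG.nonempty-pend pg qeq
                         (pend-restricts-[] _ _ _ _ ok (restricts-left (inj₁ g ∷ r)) peq))
      ...   | q ∷ qs = answers qeq peq (sym (top-tag opponent ok (follows-⊸ p) eq peq))

    ext-right : ∀ {h′ h r} → Position (G ⊸ H) (inj₂ h ∷ r) → turn (inj₂ h ∷ r) ≡ opponent →
                Position H (h′ ∷ h ∷ right r) → Position (G ⊸ H) (inj₂ h′ ∷ inj₂ h ∷ r)
    ext-right {h′} {h} {r} p eq ph with ⊸-split p
    ... | ok , pg , _ = ⊸-join (cons (trans (trans (LH.polarity ph) (turn-right p eq)) (sym eq)) fits ok) pg ph
      where
      fits : Fits L component (inj₂ h′) (inj₂ h ∷ r)
      fits with qa (label H) h′ in qeq
      ... | question = asks qeq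
      ... | answer with pend L (inj₂ h ∷ r) in peq
      ...   | []     = ⊥-elim (LH.nonempty-pend ph qeq
                         (pend-restricts-[] _ _ _ _ ok (restricts-right (inj₂ h ∷ r)) peq))
      ...   | q ∷ qs = answers qeq peq (sym (top-tag opponent ok (follows-⊸ p) eq peq))

    ext-first : ∀ {h} → Position H (h ∷ []) → Position (G ⊸ H) (inj₂ h ∷ [])
    ext-first p with LH.ok p
    ... | cons eq (asks q) _ = ⊸-join (cons eq (asks q) []) LG.nil p

-- Exponential: threads, switching and extension of positions

module _ {G : RawGame} where

  !-split : ∀ {r} → Position (! G) r →
            OK (label (! G)) proj₁ r × (∀ i → Position G (r ↾ i))
  !-split {r} ⟨ l , g , m ⟩ = toOK _ _ r l (λ {t} {a} {u} {q} → m {t} {a} {u} {q}) ,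
    λ i → ⟨ subst (Pos G) (↾-reverse i r) (g i) ⟩

  !-join : ∀ {r} → OK (label (! G)) proj₁ r → (∀ i → Position G (r ↾ i)) → Position (! G) r
  !-join {r} ok g = ⟨ OK⇒Legal _ _ ok , (λ i → subst (Pos G) (sym (↾-reverse i r)) (position (g i))) ,
    (λ {t} {a} {u} {q} → OK⇒Matching _ _ ok {t} {a} {u} {q}) ⟩

  record !-Equiv (r r′ : List (ℕ × Move G)) : Set where
    constructor equivs
    field
      pos₁    : Position (! G) r
      pos₂    : Position (! G) r′
      perm    : ℕ ↔ ℕ
    π : ℕ → ℕ
    π = Inverse.to perm
    field
      threads : ∀ i → Equiv G (r ↾ i) (r′ ↾ π i)
      tags    : map (π ∘′ proj₁) r ≡ map proj₁ r′

    π-injective : ∀ {i j} → π i ≡ π j → i ≡ j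
    π-injective {i} {j} eq = trans (sym (Inverse.strictlyInverseʳ perm i))
      (trans (cong (Inverse.from perm) eq) (Inverse.strictlyInverseʳ perm j))

  !-≈-split : ∀ {r r′} → Equiv (! G) r r′ → !-Equiv r r′
  !-≈-split {r} {r′} ⟨ p , p′ , π , e , t ⟩ = equivs ⟨ p ⟩ ⟨ p′ ⟩ π
    (λ i → ⟨ subst₂ (RawGame._≈_ G) (↾-reverse i r) (↾-reverse (Inverse.to π i) r′) (e i) ⟩)
    (reverse-injective (trans (sym (reverse-map _ r)) (trans t (reverse-map proj₁ r′))))

  !-≈-join : ∀ {r r′} → !-Equiv r r′ → Equiv (! G) r r′
  !-≈-join {r} {r′} (equivs ⟨ p ⟩ ⟨ p′ ⟩ π e t) = ⟨ p , p′ , π ,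
    (λ i → subst₂ (RawGame._≈_ G) (sym (↾-reverse i r)) (sym (↾-reverse (Inverse.to π i) r′)) (equiv (e i))) ,
    trans (reverse-map _ r) (trans (cong reverse t) (sym (reverse-map proj₁ r′))) ⟩

  module Bang (LG : Laws G) where

    private
      module LG = Laws LG
      L : ℕ × Move G → PO × QA
      L = label (! G)

    !-pos-∷ : ∀ {i m r} → Position (! G) ((i , m) ∷ r) → Position G (m ∷ r ↾ i)
    !-pos-∷ {i} {m} {r} p = subst (Position G) (↾-hit i m r) (proj₂ (!-split p) i)

    init-! : ∀ {m r} → Position (! G) (m ∷ r) → Position (! G) r
    init-! {i , m} {r} p with !-split p
    ... | cons _ _ ok , ps = !-join ok λ k → lemma k (i ≟ k)
      where lemma : ∀ k → Dec (i ≡ k) → Position G (r ↾ k)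
            lemma k (yes refl) = LG.init (!-pos-∷ p)
            lemma k (no i≢k)   = subst (Position G) (↾-miss m r i≢k) (ps k)

    !-laws : Laws (! G)
    !-laws = record
      { ok     = λ p → OK-retag (λ _ → tt) (proj₁ (!-split p))
      ; init   = init-!
      ; nil    = !-join [] (λ _ → LG.nil)
      ; ≈-pos₁ = λ e → !-Equiv.pos₁ (!-≈-split e)
      ; ≈-pos₂ = λ e → !-Equiv.pos₂ (!-≈-split e)
      ; ≈-refl = λ p → !-≈-join (equivs p p (↔-id ℕ) (λ i → LG.≈-refl (proj₂ (!-split p) i)) refl)
      ; ≈-length = λ {r} {r′} e → trans (sym (length-map _ r))
          (trans (cong length (!-Equiv.tags (!-≈-split e))) (length-map proj₁ r′))
      }

    private
      po-! : ∀ {m r} → Position (! G) (m ∷ r) → po L m ≡ turn r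
      po-! p = Laws.polarity !-laws p

    -- An Opponent move makes its thread the only odd one, and polarity forces the reply of Player
    -- into it. So in `! G` it is Player who follows, in contrast to `⊸`.
    turn-threads : ∀ {r} → Position (! G) r →
      (turn r ≡ opponent → ∀ k → turn (r ↾ k) ≡ opponent) ×
      (∀ {i m r′} → r ≡ (i , m) ∷ r′ → turn r ≡ player → ∀ k → i ≢ k → turn (r ↾ k) ≡ opponent)
    turn-threads {[]} p = (λ _ _ → refl) , λ ()
    turn-threads {(i , m) ∷ r} p with turn-threads (init-! p)
    ... | even , odd = to-even , λ { refl eq k i≢k →
          trans (cong turn (↾-miss m r i≢k)) (even (opposite-adjoint eq) k) }
      where
      to-even : turn ((i , m) ∷ r) ≡ opponent → ∀ k → turn (((i , m) ∷ r) ↾ k) ≡ opponent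
      to-even eq k = lemma (i ≟ k)
        where
        m-player = trans (po-! p) (opposite-adjoint eq)
        lemma : Dec (i ≡ k) → turn (((i , m) ∷ r) ↾ k) ≡ opponent
        lemma (yes refl) = trans (cong turn (↾-hit i m r))
          (cong opposite (trans (sym (LG.polarity (!-pos-∷ p))) m-player))
        lemma (no i≢k) = trans (cong turn (↾-miss m r i≢k)) (other r refl)
          where
          other : ∀ r′ → r′ ≡ r → turn (r ↾ k) ≡ opponent
          other [] refl = refl
          other ((j , _) ∷ _) refl with j ≟ i
          ... | yes refl = odd refl (opposite-adjoint eq) k i≢k
          -- Were the last Opponent move in another thread `j`, the thread `i` would be even and a
          -- Player move in it would have the wrong polarity.
          ... | no j≢i with () ← trans (sym m-player)
                    (trans (LG.polarity (!-pos-∷ p)) (odd refl (opposite-adjoint eq) i j≢i))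

    next-! : ∀ {k b i a r} → Position (! G) ((k , b) ∷ (i , a) ∷ r) → turn ((i , a) ∷ r) ≡ player → k ≡ i
    next-! {k} {b} {i} {a} {r} p eq with i ≟ k
    ... | yes refl = refl
    ... | no i≢k with () ← trans (sym eq) (trans (sym (po-! p))
            (trans (LG.polarity (!-pos-∷ p)) (proj₂ (turn-threads (init-! p)) refl eq k i≢k)))

    follows-! : ∀ {r} → Position (! G) r → Follows {label = L} {tag = proj₁} player r
    follows-! {[]} _ = tt
    follows-! {_ ∷ []} _ = tt
    follows-! {m ∷ n ∷ r} p = next-! p , follows-! (init-! p)

    restricts-↾ : ∀ i r → Restricts L proj₁ (label G) i r (r ↾ i)
    restricts-↾ i [] = []
    restricts-↾ i ((k , m) ∷ r) = lemma (k ≟ i)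
      where lemma : Dec (k ≡ i) → Restricts L proj₁ (label G) i ((k , m) ∷ r) (((k , m) ∷ r) ↾ i)
            lemma (yes refl) = subst (Restricts _ _ _ _ _) (sym (↾-hit k m r)) (hit refl refl (restricts-↾ i r))
            lemma (no k≢i)   = subst (Restricts _ _ _ _ _) (sym (↾-miss m r k≢i)) (miss k≢i (restricts-↾ i r))

    ext-! : ∀ {b i a r} → Position (! G) ((i , a) ∷ r) → turn ((i , a) ∷ r) ≡ player →
            Position G (b ∷ a ∷ r ↾ i) → Position (! G) ((i , b) ∷ (i , a) ∷ r)
    ext-! {b} {i} {a} {r} p eq pb with !-split p
    ... | ok , ps = !-join (cons b-player fits ok) λ k → threads k (i ≟ k)
      where
      r⁺ = (i , a) ∷ r
      threads : ∀ k → Dec (i ≡ k) → Position G (((i , b) ∷ r⁺) ↾ k)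
      threads k (yes refl) = subst (Position G)
        (sym (trans (↾-hit i b r⁺) (cong (b ∷_) (↾-hit i a r)))) pb
      threads k (no i≢k)   = subst (Position G) (sym (↾-miss b r⁺ i≢k)) (ps k)
      b-player : po (label G) b ≡ turn r⁺
      b-player = trans (LG.polarity pb) (cong opposite
        (trans (proj₁ (turn-threads (init-! p)) (opposite-adjoint eq) i) (sym (opposite-adjoint eq))))
      fits : Fits L proj₁ (i , b) r⁺
      fits with qa (label G) b in qeq
      ... | question = asks qeq
      ... | answer with pend L r⁺ in peq
      ...   | []     = ⊥-elim (LG.nonempty-pend pb qeq (trans (cong (pend (label G)) (sym (↾-hit i a r)))
                         (pend-restricts-[] _ _ _ _ ok (restricts-↾ i r⁺) peq)))
      ...   | q ∷ qs = answers qeq peq (sym (top-tag player ok (follows-! p) eq peq))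

-- Strategies and tests

module _ {M : Set} where

  turn⇒2∣ : ∀ (r : List M) → turn r ≡ opponent → 2 ∣ length r
  turn⇒2∣ []          _  = 2 ∣0
  turn⇒2∣ (_ ∷ _ ∷ r) eq =
    ∣m∣n⇒∣m+n ∣-refl (turn⇒2∣ r (trans (sym (opposite-involutive (turn r))) eq))

  2∣⇒turn : ∀ (r : List M) → 2 ∣ length r → turn r ≡ opponent
  2∣⇒turn []          _ = refl
  2∣⇒turn (_ ∷ [])    d with () ← ∣1⇒≡1 d
  2∣⇒turn (_ ∷ _ ∷ r) d = trans (opposite-involutive (turn r)) (2∣⇒turn r (∣m+n∣m⇒∣n d ∣-refl))

  2∣-reverse : ∀ (r : List M) → 2 ∣ length r → turn (reverse r) ≡ opponent
  2∣-reverse r d = 2∣⇒turn (reverse r) (subst (2 ∣_) (sym (length-reverse r)) d)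

  reverse-2∣ : ∀ (r : List M) → turn (reverse r) ≡ opponent → 2 ∣ length r
  reverse-2∣ r eq = subst (2 ∣_) (length-reverse r) (turn⇒2∣ (reverse r) eq)

  player-2∤ : ∀ (r : List M) → turn r ≡ player → 2 ∤ length r
  player-2∤ r eq d with () ← trans (sym eq) (2∣⇒turn r d)

  2∤-player : ∀ (r : List M) → 2 ∤ length r → turn r ≡ player
  2∤-player r nd with turn r in eq
  ... | player   = refl
  ... | opponent = ⊥-elim (nd (turn⇒2∣ r eq))

-- `Reply N D o z`: after z, the agent plays the move o, or stops if o is
-- `nothing`. N holds of the sequences after a move of the agent.
Reply : {M : Set} (N D : List M → Set) → Maybe M → List M → Set
Reply N D (just b) z = N (b ∷ z)
Reply N D nothing  z = D z

Ext : (G : RawGame) → Maybe (Move G) → List (Move G) → Maybe (Move G) → List (Move G) → Set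
Ext G (just b) z (just b′) z′ = Equiv G (b ∷ z) (b′ ∷ z′)
Ext G nothing  z nothing   z′ = ⊤
Ext G _        z _         z′ = ⊥

module _ (G : RawGame) where

  -- The relation `⊏≈` with stopping as one more reply, so that one notion serves strategies, where
  -- `D` is empty, and tests.
  Sim : (N D N′ D′ : List (Move G) → Set) → Set
  Sim N D N′ D′ = ∀ o {a z a′ z′} → Reply N D o (a ∷ z) → N z → N′ z′ → Equiv G (a ∷ z) (a′ ∷ z′) →
                  ∃[ o′ ] Reply N′ D′ o′ (a′ ∷ z′) × Ext G o (a ∷ z) o′ (a′ ∷ z′)

  -- The common core of `Strat` and `Test`, which differ in parity and at the empty sequence.
  -- Stopping stands for `done`, which must answer the initial `ask`; by bracketing nothing else is
  -- pending then, whence `D-pos`.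
  record Agent (N D : List (Move G) → Set) : Set where
    field
      N-pos : ∀ {z} → N z → Position G z
      D-pos : ∀ {z} → D z → Position G z × pend (label G) z ≡ []
      back  : ∀ o {a z} → Reply N D o (a ∷ z) → N z
      hf    : ∀ o o′ {a z z′} → Reply N D o (a ∷ z) → Reply N D o′ (a ∷ z′) → o ≡ o′
      hf-∃  : ∀ o {a z z′} → Reply N D o (a ∷ z) → N z′ → Position G (a ∷ z′) → Reply N D o (a ∷ z′)
      self  : Sim N D N D

  record Strat : Set₁ where
    field
      N     : List (Move G) → Set
      agent : Agent N (λ _ → ⊥)
      nil   : N []
      even  : ∀ {z} → N z → turn z ≡ opponent
    open Agent agent public

  -- A strategy on G ⊸ 𝕊, seen from G: N z and D z stand for the plays
  -- ask·z and ask·z·done.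
  record Test : Set₁ where
    field
      N D    : List (Move G) → Set
      agent  : Agent N D
      -- The move `ask` leaves no trace in `z`, so history-freeness of the reply to it is stated
      -- separately.
      hf-[]  : ∀ o o′ → Reply N D o [] → Reply N D o′ [] → o ≡ o′
      odd    : ∀ {z} → N z → turn z ≡ player
      D-even : ∀ {z} → D z → turn z ≡ opponent
    open Agent agent public

module _ {G : RawGame} where

  Conv : (List (Move G) → Set) → (List (Move G) → Set) → Set
  Conv N D = ∃[ z ] N z × D z

  module _ (S : Strat G) where

    open Strat S

    private
      σ : RawStrategy G
      σ = ⟪ (λ s → N (reverse s)) ⟫

      Closure : List (Move G) → Set
      Closure r = N r ⊎ (∃[ a ] ∃[ r′ ] ∃[ b ] r ≡ a ∷ r′ × N (b ∷ a ∷ r′))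

      closure-init : ∀ {m r} → Closure (m ∷ r) → Closure r
      closure-init {r = []}    (inj₁ n) with () ← even n
      closure-init {r = _ ∷ _} (inj₁ n) = inj₂ (_ , _ , _ , refl , n)
      closure-init (inj₂ (_ , _ , b , refl , n)) = inj₁ (back (just b) n)

      closure-suffix : ∀ u {r} → Closure (u ++ r) → Closure r
      closure-suffix []      c = c
      closure-suffix (_ ∷ u) c = closure-suffix u (closure-init c)

      to : ∀ {s} → closure σ s → Closure (reverse s)
      to (inj₁ n) = inj₁ n
      to (inj₂ (_ , _ , s , a , b , refl , n)) = inj₂ (a , reverse s , b , reverse-++ s (a ∷ []) ,
        subst N (reverse-++ s (a ∷ b ∷ [])) n)

    module _ (LG : Laws G) where

      private

        from : ∀ {s} → Closure (reverse s) → closure σ s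
        from (inj₁ n) = inj₁ n
        from {s} (inj₂ (a , r , b , eq , n)) = inj₂
          ( subst (Pos G) (reverse-involutive s)
              (position (subst (Position G) (sym eq) (Laws.init LG (N-pos n))))
          , player-2∤ s s-turn
          , reverse r , a , b
          , trans (sym (reverse-involutive s)) (trans (cong reverse eq) (unfold-reverse a r))
          , subst N (sym (trans (reverse-++ (reverse r) _) (cong (λ z → b ∷ a ∷ z) (reverse-involutive r)))) n )
          where
          s-turn : turn s ≡ player
          s-turn = 2∤-player s λ d → player-2∤ (reverse s)
            (trans (cong turn eq) (opposite-adjoint (even n)))
            (turn⇒2∣ (reverse s) (2∣-reverse s d))

      strat⇒isStrategy : IsStrategy σ
      strat⇒isStrategy = record
        { nonEmpty       = [] , nil
        ; positions      = λ {s} n → subst (Pos G) (reverse-involutive s) (position (N-pos n))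
        ; even           = λ {s} n → reverse-2∣ s (even n)
        ; prefix-closed  = λ {s} {t} c → from {s} (closure-suffix (reverse t)
                             (subst Closure (reverse-++ s t) (to {s ++ t} c)))
        ; history-free   = λ {s} {t} {a} {b} {c} n n′ → just-inj (hf (just b) (just c)
                             (subst N (reverse-++ s _) n) (subst N (reverse-++ t _) n′))
        ; history-free-∃ = λ {s} {t} {a} {b} n n′ p → subst N (sym (reverse-++ t _))
                             (hf-∃ (just b) (subst N (reverse-++ s _) n) n′
                               ⟨ subst (Pos G) (sym (trans (cong reverse (sym (reverse-++ t (a ∷ [])))) (reverse-involutive _))) p ⟩)
        }
        where
        just-inj : ∀ {b c : Move G} → just b ≡ just c → b ≡ c
        just-inj refl = refl

      strat⇒Str : Str G
      strat⇒Str = record { raw = σ ; isStrategy = strat⇒isStrategy ; self-≈ = sim , sim }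
        where
        sim : σ ⊏≈ σ
        sim {s} {a} {b} {s′} {a′} n n′ e
          with self (just b) (subst N (reverse-++ s _) n)
                 (back (just b) (subst N (reverse-++ s _) n)) n′
                 ⟨ subst₂ (RawGame._≈_ G) (eq s a) (eq s′ a′) e ⟩
          where
          eq : ∀ s a → s ∷ʳ a ≡ reverse (a ∷ reverse s)
          eq s a = sym (trans (unfold-reverse a (reverse s)) (cong (_∷ʳ a) (reverse-involutive s)))
        ... | just b′ , n″ , ⟨ e′ ⟩ = b′ , subst N (sym (reverse-++ s′ _)) n″ ,
              subst₂ (RawGame._≈_ G) (eq s a b) (eq s′ a′ b′) e′
          where
          eq : ∀ s a b → reverse (b ∷ a ∷ reverse s) ≡ s ++ a ∷ b ∷ []
          eq s a b = trans (reverse-∷∷ b a (reverse s)) (cong (_++ a ∷ b ∷ []) (reverse-involutive s))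

  Str⇒strat : Str G → Strat G
  Str⇒strat S = record
    { N     = N
    ; agent = record
      { N-pos = λ n → ⟨ positions n ⟩
      ; D-pos = λ ()
      ; back  = λ { (just b) {a} {z} n → back (subst (plays σ) (reverse-∷∷ b a z) n) }
      ; hf    = λ { (just b) (just c) {a} {z} {z′} n n′ → cong just (history-free
                  (subst (plays σ) (reverse-∷∷ b a z) n) (subst (plays σ) (reverse-∷∷ c a z′) n′)) }
      ; hf-∃  = λ { (just b) {a} {z} {z′} n n′ (⟨ p ⟩) → subst (plays σ) (sym (reverse-∷∷ b a z′))
                  (history-free-∃ (subst (plays σ) (reverse-∷∷ b a z) n) n′
                    (subst (Pos G) (unfold-reverse a z′) p)) }
      ; self  = λ { (just b) {a} {z} {a′} {z′} n _ n′ (⟨ e ⟩) → sim b {a} {z} {a′} {z′} n n′ e }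
      }
    ; nil   = nil
    ; even  = λ {z} n → 2∣⇒turn z (subst (2 ∣_) (length-reverse z) (even n))
    }
    where
    σ = raw S
    open IsStrategy (Str.isStrategy S)
    N : List (Move G) → Set
    N r = plays σ (reverse r)
    nil : plays σ []
    nil with prefix-closed {[]} {proj₁ nonEmpty} (inj₁ (proj₂ nonEmpty))
    ... | inj₁ n = n
    ... | inj₂ (_ , nd , _) = ⊥-elim (nd (2 ∣0))
    back : ∀ {s a b} → plays σ (s ++ a ∷ b ∷ []) → plays σ s
    back {s} {a} {b} n with prefix-closed {s} (inj₁ n)
    ... | inj₁ n′ = n′
    ... | inj₂ (_ , nd , _) = ⊥-elim (nd (∣m+n∣m⇒∣n {2} {2} 2∣2+s ∣-refl))
      where 2∣2+s : 2 ∣ 2 + length s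
            2∣2+s = subst (2 ∣_) (trans (Data.List.Properties.length-++ s)
                        (Data.Nat.Properties.+-comm (length s) 2)) (even n)
    sim : ∀ b {a z a′ z′} → N (b ∷ a ∷ z) → N z′ → RawGame._≈_ G (reverse (a ∷ z)) (reverse (a′ ∷ z′)) →
          ∃[ o′ ] Reply N (λ _ → ⊥) o′ (a′ ∷ z′) × Ext G (just b) (a ∷ z) o′ (a′ ∷ z′)
    sim b {a} {z} {a′} {z′} n n′ e with proj₁ (Str.self-≈ S)
          (subst (plays σ) (reverse-∷∷ b a z) n) n′
          (subst₂ (RawGame._≈_ G) (unfold-reverse a z) (unfold-reverse a′ z′) e)
    ... | b′ , n″ , e′ = just b′ , subst (plays σ) (sym (reverse-∷∷ b′ a′ z′)) n″ ,
          ⟨ subst₂ (RawGame._≈_ G) (sym (reverse-∷∷ b a z)) (sym (reverse-∷∷ b′ a′ z′)) e′ ⟩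

-- The Sierpiński game, and tests as strategies into it

𝕊-Play : List SierpińskiMove → Set
𝕊-Play r = r ≡ [] ⊎ r ≡ ask ∷ [] ⊎ r ≡ done ∷ ask ∷ []

𝕊-position : ∀ {r} → Position 𝕊 r → 𝕊-Play r
𝕊-position ⟨ inj₁ eq ⟩        = inj₁ (reverse-injective eq)
𝕊-position ⟨ inj₂ (inj₁ eq) ⟩ = inj₂ (inj₁ (reverse-injective eq))
𝕊-position ⟨ inj₂ (inj₂ eq) ⟩ = inj₂ (inj₂ (reverse-injective eq))

𝕊-ask : Position 𝕊 (ask ∷ [])
𝕊-ask = ⟨ inj₂ (inj₁ refl) ⟩

𝕊-done : Position 𝕊 (done ∷ ask ∷ [])
𝕊-done = ⟨ inj₂ (inj₂ refl) ⟩

𝕊-≈ : ∀ {r r′} → Equiv 𝕊 r r′ → r ≡ r′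
𝕊-≈ ⟨ _ , eq ⟩ = reverse-injective eq

𝕊-laws : Laws 𝕊
𝕊-laws = record
  { ok     = λ p → ok (𝕊-position p)
  ; init   = λ p → init (𝕊-position p)
  ; nil    = ⟨ inj₁ refl ⟩
  ; ≈-pos₁ = λ (⟨ p , _ ⟩) → ⟨ p ⟩
  ; ≈-pos₂ = λ (⟨ p , eq ⟩) → ⟨ subst (Pos 𝕊) eq p ⟩
  ; ≈-refl = λ (⟨ p ⟩) → ⟨ p , refl ⟩
  ; ≈-length = λ e → cong length (𝕊-≈ e)
  }
  where
  ok : ∀ {r} → 𝕊-Play r → OK (label 𝕊) (λ _ → tt) r
  ok (inj₁ refl)        = []
  ok (inj₂ (inj₁ refl)) = cons refl (asks refl) []
  ok (inj₂ (inj₂ refl)) = cons refl (answers refl refl refl) (cons refl (asks refl) [])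
  init : ∀ {m r} → 𝕊-Play (m ∷ r) → Position 𝕊 r
  init (inj₂ (inj₁ refl)) = ⟨ inj₁ refl ⟩
  init (inj₂ (inj₂ refl)) = 𝕊-ask

-- Has two uses: with `ask` it embeds the plays of `G` into those of `G ⊸ 𝕊`; with the first move
-- `b₁` of a test on `A ⇒ B` it places moves of `! A` after `b₁`.
module Opening {G H : RawGame} (LG : Laws G) (LH : Laws H) (h : Move H) (ph : Position H (h ∷ [])) where

  private
    L : Move G ⊎ Move H → PO × QA
    L = label (G ⊸ H)

    h-ok : po (label H) h ≡ opponent × qa (label H) h ≡ question
    h-ok with Laws.ok LH ph
    ... | cons eq (asks q) _ = eq , q

  emb : List (Move G) → List (Move G ⊎ Move H)
  emb []      = inj₂ h ∷ []
  emb (g ∷ z) = inj₁ g ∷ emb z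

  left-emb : ∀ z → left (emb z) ≡ z
  left-emb []      = refl
  left-emb (g ∷ z) = cong (g ∷_) (left-emb z)

  right-emb : ∀ z → right (emb z) ≡ h ∷ []
  right-emb []      = refl
  right-emb (g ∷ z) = right-emb z

  turn-emb : ∀ z → turn (emb z) ≡ opposite (turn z)
  turn-emb []      = refl
  turn-emb (_ ∷ z) = cong opposite (turn-emb z)

  -- The question `h` stays unanswered at the bottom of the stack and never interferes with the
  -- answers in `G`.
  pend-emb : ∀ {z} → OK (label G) (λ _ → tt) z → pend L (emb z) ≡ emb (pend (label G) z)
  pend-emb [] = updatePending-question L [] {inj₂ h} (proj₂ h-ok)
  pend-emb {g ∷ z} (cons _ (asks q) ok)
    rewrite updatePending-question L (pend L (emb z)) {inj₁ g} q
          | updatePending-question (label G) (pend (label G) z) q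
    = cong (inj₁ g ∷_) (pend-emb ok)
  pend-emb {g ∷ z} (cons _ (answers a peq _) ok)
    rewrite updatePending-answer L (pend L (emb z)) {inj₁ g} a
          | updatePending-answer (label G) (pend (label G) z) a
          | pend-emb ok | peq = refl

  emb-OK : ∀ {z} → OK (label G) (λ _ → tt) z → OK L component (emb z)
  emb-OK [] = cons (proj₁ h-ok) (asks (proj₂ h-ok)) []
  emb-OK {g ∷ z} (cons eq (asks q) ok) =
    cons (trans (cong opposite eq) (sym (turn-emb z))) (asks q) (emb-OK ok)
  emb-OK {g ∷ z} (cons eq (answers a peq _) ok) =
    cons (trans (cong opposite eq) (sym (turn-emb z)))
         (answers a (trans (pend-emb ok) (cong emb peq)) refl) (emb-OK ok)

  emb-pos : ∀ {z} → Position G z → Position (G ⊸ H) (emb z)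
  emb-pos {z} p = ⊸-join (emb-OK (Laws.ok LG p)) (subst (Position G) (sym (left-emb z)) p)
    (subst (Position H) (sym (right-emb z)) ph)

  emb-pos⁻ : ∀ {z} → Position (G ⊸ H) (emb z) → Position G z
  emb-pos⁻ {z} p = subst (Position G) (left-emb z) (proj₁ (proj₂ (⊸-split p)))

  emb-tags : ∀ z z′ → length z ≡ length z′ → map component (emb z) ≡ map component (emb z′)
  emb-tags []      []       _  = refl
  emb-tags (_ ∷ z) (_ ∷ z′) eq = cong (false ∷_) (emb-tags z z′ (suc-injective eq))

  emb-≈ : ∀ {z z′} → Equiv G z z′ → Equiv (G ⊸ H) (emb z) (emb z′)
  emb-≈ {z} {z′} e = ⊸-≈-join (equivs (emb-pos (Laws.≈-pos₁ LG e)) (emb-pos (Laws.≈-pos₂ LG e))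
    (subst₂ (Equiv G) (sym (left-emb z)) (sym (left-emb z′)) e)
    (subst₂ (Equiv H) (sym (right-emb z)) (sym (right-emb z′)) (Laws.≈-refl LH ph))
    (emb-tags z z′ (Laws.≈-length LG e)))

module _ {G : RawGame} (LG : Laws G) where

  private
    module G = Laws LG
    module L = Lolli LG 𝕊-laws
    module E = Opening LG 𝕊-laws ask 𝕊-ask

  asked : List (Move G) → List (Move G ⊎ SierpińskiMove)
  asked = E.emb

  done-pos : ∀ {z} → Position G z → pend (label G) z ≡ [] → turn z ≡ opponent →
             Position (G ⊸ 𝕊) (inj₂ done ∷ asked z)
  done-pos {z} p peq eq = ⊸-join
    (cons (trans (cong opposite (sym eq)) (sym (E.turn-emb z)))
          (answers refl (trans (E.pend-emb (G.ok p)) (cong asked peq)) refl)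
          (E.emb-OK (G.ok p)))
    (subst (Position G) (sym (E.left-emb z)) p)
    (subst (λ r → Position 𝕊 (done ∷ r)) (sym (E.right-emb z)) 𝕊-done)

  done-pos⁻ : ∀ {z} → Position (G ⊸ 𝕊) (inj₂ done ∷ asked z) →
              Position G z × pend (label G) z ≡ [] × turn z ≡ opponent
  done-pos⁻ {z} p with proj₁ (⊸-split p) | E.emb-pos⁻ {z} (L.init-⊸ p)
  ... | cons _ (asks ()) _ | _
  ... | cons eq (answers _ peq t) _ | pz = pz ,
    -- `done` answers the top of the stack, which by matching lies in `𝕊` and so is `ask`. As `ask`
    -- is at the bottom, no question of `z` is pending.
    balanced _ (trans (sym (E.pend-emb (G.ok pz))) peq) t ,
    sym (trans (cong opposite (trans eq (E.turn-emb z))) (opposite-involutive _))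
    where
    balanced : ∀ y {q qs} → asked y ≡ q ∷ qs → true ≡ component q → y ≡ []
    balanced []      _    _ = refl
    balanced (_ ∷ _) refl ()

  𝕊-next : ∀ {m r s} → right r ≡ s → Position (G ⊸ 𝕊) (inj₂ m ∷ r) → 𝕊-Play (m ∷ s)
  𝕊-next refl p = 𝕊-position (proj₂ (proj₂ (⊸-split p)))

  data Form : List (Move G ⊎ SierpińskiMove) → Set where
    empty   : Form []
    running : ∀ z → Form (asked z)
    stopped : ∀ z → Form (inj₂ done ∷ asked z)

  private
    first-𝕊 : ∀ {m} → 𝕊-Play (m ∷ []) → m ≡ ask
    first-𝕊 (inj₂ (inj₁ refl)) = refl

    second-𝕊 : ∀ {m} → 𝕊-Play (m ∷ ask ∷ []) → m ≡ done
    second-𝕊 (inj₂ (inj₂ refl)) = refl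

    third-𝕊 : ∀ {m} → 𝕊-Play (m ∷ done ∷ ask ∷ []) → ⊥
    third-𝕊 (inj₂ (inj₁ ()))
    third-𝕊 (inj₂ (inj₂ ()))

  after-ask : ∀ {m} → Position (G ⊸ 𝕊) (m ∷ []) → m ≡ inj₂ ask
  after-ask {inj₁ g} p with () ← proj₂ (L.first-right p)
  after-ask {inj₂ m} p = cong inj₂ (first-𝕊 (𝕊-next refl p))

  after-asked : ∀ {m z} → Position (G ⊸ 𝕊) (inj₂ m ∷ asked z) → m ≡ done
  after-asked {m} {z} p = second-𝕊 (𝕊-next (E.right-emb z) p)

  -- After `done` Opponent is to move: switching forbids a move in `G`, and `𝕊` has no longer
  -- position.
  after-done : ∀ {m z} → Position (G ⊸ 𝕊) (m ∷ inj₂ done ∷ asked z) → ⊥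
  after-done {inj₁ g} {z} p = absurd (L.next-right p (trans (cong opposite (E.turn-emb z))
      (trans (opposite-involutive _) (proj₂ (proj₂ (done-pos⁻ {z} (L.init-⊸ p)))))))
    where absurd : ∃[ m ] inj₁ g ≡ inj₂ m → ⊥
          absurd ()
  after-done {inj₂ m} {z} p = third-𝕊 (𝕊-next (cong (done ∷_) (E.right-emb z)) p)

  private
    form-∷ : ∀ {m r} → Form r → Position (G ⊸ 𝕊) (m ∷ r) → Form (m ∷ r)
    form-∷ empty p = subst (λ m → Form (m ∷ [])) (sym (after-ask p)) (running [])
    form-∷ {inj₁ g} (running z) p = running (g ∷ z)
    form-∷ {inj₂ m} (running z) p = subst (λ m → Form (inj₂ m ∷ asked z)) (sym (after-asked {z = z} p)) (stopped z)
    form-∷ (stopped z) p = ⊥-elim (after-done {z = z} p)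

  form : ∀ {r} → Position (G ⊸ 𝕊) r → Form r
  form {[]}    p = empty
  form {_ ∷ _} p = form-∷ (form (L.init-⊸ p)) p

  Lift : Maybe (Move G) → Move G ⊎ SierpińskiMove
  Lift (just g) = inj₁ g
  Lift nothing  = inj₂ done

  Lift-injective : ∀ o o′ → Lift o ≡ Lift o′ → o ≡ o′
  Lift-injective (just _) (just _) refl = refl
  Lift-injective nothing  nothing  refl = refl

  strat⇒test : Strat (G ⊸ 𝕊) → Test G
  strat⇒test S = record
    { N = N ; D = D
    ; agent = record
      { N-pos = λ n → E.emb-pos⁻ (S.N-pos n)
      ; D-pos = λ {z} d → let p , peq , _ = done-pos⁻ {z} (S.N-pos d) in p , peq
      ; back  = λ o {a} {z} n → S.back (just (Lift o)) (to o n)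
      ; hf    = λ o o′ {a} {z} {z′} n n′ → Lift-injective o o′
                  (just-injective (S.hf (just (Lift o)) (just (Lift o′)) (to o n) (to o′ n′)))
      ; hf-∃  = λ o {a} {z} {z′} n n′ p → from o (S.hf-∃ (just (Lift o)) (to o n) n′ (E.emb-pos p))
      ; self  = self
      }
    ; hf-[]  = λ o o′ n n′ → Lift-injective o o′
                 (just-injective (S.hf (just (Lift o)) (just (Lift o′)) (to o n) (to o′ n′)))
    ; odd    = λ {z} n → opposite-adjoint (trans (sym (E.turn-emb z)) (S.even n))
    ; D-even = λ {z} d → proj₂ (proj₂ (done-pos⁻ {z} (S.N-pos d)))
    }
    where
    module S = Strat S
    N D : List (Move G) → Set
    N z = S.N (asked z)
    D z = S.N (inj₂ done ∷ asked z)
    to : ∀ o {z} → Reply N D o z → S.N (Lift o ∷ asked z)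
    to (just _) n = n
    to nothing  n = n
    from : ∀ o {z} → S.N (Lift o ∷ asked z) → Reply N D o z
    from (just _) n = n
    from nothing  n = n
    self : Sim G N D N D
    self o {a} {z} {a′} {z′} n nz n′ e with S.self (just (Lift o)) (to o n) nz n′ (E.emb-≈ e)
    ... | just c , n″ , e″ = decode o c n″ e″
      where
      open ⊸-Equiv
      decode : ∀ o c → S.N (c ∷ asked (a′ ∷ z′)) → Equiv (G ⊸ 𝕊) (Lift o ∷ asked (a ∷ z)) (c ∷ asked (a′ ∷ z′)) →
               ∃[ o′ ] Reply N D o′ (a′ ∷ z′) × Ext G o (a ∷ z) o′ (a′ ∷ z′)
      decode (just b) (inj₁ b′) n e = just b′ , n ,
        subst₂ (λ s s′ → Equiv G (b ∷ a ∷ s) (b′ ∷ a′ ∷ s′)) (E.left-emb z) (E.left-emb z′) (lefts (⊸-≈-split e))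
      decode (just b) (inj₂ _) n e with () ← ∷-injectiveˡ (tags (⊸-≈-split e))
      decode nothing (inj₁ _) n e with () ← ∷-injectiveˡ (tags (⊸-≈-split e))
      decode nothing (inj₂ m) n e with ∷-injectiveˡ (𝕊-≈ (rights (⊸-≈-split e)))
      ... | refl = nothing , n , tt

  module _ (T : Test G) where

    private
      module T = Test T

      Play : List (Move G ⊎ SierpińskiMove) → Set
      Play r = r ≡ [] ⊎ (∃[ o ] ∃[ z ] r ≡ Lift o ∷ asked z × Reply T.N T.D o z)

      play : ∀ o {z} → Reply T.N T.D o z → Play (Lift o ∷ asked z)
      play o n = inj₂ (o , _ , refl , n)

      play-pos : ∀ {r} → Play r → Position (G ⊸ 𝕊) r
      play-pos (inj₁ refl) = Laws.nil L.⊸-laws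
      play-pos (inj₂ (just b  , z , refl , n)) = E.emb-pos (T.N-pos n)
      play-pos (inj₂ (nothing , z , refl , n)) =
        done-pos {z} (proj₁ (T.D-pos n)) (proj₂ (T.D-pos n)) (T.D-even n)

      data Turn (a : Move G ⊎ SierpińskiMove) : List (Move G ⊎ SierpińskiMove) → Set where
        asks  : a ≡ inj₂ ask → Turn a []
        moves : ∀ {g z} → a ≡ inj₁ g → T.N z → Turn a (asked z)

      turn-of : ∀ {a r} → Play r → Position (G ⊸ 𝕊) (a ∷ r) → Turn a r
      turn-of (inj₁ refl) p = asks (after-ask p)
      turn-of {inj₁ g} (inj₂ (just b , z , refl , n)) p = moves {z = b ∷ z} refl n
      -- The only move left in `𝕊` is `done`, a Player move, whereas here it is Opponent's turn.
      turn-of {inj₂ m} (inj₂ (just b , z , refl , n)) p = ⊥-elim (player≢opponent (trans (sym (T.odd n))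
        (proj₂ (proj₂ (done-pos⁻ {b ∷ z} (subst (λ m → Position (G ⊸ 𝕊) (inj₂ m ∷ asked (b ∷ z)))
          (after-asked {z = b ∷ z} p) p))))))
      turn-of (inj₂ (nothing , z , refl , n)) p = ⊥-elim (after-done {z = z} p)

      data Pair (b a : Move G ⊎ SierpińskiMove) : List (Move G ⊎ SierpińskiMove) → Set where
        asks  : ∀ o → b ≡ Lift o → a ≡ inj₂ ask → Reply T.N T.D o [] → Pair b a []
        moves : ∀ o {g z} → b ≡ Lift o → a ≡ inj₁ g → Reply T.N T.D o (g ∷ z) → Pair b a (asked z)

      pair-of : ∀ {b a r} → Play (b ∷ a ∷ r) → Pair b a r
      pair-of (inj₂ (o , []    , refl , n)) = asks o refl refl n
      pair-of (inj₂ (o , _ ∷ _ , refl , n)) = moves o refl refl n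

      play-back : ∀ {b a r} → Play (b ∷ a ∷ r) → Play r
      play-back p with pair-of p
      ... | asks _ _ _ _ = inj₁ refl
      ... | moves o {z = z} _ _ n with z | T.back o n
      ...   | []    | n′ with () ← T.odd n′
      ...   | b ∷ z | n′ = play (just b) {z} n′

      play-hf : ∀ {b c a r r′} → Play (b ∷ a ∷ r) → Play (c ∷ a ∷ r′) → b ≡ c
      play-hf p p′ with pair-of p | pair-of p′
      ... | asks o refl refl n | asks o′ refl _ n′ = cong Lift (T.hf-[] o o′ n n′)
      ... | moves o refl refl n | moves o′ refl refl n′ = cong Lift (T.hf o o′ n n′)
      ... | asks _ _ refl _ | moves _ _ () _
      ... | moves _ _ refl _ | asks _ _ () _

      play-hf-∃ : ∀ {b a r r′} → Play (b ∷ a ∷ r) → Play r′ → Position (G ⊸ 𝕊) (a ∷ r′) → Play (b ∷ a ∷ r′)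
      play-hf-∃ p p′ pos with pair-of p | turn-of p′ pos
      ... | asks o refl refl n | asks _ = play o n
      ... | asks o refl refl n | moves () _
      ... | moves o refl refl n | asks ()
      ... | moves o {g} refl refl n | moves {z = z} refl n′ =
        play o (T.hf-∃ o n n′ (E.emb-pos⁻ {g ∷ z} pos))

      lift-≈ : ∀ o o′ {z z′} → Position (G ⊸ 𝕊) (Lift o ∷ asked z) → Position (G ⊸ 𝕊) (Lift o′ ∷ asked z′) →
               Equiv G z z′ → Ext G o z o′ z′ → Equiv (G ⊸ 𝕊) (Lift o ∷ asked z) (Lift o′ ∷ asked z′)
      lift-≈ (just b) (just b′) {z} {z′} p p′ _ e = ⊸-≈-join (equivs p p′
        (subst₂ (λ s s′ → Equiv G (b ∷ s) (b′ ∷ s′)) (sym (E.left-emb z)) (sym (E.left-emb z′)) e)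
        (subst₂ (Equiv 𝕊) (sym (E.right-emb z)) (sym (E.right-emb z′)) (Laws.≈-refl 𝕊-laws 𝕊-ask))
        (cong (false ∷_) (E.emb-tags z z′ (suc-injective (G.≈-length e)))))
      lift-≈ nothing nothing {z} {z′} p p′ e _ = ⊸-≈-join (equivs p p′
        (subst₂ (Equiv G) (sym (E.left-emb z)) (sym (E.left-emb z′)) e)
        (subst₂ (λ s s′ → Equiv 𝕊 (done ∷ s) (done ∷ s′)) (sym (E.right-emb z)) (sym (E.right-emb z′))
          (Laws.≈-refl 𝕊-laws 𝕊-done))
        (cong (true ∷_) (E.emb-tags z z′ (G.≈-length e))))

      play-self : ∀ {b a r a′ r′} → Play (b ∷ a ∷ r) → Play r′ → Equiv (G ⊸ 𝕊) (a ∷ r) (a′ ∷ r′) →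
                  ∃[ b′ ] Play (b′ ∷ a′ ∷ r′) × Equiv (G ⊸ 𝕊) (b ∷ a ∷ r) (b′ ∷ a′ ∷ r′)
      play-self p p′ e with ⊸-≈-split e
      play-self p p′ e | equivs _ pos _ _ tags with pair-of p | turn-of p′ pos
      ... | asks o refl refl n | asks refl =
        Lift o , play o n , Laws.≈-refl L.⊸-laws (play-pos (play o {[]} n))
      ... | asks _ _ refl _ | moves refl _ with () ← tags
      ... | moves _ _ refl _ | asks refl with () ← tags
      play-self p p′ e | equivs _ pos ls _ _ | moves o {g} {z} refl refl n | moves {g′} {z′} refl n′
        with e″ ← subst₂ (λ s s′ → Equiv G (g ∷ s) (g′ ∷ s′)) (E.left-emb z) (E.left-emb z′) ls
        with o′ , n″ , e′ ← T.self o n (T.back o n) n′ e″ =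
        Lift o′ , play o′ n″ , lift-≈ o o′ (play-pos (play o {g ∷ z} n)) (play-pos (play o′ {g′ ∷ z′} n″)) e″ e′

      play-even : ∀ {r} → Play r → turn r ≡ opponent
      play-even (inj₁ refl) = refl
      play-even (inj₂ (just b , z , refl , n)) = trans (E.turn-emb (b ∷ z)) (cong opposite (T.odd n))
      play-even (inj₂ (nothing , z , refl , n)) = trans (cong opposite (E.turn-emb z))
        (trans (opposite-involutive _) (T.D-even n))

    test⇒strat : Strat (G ⊸ 𝕊)
    test⇒strat = record
      { N     = Play
      ; agent = record
        { N-pos = play-pos
        ; D-pos = λ ()
        ; back  = λ { (just b) n → play-back n }
        ; hf    = λ { (just b) (just c) n n′ → cong just (play-hf n n′) }
        ; hf-∃  = λ { (just b) n n′ p → play-hf-∃ n n′ p }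
        ; self  = λ { (just b) n _ n′ e → let b′ , n″ , e′ = play-self n n′ e in just b′ , n″ , e′ }
        }
      ; nil   = inj₁ refl
      ; even  = play-even
      }

    test⇒strat-D : ∀ {z} → Strat.N test⇒strat (inj₂ done ∷ asked z) → T.D z
    test⇒strat-D {z} (inj₂ (nothing , z′ , eq , n)) =
      subst T.D (trans (sym (E.left-emb z′)) (trans (cong left (sym (∷-injectiveʳ eq))) (E.left-emb z))) n
    test⇒strat-D {z} (inj₁ ())
    test⇒strat-D {z} (inj₂ (just _ , _ , () , _))

    D⇒test⇒strat : ∀ {z} → T.D z → Strat.N test⇒strat (inj₂ done ∷ asked z)
    D⇒test⇒strat n = play nothing n

-- Convergence of composites

𝟏-laws : Laws 𝟏
𝟏-laws = record
  { ok     = λ { {[]} _ → [] }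
  ; init   = λ { {()} }
  ; nil    = ⟨ refl ⟩
  ; ≈-pos₁ = λ { {[]} _ → ⟨ refl ⟩ }
  ; ≈-pos₂ = λ { {_} {[]} _ → ⟨ refl ⟩ }
  ; ≈-refl = λ { {[]} _ → ⟨ refl , refl ⟩ }
  ; ≈-length = λ { {[]} {[]} _ → refl }
  }

!𝟏-laws : Laws (! 𝟏)
!𝟏-laws = Bang.!-laws 𝟏-laws

module _ {X Y : Set} where

  left-reverse : ∀ (w : List (X ⊎ Y)) {r} → reverse w ≡ r → left w ≡ reverse (left r)
  left-reverse w refl = trans (sym (reverse-involutive (left w))) (cong reverse (sym (mapMaybe-reverse isInj₁ w)))

  right-reverse : ∀ (w : List (X ⊎ Y)) {r} → reverse w ≡ r → right w ≡ reverse (right r)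
  right-reverse w refl = trans (sym (reverse-involutive (right w))) (cong reverse (sym (mapMaybe-reverse isInj₂ w)))

  map-inj₂-tags : ∀ (z z′ : List Y) → length z ≡ length z′ →
                  map (component {X} {Y}) (map inj₂ z) ≡ map (component {X} {Y}) (map inj₂ z′)
  map-inj₂-tags []      []       _  = refl
  map-inj₂-tags (_ ∷ z) (_ ∷ z′) eq = cong (true ∷_) (map-inj₂-tags z z′ (suc-injective eq))

module _ {X H : RawGame} (LX : Laws X) (LH : Laws H) where

  inj₂-pos : ∀ {z} → Position H z → Position (X ⊸ H) (map inj₂ z)
  inj₂-pos {z} p = ⊸-join (OK-map⁺ inj₂ (OK-retag (λ _ → true) (Laws.ok LH p)))
    (subst (Position X) (sym (mapMaybeIsInj₁∘mapInj₂ z)) (Laws.nil LX))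
    (subst (Position H) (sym (mapMaybeIsInj₂∘mapInj₂ z)) p)

  inj₂-pos⁻ : ∀ {z} → Position (X ⊸ H) (map inj₂ z) → Position H z
  inj₂-pos⁻ {z} p = subst (Position H) (mapMaybeIsInj₂∘mapInj₂ z) (proj₂ (proj₂ (⊸-split p)))

  inj₂-≈ : ∀ {z z′} → Equiv H z z′ → Equiv (X ⊸ H) (map inj₂ z) (map inj₂ z′)
  inj₂-≈ {z} {z′} e = ⊸-≈-join (equivs (inj₂-pos (Laws.≈-pos₁ LH e)) (inj₂-pos (Laws.≈-pos₂ LH e))
    (subst₂ (Equiv X) (sym (mapMaybeIsInj₁∘mapInj₂ z)) (sym (mapMaybeIsInj₁∘mapInj₂ z′))
      (Laws.≈-refl LX (Laws.nil LX)))
    (subst₂ (Equiv H) (sym (mapMaybeIsInj₂∘mapInj₂ z)) (sym (mapMaybeIsInj₂∘mapInj₂ z′)) e)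
    (map-inj₂-tags {Move X} z z′ (Laws.≈-length LH e)))

  inj₂-≈⁻ : ∀ {z z′} → Equiv (X ⊸ H) (map inj₂ z) (map inj₂ z′) → Equiv H z z′
  inj₂-≈⁻ {z} {z′} e = subst₂ (Equiv H) (mapMaybeIsInj₂∘mapInj₂ z) (mapMaybeIsInj₂∘mapInj₂ z′)
    (⊸-Equiv.rights (⊸-≈-split e))

module _ {X : RawGame} (LX : Laws X) (¬X : Move X → ⊥) where

  retract : ∀ {Y : Set} (s : List (Move X ⊎ Y)) → s ≡ map inj₂ (right s)
  retract []           = refl
  retract (inj₁ x ∷ s) = ⊥-elim (¬X x)
  retract (inj₂ y ∷ s) = cong (inj₂ y ∷_) (retract s)

  module _ {A : RawGame} (LA : Laws A) where

    strat-from : Strat (X ⊸ A) → Strat A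
    strat-from S = record
      { N     = λ z → S.N (map inj₂ z)
      ; agent = record
        { N-pos = λ n → inj₂-pos⁻ LX LA (S.N-pos n)
        ; D-pos = λ ()
        ; back  = λ { (just b) n → S.back (just (inj₂ b)) n }
        ; hf    = λ { (just b) (just c) n n′ → lemma (S.hf (just (inj₂ b)) (just (inj₂ c)) n n′) }
        ; hf-∃  = λ { (just b) n n′ p → S.hf-∃ (just (inj₂ b)) n n′ (inj₂-pos LX LA p) }
        ; self  = λ { (just b) {a′ = a′} {z′} n m n′ e → self b {a′ = a′} {z′}
                        (S.self (just (inj₂ b)) n m n′ (inj₂-≈ LX LA e)) }
        }
      ; nil   = S.nil
      ; even  = λ {z} n → trans (sym (turn-map {label = label (X ⊸ A)} {component} inj₂ z)) (S.even n)
      }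
      where
      module S = Strat S
      lemma : ∀ {b c : Move A} → just (inj₂ {A = Move X} b) ≡ just (inj₂ c) → just b ≡ just c
      lemma refl = refl
      self : ∀ b {a z a′ z′} →
             ∃[ o′ ] Reply S.N (λ _ → ⊥) o′ (map inj₂ (a′ ∷ z′)) ×
               Ext (X ⊸ A) (just (inj₂ b)) (map inj₂ (a ∷ z)) o′ (map inj₂ (a′ ∷ z′)) →
             ∃[ o′ ] Reply (λ z → S.N (map inj₂ z)) (λ _ → ⊥) o′ (a′ ∷ z′) × Ext A (just b) (a ∷ z) o′ (a′ ∷ z′)
      self b (just (inj₁ x) , _)       = ⊥-elim (¬X x)
      self b (just (inj₂ b′) , n , e)  = just b′ , n , inj₂-≈⁻ LX LA e

    strat-to : Strat A → Strat (X ⊸ A)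
    strat-to S = record
      { N     = λ r → S.N (right r)
      ; agent = record
        { N-pos = λ {r} n → subst (Position (X ⊸ A)) (sym (retract r)) (inj₂-pos LX LA (S.N-pos n))
        ; D-pos = λ ()
        ; back  = λ { (just (inj₁ x)) → ⊥-elim (¬X x)
                    ; (just (inj₂ b)) {inj₁ x} → ⊥-elim (¬X x)
                    ; (just (inj₂ b)) {inj₂ a} n → S.back (just b) n }
        ; hf    = λ { (just (inj₁ x)) → ⊥-elim (¬X x)
                    ; (just (inj₂ b)) (just (inj₁ x)) → ⊥-elim (¬X x)
                    ; (just (inj₂ b)) (just (inj₂ c)) {inj₁ x} → ⊥-elim (¬X x)
                    ; (just (inj₂ b)) (just (inj₂ c)) {inj₂ a} n n′ → lemma (S.hf (just b) (just c) n n′) }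
        ; hf-∃  = λ { (just (inj₁ x)) → ⊥-elim (¬X x)
                    ; (just (inj₂ b)) {inj₁ x} → ⊥-elim (¬X x)
                    ; (just (inj₂ b)) {inj₂ a} {z} {z′} n n′ p → S.hf-∃ (just b) n n′
                        (inj₂-pos⁻ LX LA (subst (Position (X ⊸ A)) (retract (inj₂ a ∷ z′)) p)) }
        ; self  = λ { (just (inj₁ x)) → ⊥-elim (¬X x)
                    ; (just (inj₂ b)) {inj₁ x} → ⊥-elim (¬X x)
                    ; (just (inj₂ b)) {inj₂ a} {_} {inj₁ x} → ⊥-elim (¬X x)
                    ; (just (inj₂ b)) {inj₂ a} {z} {inj₂ a′} {z′} n m n′ e → self b
                        (S.self (just b) n m n′ (⊸-Equiv.rights (⊸-≈-split e))) }
        }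
      ; nil   = S.nil
      ; even  = λ {r} n → trans (cong turn (retract r))
                  (trans (turn-map {label = label (X ⊸ A)} {component} inj₂ (right r)) (S.even n))
      }
      where
      module S = Strat S
      lemma : ∀ {b c : Move A} → just b ≡ just c → just (inj₂ {A = Move X} b) ≡ just (inj₂ c)
      lemma refl = refl
      self : ∀ b {a z a′ z′} →
             ∃[ o′ ] Reply S.N (λ _ → ⊥) o′ (a′ ∷ right z′) × Ext A (just b) (a ∷ right z) o′ (a′ ∷ right z′) →
             ∃[ o′ ] Reply (λ z → S.N (right z)) (λ _ → ⊥) o′ (inj₂ a′ ∷ z′) ×
               Ext (X ⊸ A) (just (inj₂ b)) (inj₂ a ∷ z) o′ (inj₂ a′ ∷ z′)
      self b {a} {z} {a′} {z′} (just b′ , n , e) = just (inj₂ b′) , n ,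
        subst₂ (Equiv (X ⊸ A)) (sym (retract (inj₂ b ∷ inj₂ a ∷ z))) (sym (retract (inj₂ b′ ∷ inj₂ a′ ∷ z′)))
          (inj₂-≈ LX LA e)

  module _ {H K : RawGame} (ρ : RawStrategy (X ⊸ H)) (τ : RawStrategy (H ⊸ K)) where

    private
      onYZ-inj₂ : ∀ (w : List (Move H ⊎ Move K)) → mapMaybe (onYZ {Move X}) (map inj₂ w) ≡ w
      onYZ-inj₂ = mapMaybeIsInj₂∘mapInj₂

      onXY-inj₂ : ∀ (w : List (Move H ⊎ Move K)) → mapMaybe (onXY {Move X}) (map inj₂ w) ≡ map inj₂ (left w)
      onXY-inj₂ []           = refl
      onXY-inj₂ (inj₁ _ ∷ w) = cong (_ ∷_) (onXY-inj₂ w)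
      onXY-inj₂ (inj₂ _ ∷ w) = onXY-inj₂ w

      onXZ-inj₂ : ∀ (w : List (Move H ⊎ Move K)) → mapMaybe (onXZ {Move X}) (map inj₂ w) ≡ map inj₂ (right w)
      onXZ-inj₂ []           = refl
      onXZ-inj₂ (inj₁ _ ∷ w) = onXZ-inj₂ w
      onXZ-inj₂ (inj₂ _ ∷ w) = cong (_ ∷_) (onXZ-inj₂ w)

    -- As `X` has no moves, an interaction is just a sequence `w` for `τ` whose `H`-part is played
    -- by `ρ`.
    ⨾-elim : ∀ {t} → plays (ρ ⨾ τ) t → 2 ∣ length t ×
             ∃[ w ] closure ρ (map inj₂ (left w)) × closure τ w × t ≡ map inj₂ (right w)
    ⨾-elim (2∣t , s , c , d , eq) rewrite retract s = 2∣t , right s ,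
      subst (closure ρ) (onXY-inj₂ (right s)) c ,
      subst (closure τ) (onYZ-inj₂ (right s)) d ,
      trans eq (onXZ-inj₂ (right s))

    ⨾-intro : ∀ (w : List (Move H ⊎ Move K)) → closure ρ (map inj₂ (left w)) → closure τ w → 2 ∣ length (right w) →
              plays (ρ ⨾ τ) (map inj₂ (right w))
    ⨾-intro w c d 2∣w = subst (2 ∣_) (sym (length-map inj₂ (right w))) 2∣w , map inj₂ w ,
      subst (closure ρ) (sym (onXY-inj₂ w)) c , subst (closure τ) (sym (onYZ-inj₂ w)) d , sym (onXZ-inj₂ w)

closure-pos : ∀ {G} (S : Str G) {s} → closure (raw S) s → Pos G s
closure-pos S (inj₁ n)       = IsStrategy.positions (Str.isStrategy S) n
closure-pos S (inj₂ (p , _)) = p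

closure-even : ∀ {G} (σ : RawStrategy G) {s} → closure σ s → turn (reverse s) ≡ opponent → plays σ s
closure-even σ (inj₁ n) _ = n
closure-even σ {s} (inj₂ (_ , nd , _)) eq = ⊥-elim (nd (reverse-2∣ s eq))

reverse-position : ∀ {G s} → Pos G s → Position G (reverse s)
reverse-position {G} {s} p = ⟨ subst (Pos G) (sym (reverse-involutive s)) p ⟩

module _ {X H : RawGame} (LX : Laws X) (¬X : Move X → ⊥) (LH : Laws H)
         (ρ : RawStrategy (X ⊸ H)) (ρ-nil : plays ρ []) (T : Str (H ⊸ 𝕊)) where

  private
    module T = Strat (Str⇒strat T)
    module E = Opening LH 𝕊-laws ask 𝕊-ask

    turn-reverse-inj₂ : ∀ {Y : Set} (z : List Y) → turn z ≡ opponent → turn (reverse (map (inj₂ {A = Move X}) (reverse z))) ≡ opponent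
    turn-reverse-inj₂ z eq = 2∣-reverse (map inj₂ (reverse z)) (subst (2 ∣_)
      (sym (trans (length-map inj₂ (reverse z)) (length-reverse z))) (turn⇒2∣ z eq))

    right-asked : ∀ z → reverse (right (asked LH z)) ≡ ask ∷ []
    right-asked z = cong reverse (E.right-emb z)

    right-stopped : ∀ z → reverse (done ∷ right (asked LH z)) ≡ ask ∷ done ∷ []
    right-stopped z = cong (λ r → reverse (done ∷ r)) (E.right-emb z)

    ask-done : ∀ {r s} → s ≡ reverse (right r) → Form LH r →
               map (inj₂ {A = Move X}) s ≡ inj₂ ask ∷ inj₂ done ∷ [] → ∃[ z ] r ≡ inj₂ done ∷ asked LH z
    ask-done refl empty ()
    ask-done eq (running z) ad with refl ← trans eq (right-asked z) with () ← ad
    ask-done eq (stopped z) ad = z , refl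

    results : ∀ {r s} → s ≡ reverse (right r) → Form LH r → 2 ∣ length (map (inj₂ {A = Move X}) s) →
              s ≡ [] ⊎ s ≡ ask ∷ done ∷ []
    results eq empty _ = inj₁ eq
    results eq (running z) 2∣s with refl ← trans eq (right-asked z) with () ← 2∣⇒turn (ask ∷ []) 2∣s
    results eq (stopped z) _ = inj₂ (trans eq (right-stopped z))

  converges : ρ ⨾ raw T ↓ → ∃[ z ] plays ρ (map inj₂ (reverse z)) × T.N (inj₂ done ∷ asked LH z)
  converges (_ , ⊇) with ⨾-elim LX ¬X ρ (raw T) (⊇ (ask ∷ done ∷ [] , inj₂ refl , refl))
  ... | _ , w , c , d , eq with ask-done (right-reverse w refl) (form LH (reverse-position (closure-pos T d))) (sym eq)
  ...   | z , weq = z , closure-even ρ (subst (closure ρ) (cong (map inj₂) lw) c) (turn-reverse-inj₂ z even-z) ,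
          subst T.N weq (subst (plays (raw T)) (sym (reverse-involutive w))
            (closure-even (raw T) d (trans (cong turn weq) (trans (cong opposite
              (E.turn-emb z)) (trans (opposite-involutive _) even-z)))))
    where
    even-z : turn z ≡ opponent
    even-z = proj₂ (proj₂ (done-pos⁻ LH {z} (subst (Position _) weq (reverse-position (closure-pos T d)))))
    lw : left w ≡ reverse z
    lw = trans (left-reverse w weq) (cong reverse (E.left-emb z))

  -- Convergence is an equality of sets of plays, but only the presence of `ask · done` carries
  -- information: an even play of the composite can be nothing but empty or `ask · done`.
  converges⁻ : ∃[ z ] plays ρ (map inj₂ (reverse z)) × T.N (inj₂ done ∷ asked LH z) → ρ ⨾ raw T ↓
  converges⁻ (z , n , d) = ⊆ , ⊇
    where
    ⊆ : ∀ {t} → plays (ρ ⨾ raw T) t → plays (point X ⊤𝕊) t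
    ⊆ p with ⨾-elim LX ¬X ρ (raw T) p
    ... | 2∣t , w , c , d , refl = right w ,
          results (right-reverse w refl) (form LH (reverse-position (closure-pos T d))) 2∣t , refl
    w = reverse (inj₂ done ∷ asked LH z)
    right-w : right w ≡ ask ∷ done ∷ []
    right-w = trans (right-reverse w {inj₂ done ∷ asked LH z} (reverse-involutive _)) (right-stopped z)
    left-w : left w ≡ reverse z
    left-w = trans (left-reverse w {inj₂ done ∷ asked LH z} (reverse-involutive _)) (cong reverse (E.left-emb z))
    ⊇ : ∀ {t} → plays (point X ⊤𝕊) t → plays (ρ ⨾ raw T) t
    ⊇ (_ , inj₁ refl , refl) = ⨾-intro LX ¬X ρ (raw T) [] (inj₁ ρ-nil) (inj₁ T.nil) (2 ∣0)
    ⊇ (_ , inj₂ refl , refl) = subst (λ t → plays (ρ ⨾ raw T) (map inj₂ t)) right-w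
      (⨾-intro LX ¬X ρ (raw T) w (inj₁ (subst (λ s → plays ρ (map inj₂ s)) (sym left-w) n)) (inj₁ d)
        (subst (λ t → 2 ∣ length t) (sym right-w) ∣-refl))

module _ {G : RawGame} (LG : Laws G) (S : Str G) (T : Str (G ⊸ 𝕊)) where

  private
    ρ : RawStrategy (𝟏 ⊸ G)
    ρ = point 𝟏 (raw S)

    ρ-nil : plays ρ []
    ρ-nil = [] , Strat.nil (Str⇒strat S) , refl

    unpoint : ∀ z → plays ρ (map inj₂ (reverse z)) → plays (raw S) (reverse z)
    unpoint z (s , n , eq) = subst (plays (raw S)) (sym (map-injective (inj₂-injective {A = Move 𝟏}) eq)) n

    to : ∃[ z ] plays ρ (map inj₂ (reverse z)) × plays (raw T) (reverse (inj₂ done ∷ asked LG z)) →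
         Conv {G} (Strat.N (Str⇒strat S)) (Test.D (strat⇒test LG (Str⇒strat T)))
    to (z , n , d) = z , unpoint z n , d

    from : Conv {G} (Strat.N (Str⇒strat S)) (Test.D (strat⇒test LG (Str⇒strat T))) →
           ∃[ z ] plays ρ (map inj₂ (reverse z)) × plays (raw T) (reverse (inj₂ done ∷ asked LG z))
    from (z , n , d) = z , (reverse z , n , refl) , d

  point-converges : ρ ⨾ raw T ↓ → Conv {G} (Strat.N (Str⇒strat S)) (Test.D (strat⇒test LG (Str⇒strat T)))
  point-converges c = to (converges 𝟏-laws (λ ()) LG ρ ρ-nil T c)

  point-converges⁻ : Conv {G} (Strat.N (Str⇒strat S)) (Test.D (strat⇒test LG (Str⇒strat T))) → ρ ⨾ raw T ↓
  point-converges⁻ c = converges⁻ 𝟏-laws (λ ()) LG ρ ρ-nil T (from c)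

module _ {C : RawGame} (LC : Laws C) where

  open Bang LC

  turn-head : ∀ {i m r} → Position (! C) ((i , m) ∷ r) → turn ((i , m) ∷ r) ≡ player →
              turn (((i , m) ∷ r) ↾ i) ≡ player
  turn-head {i} {m} {r} p eq = trans (cong turn (↾-hit i m r)) (cong opposite
    (proj₁ (turn-threads (init-! p)) (opposite-adjoint eq) i))

  even-threads : ∀ {r} → Position (! C) r → (∀ i → turn (r ↾ i) ≡ opponent) → turn r ≡ opponent
  even-threads {[]} _ _ = refl
  even-threads {(i , m) ∷ r} p ev with turn ((i , m) ∷ r) in eq
  ... | opponent = refl
  ... | player = ⊥-elim (player≢opponent (trans (sym (turn-head p eq)) (ev i)))

module _ {M : Set} (P : ℕ → List M → Set) where

  ↾-∷ : ∀ i m r → (∀ k → k ≢ i → P k (r ↾ k)) → P i (m ∷ r ↾ i) → ∀ k → P k (((i , m) ∷ r) ↾ k)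
  ↾-∷ i m r others this k = lemma (i ≟ k)
    where lemma : Dec (i ≡ k) → P k (((i , m) ∷ r) ↾ k)
          lemma (yes refl) = subst (P i) (sym (↾-hit i m r)) this
          lemma (no i≢k)   = subst (P k) (sym (↾-miss m r i≢k)) (others k λ eq → i≢k (sym eq))

  ↾-∷⁻ : ∀ i m r → (∀ k → P k (((i , m) ∷ r) ↾ k)) → P i (m ∷ r ↾ i) × (∀ k → k ≢ i → P k (r ↾ k))
  ↾-∷⁻ i m r ps = subst (P i) (↾-hit i m r) (ps i) ,
    λ k k≢i → subst (P k) (↾-miss m r (λ eq → k≢i (sym eq))) (ps k)

  ↾-∷∷ : ∀ i m n r → (∀ k → k ≢ i → P k (r ↾ k)) → P i (n ∷ m ∷ r ↾ i) →
         ∀ k → P k (((i , n) ∷ (i , m) ∷ r) ↾ k)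
  ↾-∷∷ i m n r others this = ↾-∷ i n ((i , m) ∷ r)
    (λ k k≢i → subst (P k) (sym (↾-miss m r (λ eq → k≢i (sym eq)))) (others k k≢i))
    (subst (λ z → P i (n ∷ z)) (sym (↾-hit i m r)) this)

  ↾-∷∷⁻ : ∀ i m n r → (∀ k → P k (((i , n) ∷ (i , m) ∷ r) ↾ k)) →
          P i (n ∷ m ∷ r ↾ i) × (∀ k → k ≢ i → P k (r ↾ k))
  ↾-∷∷⁻ i m n r ps = subst (λ z → P i (n ∷ z)) (↾-hit i m r) (proj₁ (↾-∷⁻ i n ((i , m) ∷ r) ps)) ,
    λ k k≢i → subst (P k) (↾-miss m r (λ eq → k≢i (sym eq))) (proj₂ (↾-∷⁻ i n ((i , m) ∷ r) ps) k k≢i)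

Threads : {M : Set} → (List M → Set) → List (ℕ × M) → Set
Threads X u = ∀ i → X (u ↾ i)

-- The plays of the composite of S with copies of X.
Hidden : {M N : Set} → (List ((ℕ × M) ⊎ N) → Set) → (List M → Set) → List N → Set
Hidden S X t = ∃[ w ] S w × right w ≡ t × Threads X (left w)

module _ (p : (ℕ × ℕ) ↣ ℕ) where

  open Promotion p

  module _ {C : RawGame} (LC : Laws C) (y : RawStrategy (𝟏 ⇒ C)) (Z : Strat C)
           (y→Z : ∀ {s} → plays y (map inj₂ s) → Strat.N Z (reverse s))
           (Z→y : ∀ {z} → Strat.N Z z → plays y (map inj₂ (reverse z))) where

    private
      module Z = Strat Z
      open Bang LC

      inj₂-∷∷ : ∀ {X Y : Set} (b a : Y) r →
                map (inj₂ {A = X}) (reverse (b ∷ a ∷ r)) ≡ map inj₂ (reverse r) ++ inj₂ a ∷ inj₂ b ∷ []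
      inj₂-∷∷ b a r = trans (cong (map inj₂) (reverse-∷∷ b a r)) (map-++ inj₂ (reverse r) _)

    -- Over `𝟏` only the clause `right-right` of `Promote` can apply, so `y †` plays `y` in every
    -- thread separately.
    threads⇒promotion : ∀ {v} → Position (! C) v → turn v ≡ opponent → Threads Z.N v →
                        plays (y †) (map inj₂ (reverse v))
    threads⇒promotion {[]} _ _ _ = ε
    threads⇒promotion {(k , b) ∷ (i , a) ∷ r} pos eq ts
      with refl ← next-! pos (opposite-adjoint eq) =
      subst (plays (y †)) (sym (inj₂-∷∷ (i , b) (i , a) r))
        (step (threads⇒promotion (init-! (init-! pos)) (trans (sym (opposite-involutive _)) eq)
                (λ k → lemma k (k ≟ i)))
              (subst (Pos (! 𝟏 ⊸ ! C)) (trans (sym (reverse-map inj₂ ((i , a) ∷ r)))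
                  (trans (cong (map inj₂) (unfold-reverse (i , a) r)) (map-++ inj₂ (reverse r) _)))
                (position (inj₂-pos !𝟏-laws !-laws (init-! pos))))
              (right-right (_ , subst (plays y) (inj₂-∷∷ b a (r ↾ i)) (Z→y (proj₁ (↾-∷∷⁻ (λ _ → Z.N) i a b r ts))))))
      where
      lemma : ∀ k → Dec (k ≡ i) → Z.N (r ↾ k)
      lemma k (yes refl) = Z.back (just b) (proj₁ (↾-∷∷⁻ (λ _ → Z.N) i a b r ts))
      lemma k (no k≢i)   = proj₂ (↾-∷∷⁻ (λ _ → Z.N) i a b r ts) k k≢i

    private
      replies : ∀ {a b} → fun y (inj₂ a) (inj₂ b) → ∃[ z ] Z.N (b ∷ a ∷ z)
      replies {a} {b} (s , n) = reverse (right s) , subst Z.N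
        (reverse-++ (right s) (a ∷ b ∷ []))
        (y→Z (subst (plays y) (trans (cong (_++ inj₂ a ∷ inj₂ b ∷ []) (retract !𝟏-laws (λ ()) s))
          (sym (map-++ inj₂ (right s) _))) n))

    promotion⇒threads : ∀ {s} → plays (y †) s →
                        ∃[ v ] s ≡ map inj₂ (reverse v) × Position (! C) v × Threads Z.N v
    promotion⇒threads ε = [] , refl , Laws.nil !-laws , λ _ → Z.nil
    promotion⇒threads (step n pos (right-right {i} {b = a} {b′ = b} f)) with promotion⇒threads n | replies f
    ... | r , refl , pr , ts | z , m = (i , b) ∷ (i , a) ∷ r , sym (inj₂-∷∷ (i , b) (i , a) r) ,
          ext-! pa (cong opposite (even-threads LC pr λ k → Z.even (ts k))) (Z.N-pos m′) ,
          ↾-∷∷ (λ _ → Z.N) i a b r (λ k _ → ts k) m′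
      where
      pa : Position (! C) ((i , a) ∷ r)
      pa = inj₂-pos⁻ !𝟏-laws !-laws ⟨ subst (Pos (! 𝟏 ⊸ ! C))
        (trans (sym (map-++ inj₂ (reverse r) _))
          (trans (cong (map inj₂) (sym (unfold-reverse (i , a) r))) (reverse-map inj₂ ((i , a) ∷ r)))) pos ⟩
      m′ : Z.N (b ∷ a ∷ r ↾ i)
      m′ = Z.hf-∃ (just b) m (ts i) (!-pos-∷ pa)

  module _ {A B : RawGame} (LA : Laws A) (LB : Laws B) (x : Str (𝟏 ⇒ A)) (σ : Str (A ⇒ B)) where

    private
      X : Strat A
      X = strat-from !𝟏-laws (λ ()) LA (Str⇒strat x)
      module X = Strat X
      module S = Strat (Str⇒strat σ)
      module !A = Bang LA
      module L = Lolli !A.!-laws LB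

      x→X : ∀ {s} → plays (raw x) (map inj₂ s) → X.N (reverse s)
      x→X {s} n = subst (plays (raw x)) (trans (sym (reverse-involutive (map inj₂ s)))
        (cong reverse (sym (reverse-map inj₂ s)))) n

      X→x : ∀ {z} → X.N z → plays (raw x) (map inj₂ (reverse z))
      X→x {z} n = subst (plays (raw x)) (sym (reverse-map inj₂ z)) n

      right-even : ∀ {t a b} → L.State t a b → b ≡ opponent → t ≡ opponent × a ≡ opponent
      right-even L.both-even _ = refl , refl

      turn-map-reverse : ∀ {Y Z : Set} (u : List Y) → turn (reverse u) ≡ opponent →
                         turn (reverse (map (inj₂ {A = Z}) u)) ≡ opponent
      turn-map-reverse u eq = 2∣-reverse (map inj₂ u) (subst (2 ∣_) (sym (length-map inj₂ u)) (reverse-2∣ u eq))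

    composite⇒hidden : ∀ {s} → plays (raw x † ⨾ raw σ) (map inj₂ s) →
                       Hidden S.N X.N (reverse s)
    composite⇒hidden {s} n with ⨾-elim !𝟏-laws (λ ()) (raw x †) (raw σ) n
    ... | 2∣s , w , c , d , eq = reverse w ,
          subst (plays (raw σ)) (sym (reverse-involutive w)) (closure-even (raw σ) d (proj₁ evens)) ,
          trans right-w (cong reverse (sym s≡)) ,
          threads
      where
      s≡ : s ≡ right w
      s≡ = map-injective inj₂-injective eq
      right-w : right (reverse w) ≡ reverse (right w)
      right-w = mapMaybe-reverse isInj₂ w
      left-w : left (reverse w) ≡ reverse (left w)
      left-w = mapMaybe-reverse isInj₁ w
      pos : Position (A ⇒ B) (reverse w)
      pos = reverse-position (closure-pos σ d)
      -- `both-even` is the only state with Opponent to move in `B`. Hence both closures are reached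
      -- in actual plays and not merely in their domains.
      evens = right-even (L.state pos) (trans (cong turn right-w) (2∣-reverse (right w)
        (subst (2 ∣_) (trans (cong length eq) (length-map inj₂ (right w))) 2∣s)))
      c′ : plays (raw x †) (map inj₂ (left w))
      c′ = closure-even (raw x †) c (turn-map-reverse (left w)
        (trans (cong turn (sym left-w)) (proj₂ evens)))
      threads : Threads X.N (left (reverse w))
      threads with promotion⇒threads LA (raw x) X x→X (λ {z} → X→x {z}) c′
      ... | v , eq′ , _ , ts = subst (Threads X.N) (sym (trans left-w
        (trans (cong reverse (map-injective inj₂-injective eq′)) (reverse-involutive v)))) ts

    hidden⇒composite : ∀ {t} → Hidden S.N X.N t → turn t ≡ opponent →
                       plays (raw x † ⨾ raw σ) (map inj₂ (reverse t))
    hidden⇒composite (w , n , refl , ts) ev = subst (λ s → plays (raw x † ⨾ raw σ) (map inj₂ s))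
      (mapMaybe-reverse isInj₂ w)
      (⨾-intro !𝟏-laws (λ ()) (raw x †) (raw σ) (reverse w)
        (inj₁ (subst (λ s → plays (raw x †) (map inj₂ s)) (sym (mapMaybe-reverse isInj₁ w))
          (threads⇒promotion LA (raw x) X x→X (λ {z} → X→x {z}) {left w} pos
            (even-threads LA pos (λ i → X.even {left w ↾ i} (ts i))) ts)))
        (inj₁ n)
        (subst (λ s → 2 ∣ length s) (sym (mapMaybe-reverse isInj₂ w))
          (subst (2 ∣_) (sym (length-reverse (right w))) (turn⇒2∣ (right w) ev))))
      where
      pos : Position (! A) (left w)
      pos = proj₁ (proj₂ (⊸-split (S.N-pos {w} n)))

    module _ (Y : Strat B) (Y→hidden : ∀ {t} → Strat.N Y t → Hidden S.N X.N t)
             (hidden→Y : ∀ {t} → Hidden S.N X.N t → Strat.N Y t) (β : Str (B ⇒ 𝕊)) where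

      private
        module Y = Strat Y
        module !B = Bang LB
        D : List (ℕ × Move B) → Set
        D = Test.D (strat⇒test !B.!-laws (Str⇒strat β))

        y = raw σ ∘ raw x

        y→Y : ∀ {s} → plays y (map inj₂ s) → Y.N (reverse s)
        y→Y {s} n = hidden→Y (composite⇒hidden {s} n)

        Y→y : ∀ {z} → Y.N z → plays y (map inj₂ (reverse z))
        Y→y n = hidden⇒composite (Y→hidden n) (Y.even n)

        ρ : RawStrategy (! 𝟏 ⊸ ! B)
        ρ = y †

      Success : Set
      Success = ∃[ v ] Threads Y.N v × D v

      private
        to : ∃[ v ] plays ρ (map inj₂ (reverse v)) × plays (raw β) (reverse (inj₂ done ∷ asked !B.!-laws v)) → Success
        to (v , n , d) with promotion⇒threads LB y Y (λ {s} → y→Y {s}) (λ {z} → Y→y {z}) n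
        ... | v′ , eq , _ , ts = v , subst (Threads Y.N)
              (sym (reverse-injective {x = v} {y = v′} (map-injective inj₂-injective eq))) ts , d

        from : Success → ∃[ v ] plays ρ (map inj₂ (reverse v)) × plays (raw β) (reverse (inj₂ done ∷ asked !B.!-laws v))
        from (v , ts , d) = v , threads⇒promotion LB y Y (λ {s} → y→Y {s}) (λ {z} → Y→y {z}) {v}
          pos (even-threads LB pos (λ i → Y.even (ts i))) ts , d
          where pos : Position (! B) v
                pos = proj₁ (Test.D-pos (strat⇒test !B.!-laws (Str⇒strat β)) d)

      composite-converges : raw β ∘ y ↓ → Success
      composite-converges c = to (converges !𝟏-laws (λ ()) !B.!-laws ρ ε β c)

      composite-converges⁻ : Success → raw β ∘ y ↓
      composite-converges⁻ r = converges⁻ !𝟏-laws (λ ()) !B.!-laws ρ ε β (from r)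

-- Agents with hidden moves

-- An agent on R some of whose moves are hidden and answered at once by a
-- history-free environment e; E holds of the sequences whose hidden part
-- was played by e. All plays considered extend w₀.
record Environment (R V : RawGame) (N D : List (Move R) → Set) : Set₁ where
  field
    R-laws  : Laws R
    V-laws  : Laws V
    V-init  : ∀ {a t a′ t′} → Equiv V (a ∷ t) (a′ ∷ t′) → Equiv V t t′
    agent   : Agent R N D
    vis     : List (Move R) → List (Move V)
    inV     : Move V → Move R
    Hid     : Move R → Set
    view    : ∀ m → (∃[ a ] m ≡ inV a) ⊎ Hid m
    disjoint : ∀ {a} → Hid (inV a) → ⊥
    inV-injective : ∀ {a b} → inV a ≡ inV b → a ≡ b
    vis-inV : ∀ a w → vis (inV a ∷ w) ≡ a ∷ vis w
    vis-Hid : ∀ {h} w → Hid h → vis (h ∷ w) ≡ vis w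
    vis-pos : ∀ {w} → Position R w → Position V (vis w)
    vis-pend : ∀ {w} → Position R w → pend (label R) w ≡ [] → pend (label V) (vis w) ≡ []
    e       : Move R → Move R → Set
    e-functional : ∀ {h k k′} → e h k → e h k′ → k ≡ k′
    E       : List (Move R) → Set
    w₀      : List (Move R)
    N-w₀    : N w₀
    E-w₀    : E w₀
    -- `w₀` shows at most one move, so the visible part distinguishes it from a play with a
    -- completed visible exchange.
    short   : ∀ {b a t} → vis w₀ ≢ b ∷ a ∷ t

  -- The moments when the outside world is to move: at the start, or after a visible move of the
  -- agent.
  Ends : List (Move R) → Set
  Ends w = w ≡ w₀ ⊎ ∃[ b ] ∃[ w′ ] w ≡ inV b ∷ w′

  Extends : List (Move R) → Set
  Extends w = ∃[ s ] w ≡ s ++ w₀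

  field
    vis-≈   : ∀ {w w′} → E w → E w′ → Equiv R w w′ → Equiv V (vis w) (vis w′)
    enter   : ∀ {a w} → N w → Ends w → Position V (a ∷ vis w) → Position R (inV a ∷ w)
    E-vis   : ∀ {a w} → E w → E (inV a ∷ w)
    E-unvis : ∀ {a w} → Extends w → E (inV a ∷ w) → E w
    E-hid   : ∀ {h k w} → N (h ∷ w) → E w → Hid h → e h k →
              Position R (k ∷ h ∷ w) × E (k ∷ h ∷ w) × Hid k
    E-unhid : ∀ {h k w} → Extends w → N (h ∷ w) → Position R (k ∷ h ∷ w) → Hid k → E (k ∷ h ∷ w) → Hid h × e h k × E w
    E-start : ∀ {k} → Position R (k ∷ w₀) → Hid k → ⊥
    E-last  : ∀ {h w} → N (h ∷ w) → E (h ∷ w) → Hid h → ⊥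
    extend  : ∀ {a w a′ w′} → E w → E w′ → Equiv R w w′ → Equiv V (a ∷ vis w) (a′ ∷ vis w′) →
              Position R (inV a ∷ w) → Position R (inV a′ ∷ w′) → Equiv R (inV a ∷ w) (inV a′ ∷ w′)
    respond : ∀ {h k w h′ w′} → Equiv R (h ∷ w) (h′ ∷ w′) → N (h ∷ w) → N (h′ ∷ w′) → E w → E w′ → Hid h → e h k →
              Hid h′ × ∃[ k′ ] e h′ k′ × Equiv R (k ∷ h ∷ w) (k′ ∷ h′ ∷ w′)
    visible : ∀ {b w m w′} → Equiv R (inV b ∷ w) (m ∷ w′) → E w → E w′ → ∃[ b′ ] m ≡ inV b′

module Hide {R V : RawGame} {N D : List (Move R) → Set} (env : Environment R V N D) where

  open Environment env
  private
    module A = Agent agent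
    MR = Move R
    MV = Move V

  private
    -- By history-freeness any play of the agent may witness its reply to `m`.
    replies : Maybe MR → MR → Set
    replies o m = ∃[ z ] Reply N D o (m ∷ z)

  -- Chat (m ∷ w) u o: from m on, hidden exchanges lead to u, where the
  -- visible reply o is made.
  data Chat : List MR → List MR → Maybe MV → Set where
    out  : ∀ {b m w} → replies (just (inV b)) m → Chat (m ∷ w) (m ∷ w) (just b)
    stop : ∀ {m w} → replies nothing m → Chat (m ∷ w) (m ∷ w) nothing
    hid  : ∀ {h k m w u o} → replies (just h) m → Hid h → e h k → Chat (k ∷ h ∷ m ∷ w) u o → Chat (m ∷ w) u o

  private
    replies-functional : ∀ o o′ {m} → replies o m → replies o′ m → o ≡ o′
    replies-functional o o′ (_ , n) (_ , n′) = A.hf o o′ n n′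

    chat-functional : ∀ {w u o u′ o′} → Chat w u o → Chat w u′ o′ → u ≡ u′ × o ≡ o′
    chat-functional (out {b} f) (out {b′} g) =
      refl , cong just (inV-injective (just-injective (replies-functional (just (inV b)) (just (inV b′)) f g)))
    chat-functional (stop f) (stop g) = refl , refl
    chat-functional (hid {h} f hh x c) (hid {h′} g hh′ y c′)
      with refl ← replies-functional (just h) (just h′) f g with refl ← e-functional x y = chat-functional c c′
    chat-functional (out {b} f) (stop g) with () ← replies-functional (just (inV b)) nothing f g
    chat-functional (stop f) (out {b} g) with () ← replies-functional nothing (just (inV b)) f g
    chat-functional (hid {h} f _ _ _) (stop g) with () ← replies-functional (just h) nothing f g
    chat-functional (stop f) (hid {h} g _ _ _) with () ← replies-functional nothing (just h) f g
    chat-functional (hid {h} f hh _ _) (out {b} g)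
      with refl ← replies-functional (just h) (just (inV b)) f g = ⊥-elim (disjoint hh)
    chat-functional (out {b} f) (hid {h} g hh _ _)
      with refl ← replies-functional (just h) (just (inV b)) g f = ⊥-elim (disjoint hh)

    -- A chat consists of history-free replies on both sides, so it can be replayed after another
    -- past. This makes the visible agent history-free.
    shift : ∀ {m w u o} w′ → Chat (m ∷ w) u o → ∃[ u′ ] Chat (m ∷ w′) u′ o
    shift w′ (out f) = _ , out f
    shift w′ (stop f) = _ , stop f
    shift w′ (hid f h x c) = let u , c′ = shift _ c in u , hid f h x c′

  data Run : List MR → Set where
    start : Run w₀
    next  : ∀ {a b w u} → Run w → Position R (inV a ∷ w) → Chat (inV a ∷ w) u (just b) → Run (inV b ∷ u)

  private
    -- The replies of a chat are witnessed by unrelated plays; `hf-∃` and `E-hid` turn them into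
    -- moves made after the actual past `w`.
    grow : ∀ {m w u o} → N w → Position R (m ∷ w) → E (m ∷ w) → Chat (m ∷ w) u o →
           Reply N D (mapₘ inV o) u × E u × vis u ≡ vis (m ∷ w) × (∃[ n ] ∃[ v ] u ≡ n ∷ v × N v)
    grow {m} {w} nw p x (out (_ , n))  = A.hf-∃ (just _) n nw p , x , refl , _ , _ , refl , nw
    grow {m} {w} nw p x (stop (_ , d)) = A.hf-∃ nothing d nw p , x , refl , _ , _ , refl , nw
    grow {m} {w} nw p x (hid {h} {k} (_ , n) hh y c)
      with n′ ← A.hf-∃ (just h) n nw p
      with p′ , x′ , hk ← E-hid n′ x hh y
      with r , x″ , eq , rest ← grow n′ p′ x′ c
      = r , x″ , trans eq (trans (vis-Hid (h ∷ m ∷ w) hk) (vis-Hid (m ∷ w) hh)) , rest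

  ends : ∀ {w} → Run w → Ends w
  ends start          = inj₁ refl
  ends (next _ _ _)   = inj₂ (_ , _ , refl)

  run-N : ∀ {w} → Run w → N w
  run-E : ∀ {w} → Run w → E w

  run-N start        = N-w₀
  run-N (next r p c) = proj₁ (grow (run-N r) p (E-vis (run-E r)) c)

  run-E start        = E-w₀
  run-E (next r p c) = E-vis (proj₁ (proj₂ (grow (run-N r) p (E-vis (run-E r)) c)))

  private
    chat-vis : ∀ {a w u o} → Run w → Position R (inV a ∷ w) → Chat (inV a ∷ w) u o → vis u ≡ a ∷ vis w
    chat-vis {a} {w} r p c = trans (proj₁ (proj₂ (proj₂ (grow (run-N r) p (E-vis (run-E r)) c)))) (vis-inV a w)

  N′ D′ : List MV → Set
  N′ t = ∃[ w ] Run w × vis w ≡ t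
  D′ t = ∃[ a ] ∃[ w ] ∃[ u ] t ≡ a ∷ vis w × Run w × Position R (inV a ∷ w) × Chat (inV a ∷ w) u nothing

  next-vis : ∀ {a b w u} → Run w → Position R (inV a ∷ w) → Chat (inV a ∷ w) u (just b) →
             vis (inV b ∷ u) ≡ b ∷ a ∷ vis w
  next-vis {a} {b} {w} {u} r p c = trans (vis-inV b u) (cong (b ∷_) (chat-vis r p c))

  private
    Replies′ : Maybe MV → MV → List MV → Set
    Replies′ o a t = ∃[ w ] ∃[ u ] vis w ≡ t × Run w × Position R (inV a ∷ w) × Chat (inV a ∷ w) u o

    intro : ∀ o {a t} → Replies′ o a t → Reply N′ D′ o (a ∷ t)
    intro (just b) (w , u , refl , r , p , c) = _ , next r p c ,
      trans (vis-inV b u) (cong (b ∷_) (chat-vis r p c))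
    intro nothing (w , u , refl , r , p , c) = _ , w , u , refl , r , p , c

    elim : ∀ o {a t} → Reply N′ D′ o (a ∷ t) → Replies′ o a t
    elim (just b) (_ , start , eq) = ⊥-elim (short eq)
    elim (just b) (_ , next {a} {b′} {w} {u} r p c , eq)
      with refl ← trans (sym eq) (trans (vis-inV b′ u) (cong (b′ ∷_) (chat-vis r p c)))
      = w , u , refl , r , p , c
    elim nothing (a , w , u , refl , r , p , c) = w , u , refl , r , p , c

    -- Two plays run in lockstep: self-equivalence of the agent matches its moves, `respond` matches
    -- those of the environment, and `visible` makes both leave the chat at the same time.
    sync : ∀ {m w m′ w′ u o} → N w → N w′ → E (m ∷ w) → E (m′ ∷ w′) → Equiv R (m ∷ w) (m′ ∷ w′) →
           Chat (m ∷ w) u o →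
           ∃[ u′ ] ∃[ o′ ] Chat (m′ ∷ w′) u′ o′ × Ext R (mapₘ inV o) u (mapₘ inV o′) u′
    sync nw nw′ x x′ eq (out {b} (_ , n))
      with n′ ← A.hf-∃ (just (inV b)) n nw (Laws.≈-pos₁ R-laws eq)
      with A.self (just (inV b)) n′ nw nw′ eq
    ... | just m″ , n″ , eq″ with visible eq″ x x′
    ...   | b′ , refl = _ , just b′ , out (_ , n″) , eq″
    sync nw nw′ x x′ eq (stop (_ , d))
      with A.self nothing (A.hf-∃ nothing d nw (Laws.≈-pos₁ R-laws eq)) nw nw′ eq
    ... | nothing , d″ , _ = _ , nothing , stop (_ , d″) , tt
    sync nw nw′ x x′ eq (hid {h} (_ , n) hh y c)
      with n′ ← A.hf-∃ (just h) n nw (Laws.≈-pos₁ R-laws eq)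
      with A.self (just h) n′ nw nw′ eq
    ... | just h′ , n″ , eq″
      with hh′ , k′ , y′ , eq‴ ← respond eq″ n′ n″ x x′ hh y
      with u′ , o′ , c′ , ext ← sync n′ n″ (proj₁ (proj₂ (E-hid n′ x hh y))) (proj₁ (proj₂ (E-hid n″ x′ hh′ y′))) eq‴ c
      = u′ , o′ , hid (_ , n″) hh′ y′ c′ , ext

    two : ∀ {X : Set} {b a : X} {t} (l : List X) → length l ≡ length (b ∷ a ∷ t) →
          ∃[ b′ ] ∃[ a′ ] ∃[ t′ ] l ≡ b′ ∷ a′ ∷ t′
    two (_ ∷ _ ∷ _) _ = _ , _ , _ , refl

    -- Recovers the equivalence of the hidden parts from that of the visible ones. It goes by
    -- rounds: the play before a round is equivalent by induction, `extend` adds the incoming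
    -- visible move, and `sync` carries the equivalence through the chat.
    couple : ∀ {w w′} → Run w → Run w′ → Equiv V (vis w) (vis w′) → Equiv R w w′
    couple start start eq = Laws.≈-refl R-laws (A.N-pos N-w₀)
    couple start (next {a} {b} {w} r p c) eq = ⊥-elim (short (proj₂ (proj₂ (proj₂ (two {b = b} {a} {vis w} (vis w₀)
      (trans (Laws.≈-length V-laws eq) (cong length (next-vis r p c))))))))
    couple (next {a} {b} {w} r p c) start eq = ⊥-elim (short (proj₂ (proj₂ (proj₂ (two {b = b} {a} {vis w} (vis w₀)
      (trans (sym (Laws.≈-length V-laws eq)) (cong length (next-vis r p c))))))))
    couple (next r p c) (next r′ p′ c′) eq
      with eq₁ ← V-init (subst₂ (Equiv V) (next-vis r p c) (next-vis r′ p′ c′) eq)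
      with sync (run-N r) (run-N r′) (E-vis (run-E r)) (E-vis (run-E r′))
             (extend (run-E r) (run-E r′) (couple r r′ (V-init eq₁)) eq₁ p p′) c
    -- Chats are deterministic, so the one produced by `sync` is the one that the second run really
    -- contains.
    ... | u″ , just b″ , c″ , ext with refl , refl ← chat-functional c″ c′ = ext

    self : Sim V N′ D′ N′ D′
    self o {a} {_} {a′} n _ (w′ , r′ , refl) eq with elim o n
    ... | w , u , refl , r , p , c
      with p′ ← enter (run-N r′) (ends r′) (Laws.≈-pos₂ V-laws eq)
      with u′ , o′ , c′ , ext ← sync (run-N r) (run-N r′) (E-vis (run-E r)) (E-vis (run-E r′))
             (extend (run-E r) (run-E r′) (couple r r′ (V-init eq)) eq p p′) c
      = o′ , intro o′ (w′ , u′ , refl , r′ , p′ , c′) , finish o o′ c c′ ext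
      where
      finish : ∀ o o′ → Chat (inV a ∷ w) u o → Chat (inV a′ ∷ w′) u′ o′ → Ext R (mapₘ inV o) u (mapₘ inV o′) u′ →
               Ext V o (a ∷ vis w) o′ (a′ ∷ vis w′)
      finish nothing nothing _ _ _ = tt
      finish (just b) (just b′) c c′ ext = subst₂ (Equiv V) (next-vis r p c) (next-vis r′ p′ c′) (vis-≈ (run-E (next r p c)) (run-E (next r′ p′ c′)) ext)

    position-D : ∀ {z} → D′ z → Position V z × pend (label V) z ≡ []
    position-D (a , w , u , refl , r , p , c)
      with d ← A.D-pos (proj₁ (grow (run-N r) p (E-vis (run-E r)) c)) =
      subst (λ t → Position V t × pend (label V) t ≡ []) (chat-vis r p c)
        (vis-pos (proj₁ d) , vis-pend (proj₁ d) (proj₂ d))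

  visible-agent : Agent V N′ D′
  visible-agent = record
    { N-pos = λ { (w , r , refl) → vis-pos (A.N-pos (run-N r)) }
    ; D-pos = position-D
    ; back  = λ o n → let w , u , eq , r , _ = elim o n in w , r , eq
    ; hf    = λ o o′ n n′ → let w , u , _ , _ , _ , c = elim o n ; _ , _ , _ , _ , _ , c′ = elim o′ n′ in
              proj₂ (chat-functional c (proj₂ (shift w c′)))
    ; hf-∃  = λ { o n (w′ , r′ , refl) p → let _ , _ , _ , _ , _ , c = elim o n ; u′ , c′ = shift w′ c in
              intro o (w′ , u′ , refl , r′ , enter (run-N r′) (ends r′) p , c′) }
    ; self  = self
    }

  data From : List MR → Set where
    base : From w₀
    step : ∀ {a b w} → From w → N (b ∷ a ∷ w) → From (b ∷ a ∷ w)

  private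
    extends : ∀ {w} → From w → Extends w
    extends base = [] , refl
    extends (step {a} {b} f _) = let s , eq = extends f in b ∷ a ∷ s , cong (λ w → b ∷ a ∷ w) eq

    -- The round in progress, begun by `inV a` after the run `v`; the last component puts the
    -- exchanges already made in front of a chat starting at `w`.
    Entered : List MR → Set
    Entered w = ∃[ a ] ∃[ v ] Run v × Position R (inV a ∷ v) × (∀ {u o} → Chat w u o → Chat (inV a ∷ v) u o)

  -- Regroups a play into rounds. `entered` goes back through the hidden exchanges to the visible
  -- move that began the round, and `E-last` excludes that the agent stops at a hidden move of its
  -- own.
  runs : ∀ {w} → From w → E w → Run w

  private
    entered : ∀ {m w} → From w → Position R (m ∷ w) → E (m ∷ w) → Entered (m ∷ w)
    entered {m} f p x with view m
    ... | inj₁ (a , refl) = a , _ , runs f (E-unvis (extends f) x) , p , λ c → c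
    entered base p x | inj₂ hk = ⊥-elim (E-start p hk)
    entered (step {a′} f n) p x | inj₂ hk
      with hh , y , x′ ← E-unhid (let s , eq = extends f in a′ ∷ s , cong (a′ ∷_) eq) n p hk x
      with a , v , r , p′ , g ← entered f (Laws.init R-laws (A.N-pos n)) x′
      = a , v , r , p′ , λ c → g (hid (_ , n) hh y c)

  runs base x = start
  runs (step {a} {b} f n) x with view b
  ... | inj₂ hb = ⊥-elim (E-last n x hb)
  ... | inj₁ (b′ , refl) with entered f (Laws.init R-laws (A.N-pos n))
        (E-unvis (let s , eq = extends f in a ∷ s , cong (a ∷_) eq) x)
  ...   | a′ , v , r , p , g = next r p (g (out (_ , n)))

  D′-intro : ∀ {m w} → From w → D (m ∷ w) → E (m ∷ w) → D′ (vis (m ∷ w))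
  D′-intro {m} {w} f d x with entered f (proj₁ (A.D-pos d)) x
  ... | a , v , r , p , g = a , v , m ∷ w , chat-vis r p (g (stop (_ , d))) , r , p , g (stop (_ , d))

  D′-elim : ∀ {t} → D′ t → ∃[ u ] D u × E u × vis u ≡ t
  D′-elim (a , w , u , refl , r , p , c) with grow (run-N r) p (E-vis (run-E r)) c
  ... | d , x , _ = u , d , x , chat-vis r p c

agent-D : ∀ {G N D D₂} → (∀ {z} → D z → D₂ z) → (∀ {z} → D₂ z → D z) → Agent G N D → Agent G N D₂
agent-D {G} {N} {D} {D₂} f g A = record
  { N-pos = N-pos
  ; D-pos = λ d → D-pos (g d)
  ; back  = λ o n → back o (to o n)
  ; hf    = λ o o′ n n′ → hf o o′ (to o n) (to o′ n′)
  ; hf-∃  = λ o n n′ p → from o (hf-∃ o (to o n) n′ p)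
  ; self  = λ o n m n′ e → let o′ , n″ , x = self o (to o n) m n′ e in o′ , from o′ n″ , x
  }
  where
  open Agent A
  to : ∀ o {z} → Reply N D₂ o z → Reply N D o z
  to (just _) n = n
  to nothing  d = g d
  from : ∀ o {z} → Reply N D o z → Reply N D₂ o z
  from (just _) n = n
  from nothing  d = f d

-- Extending equivalent positions

module _ {C : RawGame} where

  thread-≈ : ∀ {i m r i′ m′ r′} (e : !-Equiv {C} ((i , m) ∷ r) ((i′ , m′) ∷ r′)) →
             !-Equiv.π e i ≡ i′ × Equiv C (m ∷ r ↾ i) (m′ ∷ r′ ↾ i′)
  thread-≈ {i} {m} {r} {i′} {m′} {r′} e with i′-eq ← ∷-injectiveˡ (!-Equiv.tags e) =
    i′-eq , subst₂ (Equiv C) (↾-hit i m r) (↾-hit i′ m′ r′)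
      (subst (λ k → Equiv C (((i , m) ∷ r) ↾ i) (((i′ , m′) ∷ r′) ↾ k)) i′-eq (!-Equiv.threads e i))

  -- The equivalence is taken in split form because the extended one must use the same permutation.
  ≈-∷ : ∀ {r r′ i m i′ m′} (e : !-Equiv {C} r r′) → !-Equiv.π e i ≡ i′ →
        Position (! C) ((i , m) ∷ r) → Position (! C) ((i′ , m′) ∷ r′) →
        Equiv C (m ∷ r ↾ i) (m′ ∷ r′ ↾ i′) → Equiv (! C) ((i , m) ∷ r) ((i′ , m′) ∷ r′)
  ≈-∷ {r} {r′} {i} {m} {_} {m′} e refl p p′ eq = !-≈-join (equivs p p′ perm
    (λ k → lemma k (i ≟ k)) (cong (π i ∷_) tags))
    where
    open !-Equiv e
    lemma : ∀ k → Dec (i ≡ k) → Equiv C (((i , m) ∷ r) ↾ k) (((π i , m′) ∷ r′) ↾ π k)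
    lemma k (yes refl) = subst₂ (Equiv C) (sym (↾-hit i m r)) (sym (↾-hit (π i) m′ r′)) eq
    lemma k (no i≢k)   = subst₂ (Equiv C) (sym (↾-miss m r i≢k))
      (sym (↾-miss m′ r′ (λ πi≡πk → i≢k (π-injective πi≡πk)))) (threads k)

  ≈-∷∷ : ∀ {r r′ i a b i′ a′ b′} → !-Equiv {C} ((i , a) ∷ r) ((i′ , a′) ∷ r′) →
         Position (! C) ((i , b) ∷ (i , a) ∷ r) → Position (! C) ((i′ , b′) ∷ (i′ , a′) ∷ r′) →
         Equiv C (b ∷ a ∷ r ↾ i) (b′ ∷ a′ ∷ r′ ↾ i′) →
         Equiv (! C) ((i , b) ∷ (i , a) ∷ r) ((i′ , b′) ∷ (i′ , a′) ∷ r′)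
  ≈-∷∷ {r} {r′} {i} {a} {b} {i′} {a′} {b′} e p p′ eq = ≈-∷ e (proj₁ (thread-≈ e)) p p′
    (subst₂ (λ z z′ → Equiv C (b ∷ z) (b′ ∷ z′)) (sym (↾-hit i a r)) (sym (↾-hit i′ a′ r′)) eq)

module _ {A B : RawGame} where

  ⇒-≈-left : ∀ {i a b z i′ a′ b′ z′} → Equiv (A ⇒ B) (inj₁ (i , a) ∷ z) (inj₁ (i′ , a′) ∷ z′) →
             Position (A ⇒ B) (inj₁ (i , b) ∷ inj₁ (i , a) ∷ z) →
             Position (A ⇒ B) (inj₁ (i′ , b′) ∷ inj₁ (i′ , a′) ∷ z′) →
             Equiv A (b ∷ a ∷ left z ↾ i) (b′ ∷ a′ ∷ left z′ ↾ i′) →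
             Equiv (A ⇒ B) (inj₁ (i , b) ∷ inj₁ (i , a) ∷ z) (inj₁ (i′ , b′) ∷ inj₁ (i′ , a′) ∷ z′)
  ⇒-≈-left e p p′ eq = ⊸-≈-join (equivs p p′
    (≈-∷∷ (!-≈-split lefts) (proj₁ (proj₂ (⊸-split p))) (proj₁ (proj₂ (⊸-split p′))) eq)
    rights (cong (false ∷_) tags))
    where open ⊸-Equiv (⊸-≈-split e)

  ⇒-≈-right : ∀ {z z′ b b′} → Equiv (A ⇒ B) z z′ → Position (A ⇒ B) (inj₂ b ∷ z) → Position (A ⇒ B) (inj₂ b′ ∷ z′) →
              Equiv B (b ∷ right z) (b′ ∷ right z′) → Equiv (A ⇒ B) (inj₂ b ∷ z) (inj₂ b′ ∷ z′)
  ⇒-≈-right e p p′ eq = ⊸-≈-join (equivs p p′ lefts eq (cong (true ∷_) tags))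
    where open ⊸-Equiv (⊸-≈-split e)

  ⇒-thread-≈ : ∀ {i a z i′ a′ z′} → Equiv (A ⇒ B) (inj₁ (i , a) ∷ z) (inj₁ (i′ , a′) ∷ z′) →
               Equiv A (a ∷ left z ↾ i) (a′ ∷ left z′ ↾ i′)
  ⇒-thread-≈ e = proj₂ (thread-≈ (!-≈-split (⊸-Equiv.lefts (⊸-≈-split e))))

-- The composite σ ∘ x as a strategy on B.
module Apply {A B : RawGame} (LA : Laws A) (B-game : IsGame B) (S : Strat (A ⇒ B)) (X : Strat A) where

  private
    LB = game-laws B-game
    module LB = Laws LB
    module !A = Bang LA
    module L = Lolli !A.!-laws LB
    module S = Strat S
    module X = Strat X

  data Copies : Move (A ⇒ B) → Move (A ⇒ B) → Set where
    copy : ∀ {i a b z} → X.N (b ∷ a ∷ z) → Copies (inj₁ (i , a)) (inj₁ (i , b))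

  private
    Hid : Move (A ⇒ B) → Set
    Hid m = ∃[ h ] m ≡ inj₁ h

    E : List (Move (A ⇒ B)) → Set
    E w = Threads X.N (left w)

    inj₁≢inj₂ : ∀ {h} → ∃[ b ] inj₁ {B = Move B} h ≡ inj₂ {A = Move (! A)} b → ⊥
    inj₁≢inj₂ ()

    left-pos : ∀ {w} → Position (A ⇒ B) w → Position (! A) (left w)
    left-pos p = proj₁ (proj₂ (⊸-split p))

    left-turn : ∀ {h w} → S.N (inj₁ h ∷ w) → turn (h ∷ left w) ≡ player
    left-turn n = L.turn-left (S.N-pos n) (S.even n)

    E-hid : ∀ {h k w} → S.N (h ∷ w) → E w → Hid h → Copies h k →
            Position (A ⇒ B) (k ∷ h ∷ w) × E (k ∷ h ∷ w) × Hid k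
    E-hid {w = w} n x _ (copy {i} {a} {b} m) =
      L.ext-left (S.N-pos n) (S.even n) (!A.ext-! pa (left-turn n) (X.N-pos m′)) ,
      ↾-∷∷ (λ _ → X.N) i a b (left w) (λ k _ → x k) m′ , _ , refl
      where
      pa : Position (! A) ((i , a) ∷ left w)
      pa = left-pos (S.N-pos n)
      m′ : X.N (b ∷ a ∷ left w ↾ i)
      m′ = X.hf-∃ (just b) m (x i) (!A.!-pos-∷ pa)

    E-unhid : ∀ {h k w} → S.N (h ∷ w) → Position (A ⇒ B) (k ∷ h ∷ w) → Hid k → E (k ∷ h ∷ w) →
              Hid h × Copies h k × E w
    E-unhid {inj₂ b} n p (_ , refl) x = ⊥-elim (inj₁≢inj₂ (L.next-right p (S.even n)))
    E-unhid {inj₁ (i , a)} {w = w} n p ((k , b) , refl) x = unhide (!A.next-! (left-pos p) (left-turn n)) x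
      where
      unhide : k ≡ i → E (inj₁ (k , b) ∷ inj₁ (i , a) ∷ w) →
               Hid (inj₁ (i , a)) × Copies (inj₁ (i , a)) (inj₁ (k , b)) × E w
      unhide refl x = (_ , refl) , copy (proj₁ threads) , λ k → lemma k (k ≟ i)
        where
        threads = ↾-∷∷⁻ (λ _ → X.N) i a b (left w) x
        lemma : ∀ k → Dec (k ≡ i) → X.N (left w ↾ k)
        lemma k (yes refl) = X.back (just b) (proj₁ threads)
        lemma k (no k≢i)   = proj₂ threads k k≢i

    respond : ∀ {h k w h′ w′} → Equiv (A ⇒ B) (h ∷ w) (h′ ∷ w′) → S.N (h ∷ w) → S.N (h′ ∷ w′) → E w → E w′ →
              Hid h → Copies h k →
              Hid h′ × ∃[ k′ ] Copies h′ k′ × Equiv (A ⇒ B) (k ∷ h ∷ w) (k′ ∷ h′ ∷ w′)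
    respond {h′ = inj₂ _} e _ _ _ _ (_ , refl) _ with () ← ∷-injectiveˡ (⊸-Equiv.tags (⊸-≈-split e))
    respond {w = w} {inj₁ (i′ , a′)} {w′} e n n′ x x′ hh (copy {i} {a} {b} m) = reply
        (X.self (just b) m′ (x i) (x′ i′) (⇒-thread-≈ e))
      where
      m′ : X.N (b ∷ a ∷ left w ↾ i)
      m′ = X.hf-∃ (just b) m (x i) (!A.!-pos-∷ (left-pos (S.N-pos n)))
      reply : ∃[ o ] Reply X.N (λ _ → ⊥) o (a′ ∷ left w′ ↾ i′) ×
                Ext A (just b) (a ∷ left w ↾ i) o (a′ ∷ left w′ ↾ i′) →
              Hid (inj₁ (i′ , a′)) × ∃[ k′ ] Copies (inj₁ (i′ , a′)) k′ ×
                Equiv (A ⇒ B) (inj₁ (i , b) ∷ inj₁ (i , a) ∷ w) (k′ ∷ inj₁ (i′ , a′) ∷ w′)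
      reply (just b′ , m″ , e″) = (_ , refl) , inj₁ (i′ , b′) , copy m″ , ⇒-≈-left e
        (proj₁ (E-hid n x (_ , refl) (copy m))) (proj₁ (E-hid n′ x′ (_ , refl) (copy {i′} m″))) e″

  environment : Environment (A ⇒ B) B S.N (λ _ → ⊥)
  environment = record
    { R-laws  = L.⊸-laws
    ; V-laws  = LB
    ; V-init  = ≈-init B-game
    ; agent   = S.agent
    ; vis     = right
    ; inV     = inj₂
    ; Hid     = Hid
    ; view    = λ { (inj₁ h) → inj₂ (h , refl) ; (inj₂ b) → inj₁ (b , refl) }
    ; disjoint = λ { (_ , ()) }
    ; inV-injective = inj₂-injective
    ; vis-inV = λ _ _ → refl
    ; vis-Hid = λ { _ (_ , refl) → refl }
    ; vis-pos = λ p → proj₂ (proj₂ (⊸-split p))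
    ; vis-pend = λ {w} p → pend-restricts-[] _ _ _ _ (proj₁ (⊸-split p)) (L.restricts-right w)
    ; e       = Copies
    ; e-functional = λ { (copy {i} {b = b} m) (copy {b = c} m′) →
                         cong (λ b → inj₁ (i , b)) (just-injective (X.hf (just b) (just c) m m′)) }
    ; E       = E
    ; w₀      = []
    ; N-w₀    = S.nil
    ; E-w₀    = λ _ → X.nil
    ; short   = λ ()
    ; vis-≈   = λ _ _ e → ⊸-Equiv.rights (⊸-≈-split e)
    ; enter   = λ { n (inj₁ refl) p → L.ext-first p
                  ; n (inj₂ (_ , _ , refl)) p → L.ext-right (S.N-pos n) (S.even n) p }
    ; E-vis   = λ x → x
    ; E-unvis = λ _ x → x
    ; E-hid   = E-hid
    ; E-unhid = λ _ → E-unhid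
    ; E-start = λ { p (_ , refl) → ⊥-elim (inj₁≢inj₂ (L.first-right p)) }
    -- A hidden move of the agent leaves its thread odd, while `E` admits even threads only.
    ; E-last  = λ { {w = w} n x ((i , a) , refl) → player≢opponent (trans
                    (sym (turn-head LA {i} {a} {left w} (left-pos (S.N-pos n)) (left-turn n))) (X.even (x i))) }
    ; extend  = λ _ _ e eb p p′ → ⇒-≈-right e p p′ eb
    ; respond = respond
    ; visible = λ { {m = inj₁ _} e _ _ → ⊥-elim (true≢false (∷-injectiveˡ (⊸-Equiv.tags (⊸-≈-split e))))
                  ; {m = inj₂ b′} _ _ _ → b′ , refl }
    }
    where
    true≢false : true ≢ false
    true≢false ()

  private module Y = Hide environment

  private
    from : ∀ {w} → S.N w → Y.From w
    from {[]} n = Y.base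
    from {_ ∷ []} n with () ← S.even n
    from {b ∷ a ∷ w} n = Y.step (from (S.back (just b) n)) n

    even-state : ∀ {t a b} → L.State t a b → t ≡ opponent → a ≡ opponent → b ≡ opponent
    even-state L.both-even _ _ = refl

  hidden⇒N : ∀ {t} → Hidden S.N X.N t → Y.N′ t
  hidden⇒N (w , n , eq , x) = w , Y.runs (from n) x , eq

  N⇒hidden : ∀ {t} → Y.N′ t → Hidden S.N X.N t
  N⇒hidden (w , r , eq) = w , Y.run-N r , eq , Y.run-E r

  apply : Strat B
  apply = record
    { N     = Y.N′
    ; agent = agent-D (λ d → proj₁ (proj₂ (Y.D′-elim d))) (λ ()) Y.visible-agent
    ; nil   = [] , Y.start , refl
    ; even  = even
    }
    where
    even : ∀ {t} → Y.N′ t → turn t ≡ opponent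
    even (w , r , refl) = even-state (L.state (S.N-pos (Y.run-N r))) (S.even (Y.run-N r))
      (even-threads LA (left-pos (S.N-pos (Y.run-N r))) (λ i → X.even (Y.run-E r i)))

-- The test on B obtained from the test β on ! B by playing B in the thread j
-- and copies of the strategies F i in the other threads. Its plays start
-- with the play v₀ · (j , b₀) of β, so that the index permutations relating
-- two of its plays fix the indices in v₀ and j.
module Section {B : RawGame} (B-game : IsGame B) (β : Test (! B)) (j : ℕ) (b₀ : Move B) (v₀ : List (Move (! B)))
  (started : Test.N β ((j , b₀) ∷ v₀)) (fresh : v₀ ↾ j ≡ [])
  (F : ℕ → Strat B) (played : ∀ i → i ≢ j → Strat.N (F i) (v₀ ↾ i))
  (F-invariant : (π : ℕ → ℕ) → (∀ {i k} → π i ≡ π k → i ≡ k) → map (π ∘′ proj₁) v₀ ≡ map proj₁ v₀ →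
                 ∀ i → F (π i) ≡ F i) where

  private
    LB = game-laws B-game
    module LB = Laws LB
    module !B = Bang LB
    module β = Test β
    module F i = Strat (F i)
    MR = Move (! B)

    w₀ : List MR
    w₀ = (j , b₀) ∷ v₀

  data Copies : MR → MR → Set where
    copy : ∀ {i a b z} → F.N i (b ∷ a ∷ z) → Copies (i , a) (i , b)

  Filled : ℕ → List (Move B) → Set
  Filled i z = i ≢ j → F.N i z

  -- That `w` extends `w₀` belongs to `E`, since this is what pins down the index permutations in
  -- `fixes`.
  E : List MR → Set
  E w = (∃[ s ] w ≡ s ++ w₀) × (∀ i → Filled i (w ↾ i))

  private
    Hid : MR → Set
    Hid m = proj₁ m ≢ j

    extends-∷ : ∀ {m w} → (∃[ s ] w ≡ s ++ w₀) → ∃[ s ] m ∷ w ≡ s ++ w₀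
    extends-∷ {m} (s , eq) = m ∷ s , cong (m ∷_) eq

    split-tags : ∀ {f : MR → ℕ} s s′ → length s ≡ length s′ →
                 map f (s ++ w₀) ≡ map proj₁ (s′ ++ w₀) → map f w₀ ≡ map proj₁ w₀
    split-tags []      []       _  eq = eq
    split-tags (_ ∷ s) (_ ∷ s′) le eq = split-tags s s′ (suc-injective le) (∷-injectiveʳ eq)

    -- The tag sequences have equal length, so the two final segments `w₀` are aligned and `π` maps
    -- the tags of `w₀` to themselves one by one.
    fixes : ∀ {π : ℕ → ℕ} {w w′} → (∃[ s ] w ≡ s ++ w₀) → (∃[ s ] w′ ≡ s ++ w₀) →
            map (π ∘′ proj₁) w ≡ map proj₁ w′ → map (π ∘′ proj₁) w₀ ≡ map proj₁ w₀
    fixes (s , refl) (s′ , refl) eq = split-tags s s′ lengths eq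
      where
      lengths : length s ≡ length s′
      lengths = +-cancelʳ-≡ (length w₀) (length s) (length s′) (trans (sym (length-++ s)) (trans
        (trans (sym (length-map _ (s ++ w₀))) (trans (cong length eq) (length-map proj₁ (s′ ++ w₀))))
        (length-++ s′)))

    fixes-j : ∀ {w w′} → E w → E w′ → (e : !-Equiv {B} w w′) → !-Equiv.π e j ≡ j
    fixes-j x x′ e = ∷-injectiveˡ (fixes (proj₁ x) (proj₁ x′) (!-Equiv.tags e))

    E-vis : ∀ {a w} → E w → E ((j , a) ∷ w)
    E-vis {a} {w} (ex , fs) = extends-∷ ex , ↾-∷ Filled j a w (λ k _ → fs k) (λ j≢j → ⊥-elim (j≢j refl))

    E-unvis : ∀ {a w} → (∃[ s ] w ≡ s ++ w₀) → E ((j , a) ∷ w) → E w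
    E-unvis {a} {w} ex (_ , fs) = ex , λ k k≢j → proj₂ (↾-∷⁻ Filled j a w fs) k k≢j k≢j

    E-hid : ∀ {h k w} → β.N (h ∷ w) → E w → Hid h → Copies h k →
            Position (! B) (k ∷ h ∷ w) × E (k ∷ h ∷ w) × Hid k
    E-hid {w = w} n (ex , fs) i≢j (copy {i} {a} {b} m) =
      !B.ext-! (β.N-pos n) (β.odd n) (F.N-pos i m′) ,
      (extends-∷ (extends-∷ ex) , ↾-∷∷ Filled i a b w (λ k _ → fs k) (λ _ → m′)) , i≢j
      where
      m′ : F.N i (b ∷ a ∷ w ↾ i)
      m′ = F.hf-∃ i (just b) m (fs i i≢j) (!B.!-pos-∷ (β.N-pos n))

    E-unhid : ∀ {h k w} → (∃[ s ] w ≡ s ++ w₀) → β.N (h ∷ w) → Position (! B) (k ∷ h ∷ w) → Hid k →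
              E (k ∷ h ∷ w) → Hid h × Copies h k × E w
    E-unhid {i , a} {k , b} {w} ex n p k≢j x = unhide (!B.next-! p (β.odd n)) k≢j x
      where
      unhide : k ≡ i → k ≢ j → E ((k , b) ∷ (i , a) ∷ w) → i ≢ j × Copies (i , a) (k , b) × E w
      unhide refl i≢j (_ , fs) = i≢j , copy (proj₁ threads i≢j) , ex , λ k → lemma k (k ≟ i)
        where
        threads = ↾-∷∷⁻ Filled i a b w fs
        lemma : ∀ k → Dec (k ≡ i) → Filled k (w ↾ k)
        lemma k (yes refl) k≢j = F.back i (just b) (proj₁ threads k≢j)
        lemma k (no k≢i)   k≢j = proj₂ threads k k≢i k≢j

    respond : ∀ {h k w h′ w′} → Equiv (! B) (h ∷ w) (h′ ∷ w′) → β.N (h ∷ w) → β.N (h′ ∷ w′) → E w → E w′ →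
              Hid h → Copies h k →
              Hid h′ × ∃[ k′ ] Copies h′ k′ × Equiv (! B) (k ∷ h ∷ w) (k′ ∷ h′ ∷ w′)
    respond {w = w} {i′ , a′} {w′} e n n′ x x′ i≢j (copy {i} {a} {b} m) = i′≢j , reply
        (F.self i (just b) m′ (proj₂ x i i≢j) (subst (λ S → Strat.N S (w′ ↾ i′)) F-i′ (proj₂ x′ i′ i′≢j))
          (proj₂ (thread-≈ split)))
      where
      split : !-Equiv ((i , a) ∷ w) ((i′ , a′) ∷ w′)
      split = !-≈-split e
      open !-Equiv split
      fixed : map (π ∘′ proj₁) w₀ ≡ map proj₁ w₀
      fixed = fixes (proj₁ x) (proj₁ x′) (∷-injectiveʳ tags)
      πi≡i′ : π i ≡ i′
      πi≡i′ = proj₁ (thread-≈ split)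
      i′≢j : i′ ≢ j
      i′≢j eq = i≢j (π-injective (trans πi≡i′ (trans eq (sym (∷-injectiveˡ fixed)))))
      -- The thread `i` may be carried to another thread `i′`; the reply there is equivalent because
      -- both are filled by the same strategy.
      F-i′ : F i′ ≡ F i
      F-i′ = trans (cong F (sym πi≡i′)) (F-invariant π π-injective (∷-injectiveʳ fixed) i)
      m′ : F.N i (b ∷ a ∷ w ↾ i)
      m′ = F.hf-∃ i (just b) m (proj₂ x i i≢j) (!B.!-pos-∷ pos₁)
      reply : ∃[ o ] Reply (F.N i) (λ _ → ⊥) o (a′ ∷ w′ ↾ i′) ×
                Ext B (just b) (a ∷ w ↾ i) o (a′ ∷ w′ ↾ i′) →
              ∃[ k′ ] Copies (i′ , a′) k′ × Equiv (! B) ((i , b) ∷ (i , a) ∷ w) (k′ ∷ (i′ , a′) ∷ w′)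
      reply (just b′ , m″ , e″) = (i′ , b′) , c , ≈-∷∷ split
        (proj₁ (E-hid n x i≢j (copy m))) (proj₁ (E-hid n′ x′ i′≢j c)) e″
        where
        c : Copies (i′ , a′) (i′ , b′)
        c = copy (subst (λ S → Strat.N S (b′ ∷ a′ ∷ w′ ↾ i′)) (sym F-i′) m″)

    visible : ∀ {b w m w′} → Equiv (! B) ((j , b) ∷ w) (m ∷ w′) → E w → E w′ → ∃[ b′ ] m ≡ (j , b′)
    visible {b} {w} {i , b′} {w′} e x x′ = b′ , cong (_, b′) (sym (trans (sym (∷-injectiveˡ fixed)) (∷-injectiveˡ tags)))
      where
      open !-Equiv (!-≈-split e)
      fixed : map (π ∘′ proj₁) w₀ ≡ map proj₁ w₀
      fixed = fixes (proj₁ x) (proj₁ x′) (∷-injectiveʳ tags)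

    vis-≈ : ∀ {w w′} → E w → E w′ → Equiv (! B) w w′ → Equiv B (w ↾ j) (w′ ↾ j)
    vis-≈ {w} {w′} x x′ e = subst (λ k → Equiv B (w ↾ j) (w′ ↾ k)) (fixes-j x x′ (!-≈-split e))
      (!-Equiv.threads (!-≈-split e) j)

    extend : ∀ {a w a′ w′} → E w → E w′ → Equiv (! B) w w′ → Equiv B (a ∷ w ↾ j) (a′ ∷ w′ ↾ j) →
             Position (! B) ((j , a) ∷ w) → Position (! B) ((j , a′) ∷ w′) →
             Equiv (! B) ((j , a) ∷ w) ((j , a′) ∷ w′)
    extend x x′ e eb p p′ = ≈-∷ (!-≈-split e) (fixes-j x x′ (!-≈-split e)) p p′ eb

    start-vis : w₀ ↾ j ≡ b₀ ∷ []
    start-vis = trans (↾-hit j b₀ v₀) (cong (b₀ ∷_) fresh)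

    enter : ∀ {a w} → β.N w → (w ≡ w₀ ⊎ ∃[ b ] ∃[ w′ ] w ≡ (j , b) ∷ w′) → Position B (a ∷ w ↾ j) →
            Position (! B) ((j , a) ∷ w)
    enter n (inj₁ refl) p = !B.ext-! (β.N-pos n) (β.odd n) (subst (λ z → Position B (_ ∷ z)) (↾-hit j b₀ v₀) p)
    enter n (inj₂ (b , w′ , refl)) p =
      !B.ext-! (β.N-pos n) (β.odd n) (subst (λ z → Position B (_ ∷ z)) (↾-hit j b w′) p)

    view : ∀ m → (∃[ a ] m ≡ (j , a)) ⊎ Hid m
    view (i , a) with i ≟ j
    ... | yes refl = inj₁ (a , refl)
    ... | no i≢j   = inj₂ i≢j

    short : ∀ {b a t} → w₀ ↾ j ≢ b ∷ a ∷ t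
    short eq with () ← trans (sym start-vis) eq

    last-odd : ∀ {i m w} → β.N ((i , m) ∷ w) → turn (((i , m) ∷ w) ↾ i) ≡ player
    last-odd n = turn-head LB (β.N-pos n) (β.odd n)

  environment : Environment (! B) B β.N β.D
  environment = record
    { R-laws  = !B.!-laws
    ; V-laws  = LB
    ; V-init  = ≈-init B-game
    ; agent   = β.agent
    ; vis     = _↾ j
    ; inV     = j ,_
    ; Hid     = Hid
    ; view    = view
    ; disjoint = λ j≢j → j≢j refl
    ; inV-injective = λ { refl → refl }
    ; vis-inV = ↾-hit j
    ; vis-Hid = λ {h} w i≢j → ↾-miss (proj₂ h) w i≢j
    ; vis-pos = λ p → proj₂ (!-split p) j
    ; vis-pend = λ {w} p → pend-restricts-[] _ _ _ _ (proj₁ (!-split p)) (!B.restricts-↾ j w)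
    ; e       = Copies
    ; e-functional = λ { (copy {i} {b = b} m) (copy {b = c} m′) →
                         cong (i ,_) (just-injective (F.hf i (just b) (just c) m m′)) }
    ; E       = E
    ; w₀      = w₀
    ; N-w₀    = started
    ; E-w₀    = ([] , refl) , ↾-∷ Filled j b₀ v₀ (λ k _ k≢j → played k k≢j) (λ j≢j → ⊥-elim (j≢j refl))
    ; short   = short
    ; vis-≈   = vis-≈
    ; enter   = enter
    ; E-vis   = E-vis
    ; E-unvis = E-unvis
    ; E-hid   = E-hid
    ; E-unhid = E-unhid
    ; E-start = λ p i≢j → i≢j (!B.next-! p (β.odd started))
    ; E-last  = λ { {i , m} {w} n (_ , fs) i≢j →
                    player≢opponent (trans (sym (last-odd n)) (F.even i (fs i i≢j))) }
    ; extend  = extend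
    ; respond = respond
    ; visible = visible
    }

  private module Γ = Hide environment

  private
    run-length : ∀ {w b} → Γ.Run w → w ↾ j ≡ b ∷ [] → b ≡ b₀
    run-length Γ.start eq = ∷-injectiveˡ (trans (sym eq) start-vis)
    run-length {b = b} (Γ.next {a} {c} {w} {u} r p ch) eq =
      ⊥-elim (one≢two (Γ.next-vis r p ch) eq)
      where
      one≢two : ∀ {l t} → l ≡ c ∷ a ∷ t → l ≡ b ∷ [] → ⊥
      one≢two refl ()

    -- `w₀` is the only run showing a single move, so the test can open with nothing but `b₀`.
    start-functional : ∀ o o′ → Reply Γ.N′ Γ.D′ o [] → Reply Γ.N′ Γ.D′ o′ [] → o ≡ o′
    start-functional (just b) (just c) (_ , r , eq) (_ , r′ , eq′) =
      cong just (trans (run-length r eq) (sym (run-length r′ eq′)))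
    start-functional nothing _ (_ , _ , _ , () , _) _
    start-functional (just _) nothing _ (_ , _ , _ , () , _)

    odd : ∀ {t} → Γ.N′ t → turn t ≡ player
    odd (w , r , refl) with Γ.ends r
    ... | inj₁ refl = last-odd started
    ... | inj₂ (b , w′ , refl) = last-odd (Γ.run-N r)

    D-even : ∀ {t} → Γ.D′ t → turn t ≡ opponent
    D-even d with u , du , _ , eq ← Γ.D′-elim d =
      trans (cong turn (sym eq)) (proj₁ (!B.turn-threads (proj₁ (β.D-pos du))) (β.D-even du) j)

  test : Test B
  test = record
    { N      = Γ.N′
    ; D      = Γ.D′
    ; agent  = Γ.visible-agent
    ; hf-[]  = start-functional
    ; odd    = odd
    ; D-even = D-even
    }

  private
    from : ∀ s {w} → w ≡ s ++ w₀ → β.N w → Γ.From w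
    from [] refl n = Γ.base
    from (_ ∷ []) refl n = ⊥-elim (player≢opponent (trans (sym (β.odd n)) (cong opposite (β.odd started))))
    from (b ∷ a ∷ s) refl n = Γ.step (from s refl (β.back (just b) n)) n

  D-intro : ∀ s → β.D (s ++ w₀) → (∀ i → Filled i ((s ++ w₀) ↾ i)) → Test.D test ((s ++ w₀) ↾ j)
  -- The test cannot stop right at `w₀`, where it has just made a move: the parities disagree.
  D-intro [] d fs = ⊥-elim (player≢opponent (trans (sym (β.odd started)) (β.D-even d)))
  D-intro (m ∷ s) d fs = Γ.D′-intro (from s refl (β.back nothing d)) d ((m ∷ s , refl) , fs)

  D-elim : ∀ {t} → Test.D test t → ∃[ s ] β.D (s ++ w₀) × (∀ i → Filled i ((s ++ w₀) ↾ i)) × (s ++ w₀) ↾ j ≡ t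
  D-elim d with Γ.D′-elim d
  ... | _ , du , ((s , refl) , fs) , eq = s , du , fs , eq

-- Tests on A ⇒ B

module _ {G : RawGame} (LG : Laws G) (S : Strat G) (T T′ : Test G) where

  private
    module S = Strat S
    module T = Test T
    module T′ = Test T′

  -- Replays a convergent play of `S` against `T` with `T′` in place of `T`: `sim` transfers the
  -- moves of the test, and self-equivalence of `S` those of `S`. The two plays agree only up to
  -- equivalence.
  conv-sim : (∀ o → Reply T.N T.D o [] → Reply T′.N T′.D o []) → Sim G T.N T.D T′.N T′.D →
             Conv {G} S.N T.D → Conv {G} S.N T′.D
  conv-sim first sim (z , n , d) with follow z nothing n d
    where
    follow : ∀ z o → S.N z → Reply T.N T.D o z →
             ∃[ z′ ] ∃[ o′ ] S.N z′ × Reply T′.N T′.D o′ z′ × Ext G o z o′ z′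
    follow [] nothing  n d = [] , nothing , n , first nothing d , tt
    follow [] (just b) n m = [] , just b , n , first (just b) m , Laws.≈-refl LG (T.N-pos m)
    follow (_ ∷ []) o n m with () ← S.even n
    follow (a ∷ b ∷ z) o n m with follow z (just b) (S.back (just a) n) (T.back o m)
    ... | z′ , just b′ , n′ , m′ , e with S.self (just a) n (S.back (just a) n) n′ e
    ...   | just a′ , n″ , e′ with o′ , m″ , e″ ← sim o m (T.back o m) m′ e′ = _ , o′ , n″ , m″ , e″
  ... | z′ , nothing , n′ , d′ , _ = z′ , n′ , d′

-- Each move changes the height of the stack by one. Consequently a sequence with nothing pending
-- has even length.
turn-pend : ∀ {M I : Set} {label : M → PO × QA} {tag : M → I} {r} → OK label tag r → turn (pend label r) ≡ turn r
turn-pend [] = refl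
turn-pend {label = label} {r = m ∷ r} (cons _ (asks q) ok)
  rewrite updatePending-question label (pend label r) {m} q = cong opposite (turn-pend ok)
turn-pend {label = label} {r = m ∷ r} (cons _ (answers a peq _) ok)
  rewrite updatePending-answer label (pend label r) {m} a | sym (turn-pend ok) | peq =
  sym (opposite-involutive _)

module _ {A B : RawGame} (LA : Laws A) (LB : Laws B) where

  private
    module !A = Bang LA
    module L = Lolli !A.!-laws LB
    MG = Move (A ⇒ B)

    left-pos : ∀ {w} → Position (A ⇒ B) w → Position (! A) (left w)
    left-pos p = proj₁ (proj₂ (⊸-split p))

  next-thread : ∀ {m i a z} → Position (A ⇒ B) (m ∷ inj₁ (i , a) ∷ z) → turn (inj₁ (i , a) ∷ z) ≡ opponent →
                ∃[ b ] m ≡ inj₁ (i , b)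
  next-thread {i = i} {a} {z} p eq = lemma (L.next-left p eq) p
    where
    lemma : ∀ {m} → ∃[ g ] m ≡ inj₁ g → Position (A ⇒ B) (m ∷ inj₁ (i , a) ∷ z) → ∃[ b ] m ≡ inj₁ (i , b)
    lemma ((k , b) , refl) p =
      b , cong (λ k → inj₁ (k , b)) (!A.next-! (left-pos p) (L.turn-left (L.init-⊸ p) eq))

  ext-thread : ∀ {i a b z} → Position (A ⇒ B) (inj₁ (i , a) ∷ z) → turn (inj₁ (i , a) ∷ z) ≡ opponent →
               Position A (b ∷ a ∷ left z ↾ i) → Position (A ⇒ B) (inj₁ (i , b) ∷ inj₁ (i , a) ∷ z)
  ext-thread p eq pb = L.ext-left p eq (!A.ext-! (left-pos p) (L.turn-left p eq) pb)

  -- A test (N , D) on A ⇒ B that splits into predicates P i for the threads of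
  -- ! A and a test (NB , DB) on B.
  record Split (N D : List MG → Set) (P : ℕ → List (Move A) → Set) (NB DB : List (Move B) → Set) : Set where
    field
      N-pos   : ∀ {z} → N z → Position (A ⇒ B) z
      threads : ∀ {z} → N z → ∀ i → P i (left z ↾ i)
      rights  : ∀ {z} → N z → NB (right z)
      view₁   : ∀ o {i a z} → Reply N D o (inj₁ (i , a) ∷ z) → N z →
                ∃[ b ] o ≡ just (inj₁ (i , b)) × P i (b ∷ a ∷ left z ↾ i)
      view₂   : ∀ o {a z} → Reply N D o (inj₂ a ∷ z) → N z →
                ∃[ o′ ] o ≡ mapₘ inj₂ o′ × Reply NB DB o′ (a ∷ right z)
      reply₁  : ∀ {i a b z} → N z → Position (A ⇒ B) (inj₁ (i , a) ∷ z) → P i (b ∷ a ∷ left z ↾ i) →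
                N (inj₁ (i , b) ∷ inj₁ (i , a) ∷ z)
      reply₂  : ∀ o {a z} → N z → Position (A ⇒ B) (inj₂ a ∷ z) → Reply NB DB o (a ∷ right z) →
                Reply N D (mapₘ inj₂ o) (inj₂ a ∷ z)

  -- An equivalence may carry the thread `i` to any thread `k`, so the predicates for threads must
  -- simulate one another across all pairs of indices.
  split-sim : ∀ {N D P NB DB N′ D′ P′ NB′ DB′} → Split N D P NB DB → Split N′ D′ P′ NB′ DB′ →
              (∀ i k → Sim A (P i) (λ _ → ⊥) (P′ k) (λ _ → ⊥)) → Sim B NB DB NB′ DB′ →
              Sim (A ⇒ B) N D N′ D′
  split-sim {N} {D} {P} {NB} {DB} {N′} {D′} {P′} {NB′} {DB′} T T′ sim₁ sim₂ = sim
    where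
    module T = Split T
    module T′ = Split T′
    open ⊸-Equiv
    sim : Sim (A ⇒ B) N D N′ D′
    sim o {inj₁ (i , a)} {z} {inj₁ (i′ , a′)} {z′} n m m′ e with T.view₁ o n m
    ... | b , refl , pb with sim₁ i i′ (just b) pb (T.threads m i) (T′.threads m′ i′) (⇒-thread-≈ e)
    ...   | just b′ , pb′ , e′ = just (inj₁ (i′ , b′)) , n′ , ⇒-≈-left e (T.N-pos n) (T′.N-pos n′) e′
      where n′ = T′.reply₁ m′ (pos₂ (⊸-≈-split e)) pb′
    sim o {inj₂ a} {z} {inj₂ a′} {z′} n m m′ e with T.view₂ o n m
    ... | o₁ , refl , r with sim₂ o₁ r (T.rights m) (T′.rights m′) (rights (⊸-≈-split e))
    ...   | o₁′ , r′ , x = mapₘ inj₂ o₁′ , n′ , ext o₁ o₁′ n n′ x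
      where
      n′ = T′.reply₂ o₁′ m′ (pos₂ (⊸-≈-split e)) r′
      ext : ∀ o₁ o₁′ → Reply N D (mapₘ inj₂ o₁) (inj₂ a ∷ z) → Reply N′ D′ (mapₘ inj₂ o₁′) (inj₂ a′ ∷ z′) →
            Ext B o₁ (a ∷ right z) o₁′ (a′ ∷ right z′) →
            Ext (A ⇒ B) (mapₘ inj₂ o₁) (inj₂ a ∷ z) (mapₘ inj₂ o₁′) (inj₂ a′ ∷ z′)
      ext (just b) (just b′) n n′ x = ⇒-≈-right e (T.N-pos n) (T′.N-pos n′) x
      ext nothing  nothing   _ _  _ = tt
    sim o {inj₁ _} {_} {inj₂ _} n m m′ e = ⊥-elim (false≢true (∷-injectiveˡ (tags (⊸-≈-split e))))
      where false≢true : false ≢ true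
            false≢true ()
    sim o {inj₂ _} {_} {inj₁ _} n m m′ e = ⊥-elim (true≢false (∷-injectiveˡ (tags (⊸-≈-split e))))
      where true≢false : true ≢ false
            true≢false ()

  module Combine (γ : Test B) (X : Strat A) where

    private
      module γ = Test γ
      module X = Strat X

    N D : List MG → Set
    N z = Position (A ⇒ B) z × turn z ≡ player × γ.N (right z) × Threads X.N (left z)
    D z = Position (A ⇒ B) z × turn z ≡ opponent × γ.D (right z) × Threads X.N (left z)

    private

      even-left : ∀ {z} → Position (A ⇒ B) z → Threads X.N (left z) → turn (left z) ≡ opponent
      even-left p x = even-threads LA (left-pos p) (λ i → X.even (x i))

      -- All threads of `! A` are even, so the last move is in `B`. By `top-tag` a topmost pending
      -- question would then also lie in `B`, where `γ` leaves none.
      D-pos : ∀ {z} → D z → Position (A ⇒ B) z × pend (label (A ⇒ B)) z ≡ []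
      D-pos {[]} (p , _) = p , refl
      D-pos {inj₁ g ∷ z} (p , eq , _ , x) =
        ⊥-elim (player≢opponent (trans (sym (L.turn-left p eq)) (even-left p x)))
      D-pos {inj₂ b ∷ z} (p , eq , d , _) = p , none-pending
        (pend-restricts _ _ _ _ (proj₁ (⊸-split p)) (L.restricts-right (inj₂ b ∷ z)))
        (top-tag opponent (proj₁ (⊸-split p)) (L.follows-⊸ p) eq)
        (proj₂ (γ.D-pos d))
        where
        none-pending : ∀ {s t} → Restricts (label (A ⇒ B)) component (label B) true s t →
                (∀ {q qs} → s ≡ q ∷ qs → component q ≡ true) → t ≡ [] → s ≡ []
        none-pending []          _ _ = refl
        none-pending (hit _ _ _) _ ()
        none-pending (miss ne _) f _ = ⊥-elim (ne (f refl))

    split : Split N D (λ _ → X.N) γ.N γ.D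
    split = record
      { N-pos   = proj₁
      ; threads = λ (_ , _ , _ , x) → x
      ; rights  = λ (_ , _ , n , _) → n
      ; view₁   = view₁
      ; view₂   = view₂
      ; reply₁  = λ {i} {a} {b} {z} (_ , eq , n , x) p m →
          ext-thread p (cong opposite eq) (X.N-pos m) , cong (λ t → opposite (opposite t)) eq , n ,
          ↾-∷∷ (λ _ → X.N) i a b (left z) (λ k _ → x k) m
      ; reply₂  = λ { (just b) (_ , eq , _ , x) p m →
                      L.ext-right p (cong opposite eq) (γ.N-pos m) , cong (λ t → opposite (opposite t)) eq , m , x
                    ; nothing (_ , eq , _ , x) p d → p , cong opposite eq , d , x }
      }
      where
      view₁ : ∀ o {i a z} → Reply N D o (inj₁ (i , a) ∷ z) → N z →
              ∃[ b ] o ≡ just (inj₁ (i , b)) × X.N (b ∷ a ∷ left z ↾ i)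
      view₁ nothing (p , eq , _ , x) _ =
        ⊥-elim (player≢opponent (trans (sym (L.turn-left p eq)) (even-left p x)))
      view₁ (just m) {i} {a} {z} n@(p , _) (_ , eq , _) = lemma (next-thread p (cong opposite eq)) n
        where
        lemma : ∀ {m} → ∃[ b ] m ≡ inj₁ (i , b) → N (m ∷ inj₁ (i , a) ∷ z) →
                ∃[ b ] just m ≡ just (inj₁ (i , b)) × X.N (b ∷ a ∷ left z ↾ i)
        lemma (b , refl) (_ , _ , _ , x) = b , refl , proj₁ (↾-∷∷⁻ (λ _ → X.N) i a b (left z) x)
      view₂ : ∀ o {a z} → Reply N D o (inj₂ a ∷ z) → N z →
              ∃[ o′ ] o ≡ mapₘ inj₂ o′ × Reply γ.N γ.D o′ (a ∷ right z)
      view₂ nothing (_ , _ , d , _) _ = nothing , refl , d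
      view₂ (just m) {a} {z} n@(p , _) (_ , eq , _) = lemma (L.next-right p (cong opposite eq)) n
        where
        lemma : ∀ {m} → ∃[ b ] m ≡ inj₂ b → N (m ∷ inj₂ a ∷ z) →
                ∃[ o′ ] just m ≡ mapₘ inj₂ o′ × Reply γ.N γ.D o′ (a ∷ right z)
        lemma (b , refl) (_ , _ , n , _) = just b , refl , n

    private
      module Sp = Split split

      back : ∀ o {a z} → Reply N D o (a ∷ z) → N z
      back nothing {inj₁ g} (p , eq , _ , x) =
        ⊥-elim (player≢opponent (trans (sym (L.turn-left p eq)) (even-left p x)))
      back nothing {inj₂ a} {z} (p , eq , d , x) = L.init-⊸ p , opposite-adjoint eq , γ.back nothing d , x
      back (just m) {inj₁ (i , a)} {z} n@(p , eq , _) = lemma (next-thread p (cong opposite eq′)) n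
        where
        eq′ : turn z ≡ player
        eq′ = trans (sym (opposite-involutive (turn z))) eq
        lemma : ∀ {m} → ∃[ b ] m ≡ inj₁ (i , b) → N (m ∷ inj₁ (i , a) ∷ z) → N z
        lemma (b , refl) (p , _ , n , x) = L.init-⊸ (L.init-⊸ p) , eq′ , n , λ k → thread k (k ≟ i)
          where
          thread : ∀ k → Dec (k ≡ i) → X.N (left z ↾ k)
          thread k (yes refl) = X.back (just b) (proj₁ (↾-∷∷⁻ (λ _ → X.N) i a b (left z) x))
          thread k (no k≢i)   = proj₂ (↾-∷∷⁻ (λ _ → X.N) i a b (left z) x) k k≢i
      back (just m) {inj₂ a} {z} n@(p , eq , _) = lemma (L.next-right p (cong opposite eq′)) n
        where
        eq′ : turn z ≡ player
        eq′ = trans (sym (opposite-involutive (turn z))) eq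
        lemma : ∀ {m} → ∃[ b ] m ≡ inj₂ b → N (m ∷ inj₂ a ∷ z) → N z
        lemma (b , refl) (p , _ , n , x) = L.init-⊸ (L.init-⊸ p) , eq′ , γ.back (just b) n , x

      hf : ∀ o o′ {a z z′} → Reply N D o (a ∷ z) → Reply N D o′ (a ∷ z′) → o ≡ o′
      hf o o′ {inj₁ (i , a)} n n′ with Sp.view₁ o n (back o n) | Sp.view₁ o′ n′ (back o′ n′)
      ... | b , refl , m | c , refl , m′ = cong (λ b → just (inj₁ (i , b)))
            (just-injective (X.hf (just b) (just c) m m′))
      hf o o′ {inj₂ a} n n′ with Sp.view₂ o n (back o n) | Sp.view₂ o′ n′ (back o′ n′)
      ... | o₁ , refl , m | o₁′ , refl , m′ = cong (mapₘ inj₂) (γ.hf o₁ o₁′ m m′)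

      hf-∃ : ∀ o {a z z′} → Reply N D o (a ∷ z) → N z′ → Position (A ⇒ B) (a ∷ z′) → Reply N D o (a ∷ z′)
      hf-∃ o {inj₁ (i , a)} n m p with Sp.view₁ o n (back o n)
      ... | b , refl , x = Sp.reply₁ m p
            (X.hf-∃ (just b) x (Sp.threads m i) (!A.!-pos-∷ (left-pos p)))
      hf-∃ o {inj₂ a} n m p with Sp.view₂ o n (back o n)
      ... | o₁ , refl , x = Sp.reply₂ o₁ m p (γ.hf-∃ o₁ x (Sp.rights m) (proj₂ (proj₂ (⊸-split p))))

      hf-[] : ∀ o o′ → Reply N D o [] → Reply N D o′ [] → o ≡ o′
      hf-[] nothing nothing _ _ = refl
      hf-[] (just m) (just m′) n@(p , _) n′@(p′ , _) = lemma (L.first-right p) (L.first-right p′) n n′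
        where
        lemma : ∀ {m m′} → ∃[ b ] m ≡ inj₂ b → ∃[ b ] m′ ≡ inj₂ b → N (m ∷ []) → N (m′ ∷ []) → just m ≡ just m′
        lemma (b , refl) (c , refl) (_ , _ , n , _) (_ , _ , n′ , _) =
          cong (mapₘ inj₂) (γ.hf-[] (just b) (just c) n n′)
      hf-[] nothing (just m) n@(_ , _ , d , _) n′@(p , _) = lemma (L.first-right p) n′
        where
        lemma : ∀ {m} → ∃[ b ] m ≡ inj₂ b → N (m ∷ []) → nothing ≡ just m
        lemma (b , refl) (_ , _ , n , _) = cong (mapₘ inj₂) (γ.hf-[] nothing (just b) d n)
      hf-[] (just m) nothing n n′ = sym (hf-[] nothing (just m) n′ n)

    combine : Test (A ⇒ B)
    combine = record
      { N      = N
      ; D      = D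
      ; agent  = record
        { N-pos = proj₁
        ; D-pos = D-pos
        ; back  = back
        ; hf    = hf
        ; hf-∃  = hf-∃
        ; self  = split-sim split split (λ _ _ → X.self) γ.self
        }
      ; hf-[]  = hf-[]
      ; odd    = λ (_ , eq , _) → eq
      ; D-even = λ (_ , eq , _) → eq
      }

  module _ (S : Strat (A ⇒ B)) (γ : Test B) (X : Strat A) where

    private
      module S = Strat S
      module C = Combine γ X

    -- Both sides describe one play `z` of `S`, with its moves in `! A` either assigned to the test
    -- or hidden.
    conv-combine : Conv {A ⇒ B} S.N C.D → Conv {B} (Hidden S.N (Strat.N X)) (Test.D γ)
    conv-combine (z , n , _ , _ , d , x) = right z , (z , n , refl , x) , d

    conv-combine⁻ : Conv {B} (Hidden S.N (Strat.N X)) (Test.D γ) → Conv {A ⇒ B} S.N C.D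
    conv-combine⁻ (_ , (z , n , refl , x) , d) = z , n , S.N-pos n , S.even n , d , x

-- Transpositions of indices and plays in a single thread

module _ (i k : ℕ) where

  private
    choose : ∀ n → Dec (n ≡ i) → Dec (n ≡ k) → ℕ
    choose n (yes _) _       = k
    choose n (no _)  (yes _) = i
    choose n (no _)  (no _)  = n

  swap : ℕ → ℕ
  swap n = choose n (n ≟ i) (n ≟ k)

  swap-i : swap i ≡ k
  swap-i = lemma (i ≟ i) (i ≟ k)
    where lemma : ∀ d e → choose i d e ≡ k
          lemma (yes _)  _ = refl
          lemma (no i≢i) _ = ⊥-elim (i≢i refl)

  private
    swap-k : swap k ≡ i
    swap-k = lemma (k ≟ i) (k ≟ k)
      where lemma : ∀ d e → choose k d e ≡ i
            lemma (yes k≡i) _       = k≡i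
            lemma (no _)  (yes _)   = refl
            lemma (no _)  (no k≢k)  = ⊥-elim (k≢k refl)

    swap-other : ∀ {n} → n ≢ i → n ≢ k → swap n ≡ n
    swap-other {n} n≢i n≢k = lemma (n ≟ i) (n ≟ k)
      where lemma : ∀ d e → choose n d e ≡ n
            lemma (yes n≡i) _       = ⊥-elim (n≢i n≡i)
            lemma (no _) (yes n≡k)  = ⊥-elim (n≢k n≡k)
            lemma (no _) (no _)     = refl

    swap-swap : ∀ n → swap (swap n) ≡ n
    swap-swap n = lemma (n ≟ i) (n ≟ k)
      where lemma : Dec (n ≡ i) → Dec (n ≡ k) → swap (swap n) ≡ n
            lemma (yes refl) _          = trans (cong swap swap-i) swap-k
            lemma (no _)     (yes refl) = trans (cong swap swap-k) swap-i
            lemma (no n≢i)   (no n≢k)   = trans (cong swap (swap-other n≢i n≢k)) (swap-other n≢i n≢k)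

  transposition : ℕ ↔ ℕ
  transposition = mk↔ₛ′ swap swap swap-swap swap-swap

module _ {M : Set} (i : ℕ) where

  single : List M → List (ℕ × M)
  single = map (i ,_)

  single-↾ : ∀ s → single s ↾ i ≡ s
  single-↾ []      = refl
  single-↾ (m ∷ s) = trans (↾-hit i m (single s)) (cong (m ∷_) (single-↾ s))

  single-↾-≢ : ∀ {k} s → i ≢ k → single s ↾ k ≡ []
  single-↾-≢ []      _   = refl
  single-↾-≢ (m ∷ s) i≢k = trans (↾-miss m (single s) i≢k) (single-↾-≢ s i≢k)

  single-threads : (P : List M → Set) → P [] → ∀ {s} → P s → Threads P (single s)
  single-threads P nil {s} p k = lemma (i ≟ k)
    where lemma : Dec (i ≡ k) → P (single s ↾ k)
          lemma (yes refl) = subst P (sym (single-↾ s)) p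
          lemma (no i≢k)   = subst P (sym (single-↾-≢ s i≢k)) nil

module _ {C : RawGame} (LC : Laws C) where

  private module LC = Laws LC

  single-pos : ∀ i {s} → Position C s → Position (! C) (single i s)
  single-pos i p = !-join (OK-map⁺ (i ,_) (OK-retag (λ _ → i) (LC.ok p)))
    (single-threads i (Position C) LC.nil p)

  single-pos⁻ : ∀ i {s} → Position (! C) (single i s) → Position C s
  single-pos⁻ i {s} p = subst (Position C) (single-↾ i s) (proj₂ (!-split p) i)

  -- The transposition of `i` and `k` is the required permutation; all other threads are empty on
  -- both sides.
  single-≈ : ∀ i k {s s′} → Equiv C s s′ → Equiv (! C) (single i s) (single k s′)
  single-≈ i k {s} {s′} e = !-≈-join (equivs (single-pos i (LC.≈-pos₁ e)) (single-pos k (LC.≈-pos₂ e))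
    (transposition i k) (λ n → threads n (i ≟ n)) (tags s s′ (LC.≈-length e)))
    where
    threads : ∀ n → Dec (i ≡ n) → Equiv C (single i s ↾ n) (single k s′ ↾ swap i k n)
    threads n (yes refl) = subst₂ (Equiv C) (sym (single-↾ i s))
      (sym (trans (cong (single k s′ ↾_) (swap-i i k)) (single-↾ k s′))) e
    threads n (no i≢n) = subst₂ (Equiv C) (sym (single-↾-≢ i s i≢n))
      (sym (single-↾-≢ k s′ (λ k≡ → i≢n (!-Equiv.π-injective transposed (trans (swap-i i k) k≡)))))
      (LC.≈-refl LC.nil)
      where
      transposed : !-Equiv {C} [] []
      transposed = equivs (Bang.!-laws LC .Laws.nil) (Bang.!-laws LC .Laws.nil) (transposition i k)
        (λ _ → LC.≈-refl LC.nil) refl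
    tags : ∀ s s′ → length s ≡ length s′ →
           map (swap i k ∘′ proj₁) (single i s) ≡ map proj₁ (single k s′)
    tags []      []       _  = refl
    tags (_ ∷ s) (_ ∷ s′) eq = cong₂ _∷_ (swap-i i k) (tags s s′ (suc-injective eq))

-- Dereliction of a test

module _ {B : RawGame} (LB : Laws B) (γ : Test B) where

  private
    module γ = Test γ
    module !B = Bang LB

    Single : (List (Move B) → Set) → List (Move (! B)) → Set
    Single P v = ∃[ t ] v ≡ single 0 t × P t

    N D : List (Move (! B)) → Set
    N = Single γ.N
    D = Single γ.D

    replies : ∀ o {v} → Reply N D o v → ∃[ o′ ] ∃[ t ] o ≡ mapₘ (0 ,_) o′ × v ≡ single 0 t × Reply γ.N γ.D o′ t
    replies (just b) (b′ ∷ t , refl , n) = just b′ , t , refl , refl , n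
    replies nothing  (t , eq , d) = nothing , t , refl , eq , d

    reply : ∀ o′ {t} → Reply γ.N γ.D o′ t → Reply N D (mapₘ (0 ,_) o′) (single 0 t)
    reply (just b) n = _ , refl , n
    reply nothing  d = _ , refl , d

    replies-∷ : ∀ o {a v} → Reply N D o (a ∷ v) → ∃[ o′ ] ∃[ b ] ∃[ t ]
                o ≡ mapₘ (0 ,_) o′ × a ≡ (0 , b) × v ≡ single 0 t × Reply γ.N γ.D o′ (b ∷ t)
    replies-∷ o n with replies o n
    ... | o′ , b ∷ t , eq , refl , m = o′ , b , t , eq , refl , refl , m

    -- The test moves before its partner does, and in `! B` the reply stays in the thread of the
    -- move. A test run in thread 0 therefore never meets another thread.
    index : ∀ {i a v} → N v → Position (! B) ((i , a) ∷ v) → i ≡ 0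
    index ([]    , refl , n) p = ⊥-elim (player≢opponent (sym (γ.odd n)))
    index (b ∷ t , refl , n) p =
      !B.next-! p (trans (turn-map {label = label (! B)} {proj₁} (0 ,_) (b ∷ t)) (γ.odd n))

    self : Sim (! B) N D N D
    self o n m (t′ , refl , m′) e with replies-∷ o n
    self o {a′ = i′ , a′} n m (t′ , refl , m′) e | o₁ , a , t , refl , refl , refl , r
      with refl ← index (t′ , refl , m′) (!-Equiv.pos₂ (!-≈-split e))
      with e₁ ← subst₂ (λ s s′ → Equiv B (a ∷ s) (a′ ∷ s′)) (single-↾ 0 t) (single-↾ 0 t′) (proj₂ (thread-≈ (!-≈-split e)))
      with o₁′ , r′ , x ← γ.self o₁ r (γ.back o₁ r) m′ e₁
      = mapₘ (0 ,_) o₁′ , reply o₁′ r′ , ext o₁ o₁′ x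
      where
      ext : ∀ o o′ → Ext B o (a ∷ t) o′ (a′ ∷ t′) →
            Ext (! B) (mapₘ (0 ,_) o) (single 0 (a ∷ t)) (mapₘ (0 ,_) o′) (single 0 (a′ ∷ t′))
      ext (just _) (just _) x = single-≈ LB 0 0 x
      ext nothing  nothing  _ = tt

  dereliction : Test (! B)
  dereliction = record
    { N      = N
    ; D      = D
    ; agent  = record
      { N-pos = λ { (t , refl , n) → single-pos LB 0 (γ.N-pos n) }
      ; D-pos = λ { (t , refl , d) → single-pos LB 0 (proj₁ (γ.D-pos d)) ,
                    trans (pend-map {label = label (! B)} {proj₁} (0 ,_) t) (cong (single 0) (proj₂ (γ.D-pos d))) }
      ; back  = back
      ; hf    = hf
      ; hf-∃  = hf-∃
      ; self  = self
      }
    ; hf-[]  = hf-[]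
    ; odd    = λ { (t , refl , n) → trans (turn-map {label = label (! B)} {proj₁} (0 ,_) t) (γ.odd n) }
    ; D-even = λ { (t , refl , d) → trans (turn-map {label = label (! B)} {proj₁} (0 ,_) t) (γ.D-even d) }
    }
    where
    back : ∀ o {a v} → Reply N D o (a ∷ v) → N v
    back o n with replies-∷ o n
    ... | o′ , b , t , refl , refl , refl , m = t , refl , γ.back o′ m
    hf : ∀ o o′ {a v v′} → Reply N D o (a ∷ v) → Reply N D o′ (a ∷ v′) → o ≡ o′
    hf o o′ n n′ with replies-∷ o n | replies-∷ o′ n′
    ... | o₁ , b , _ , refl , refl , _ , m | o₁′ , _ , _ , refl , refl , _ , m′ = cong (mapₘ _) (γ.hf o₁ o₁′ m m′)
    hf-∃ : ∀ o {a v v′} → Reply N D o (a ∷ v) → N v′ → Position (! B) (a ∷ v′) → Reply N D o (a ∷ v′)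
    hf-∃ o n (t′ , refl , m′) p with replies-∷ o n
    ... | o₁ , b , t , refl , refl , refl , m = reply o₁ (γ.hf-∃ o₁ m m′ (single-pos⁻ LB 0 {b ∷ t′} p))
    hf-[] : ∀ o o′ → Reply N D o [] → Reply N D o′ [] → o ≡ o′
    hf-[] o o′ n n′ with replies o n | replies o′ n′
    ... | o₁ , [] , refl , _ , m | o₁′ , [] , refl , _ , m′ = cong (mapₘ _) (γ.hf-[] o₁ o₁′ m m′)

  module _ (Y : Strat B) where

    conv-dereliction : Conv {B} (Strat.N Y) γ.D → ∃[ v ] Threads (Strat.N Y) v × Test.D dereliction v
    conv-dereliction (t , n , d) = single 0 t , single-threads 0 (Strat.N Y) (Strat.nil Y) n , t , refl , d

    conv-dereliction⁻ : ∃[ v ] Threads (Strat.N Y) v × Test.D dereliction v → Conv {B} (Strat.N Y) γ.D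
    conv-dereliction⁻ (_ , ns , t , refl , d) = t , subst (Strat.N Y) (single-↾ 0 t) (ns 0) , d

-- A test on A ⇒ B that starts by playing b₁ is equivalent to one that plays
-- copies of a single strategy on A and a test on B: after ask · b₁ it plays
-- in each thread of ! A up to ≈ as in the thread 0.
module Decompose {A B : RawGame} (LA : Laws A) (LB : Laws B) (T : Test (A ⇒ B)) (b₁ : Move B)
                 (opening : Test.N T (inj₂ b₁ ∷ [])) where

  private
    module LA = Laws LA
    module LB = Laws LB
    module !A = Bang LA
    module L = Lolli !A.!-laws LB
    module T = Test T
    module O = Opening !A.!-laws LB b₁ (proj₂ (proj₂ (⊸-split (T.N-pos opening))))

    left-pos : ∀ {w} → Position (A ⇒ B) w → Position (! A) (left w)
    left-pos p = proj₁ (proj₂ (⊸-split p))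

    right-pos : ∀ {w} → Position (A ⇒ B) w → Position B (right w)
    right-pos p = proj₂ (proj₂ (⊸-split p))

    -- ask · b₁ followed by s in the thread i
    opened : ℕ → List (Move A) → List (Move (A ⇒ B))
    opened i s = O.emb (single i s)

    P : ℕ → List (Move A) → Set
    P i s = T.N (opened i s)

    opened-pos : ∀ i {s} → Position A s → Position (A ⇒ B) (opened i s)
    opened-pos i p = O.emb-pos (single-pos LA i p)

    opened-↾ : ∀ i s → left (opened i s) ↾ i ≡ s
    opened-↾ i s = trans (cong (_↾ i) (O.left-emb (single i s))) (single-↾ i s)

    P-next : ∀ i {m a s} → T.N (m ∷ opened i (a ∷ s)) → ∃[ b ] m ≡ inj₁ (i , b)
    P-next i n = next-thread LA LB (T.N-pos n) (opposite-adjoint (T.odd n))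

    P-sim : ∀ i k → Sim A (P i) (λ _ → ⊥) (P k) (λ _ → ⊥)
    P-sim i k (just b) {a} {s} {a′} {s′} n m m′ e = decode
        (T.self (just (inj₁ (i , b))) n m m′ (O.emb-≈ (single-≈ LA i k e)))
      where
      decode′ : ∀ {m″} → ∃[ b′ ] m″ ≡ inj₁ (k , b′) → T.N (m″ ∷ opened k (a′ ∷ s′)) →
                Equiv (A ⇒ B) (inj₁ (i , b) ∷ opened i (a ∷ s)) (m″ ∷ opened k (a′ ∷ s′)) →
                ∃[ o ] Reply (P k) (λ _ → ⊥) o (a′ ∷ s′) × Ext A (just b) (a ∷ s) o (a′ ∷ s′)
      decode′ (b′ , refl) n e = just b′ , n , subst₂ (λ z z′ → Equiv A (b ∷ z) (b′ ∷ z′))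
        (opened-↾ i (a ∷ s)) (opened-↾ k (a′ ∷ s′)) (⇒-thread-≈ e)
      decode : ∃[ o ] Reply T.N T.D o (opened k (a′ ∷ s′)) ×
                 Ext (A ⇒ B) (just (inj₁ (i , b))) (opened i (a ∷ s)) o (opened k (a′ ∷ s′)) →
               ∃[ o ] Reply (P k) (λ _ → ⊥) o (a′ ∷ s′) × Ext A (just b) (a ∷ s) o (a′ ∷ s′)
      decode (just m″ , n , e) = decode′ (P-next k n) n e

  strategy : Strat A
  strategy = record
    { N     = P 0
    ; agent = record
      { N-pos = λ n → single-pos⁻ LA 0 (O.emb-pos⁻ (T.N-pos n))
      ; D-pos = λ ()
      ; back  = λ { (just b) n → T.back (just (inj₁ (0 , b))) n }
      ; hf    = λ { (just b) (just c) n n′ →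
                    injective (T.hf (just (inj₁ (0 , b))) (just (inj₁ (0 , c))) n n′) }
      ; hf-∃  = λ { (just b) n n′ p → T.hf-∃ (just (inj₁ (0 , b))) n n′ (opened-pos 0 p) }
      ; self  = P-sim 0 0
      }
    ; nil   = opening
    ; even  = λ {s} n → trans (sym (turn-map {label = label (! A)} {proj₁} (0 ,_) s))
                (opposite-adjoint (trans (sym (O.turn-emb (single 0 s))) (T.odd n)))
    }
    where
    injective : ∀ {b c} → just (inj₁ {B = Move B} (0 , b)) ≡ just (inj₁ (0 , c)) → just b ≡ just c
    injective refl = refl

  private
    lift : List (Move B) → List (Move (A ⇒ B))
    lift = map inj₂

    NB DB : List (Move B) → Set
    NB t = T.N (lift t)
    DB t = T.D (lift t)

    to : ∀ o {t} → Reply NB DB o t → Reply T.N T.D (mapₘ inj₂ o) (lift t)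
    to (just _) n = n
    to nothing  n = n

    from : ∀ o {t} → Reply T.N T.D (mapₘ inj₂ o) (lift t) → Reply NB DB o t
    from (just _) n = n
    from nothing  n = n

    lift-pos : ∀ {t} → Position B t → Position (A ⇒ B) (lift t)
    lift-pos = inj₂-pos !A.!-laws LB

    lift-pos⁻ : ∀ {t} → Position (A ⇒ B) (lift t) → Position B t
    lift-pos⁻ = inj₂-pos⁻ !A.!-laws LB

    turn-lift : ∀ t → turn (lift t) ≡ turn t
    turn-lift = turn-map {label = label (A ⇒ B)} {component} inj₂

    mapₘ-injective : ∀ o o′ → mapₘ (inj₂ {A = Move (! A)} {B = Move B}) o ≡ mapₘ inj₂ o′ → o ≡ o′
    mapₘ-injective (just _) (just _) refl = refl
    mapₘ-injective nothing  nothing  refl = refl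

    self : Sim B NB DB NB DB
    self o {a} {t} {a′} {t′} n m m′ e = decode o
        (T.self (mapₘ inj₂ o) (to o n) m m′ (inj₂-≈ !A.!-laws LB e))
      where
      decode : ∀ o → ∃[ o′ ] Reply T.N T.D o′ (lift (a′ ∷ t′)) ×
                 Ext (A ⇒ B) (mapₘ inj₂ o) (lift (a ∷ t)) o′ (lift (a′ ∷ t′)) →
               ∃[ o′ ] Reply NB DB o′ (a′ ∷ t′) × Ext B o (a ∷ t) o′ (a′ ∷ t′)
      decode (just b) (just (inj₂ b′) , n , e) = just b′ , n , inj₂-≈⁻ !A.!-laws LB e
      decode (just b) (just (inj₁ _) , n , e) = ⊥-elim (true≢false (∷-injectiveˡ (⊸-Equiv.tags (⊸-≈-split e))))
        where true≢false : true ≢ false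
              true≢false ()
      decode nothing (nothing , d , _) = nothing , d , tt

  test : Test B
  test = record
    { N      = NB
    ; D      = DB
    ; agent  = record
      { N-pos = λ n → lift-pos⁻ (T.N-pos n)
      ; D-pos = λ {t} d → lift-pos⁻ (proj₁ (T.D-pos d)) , unmap (pend (label B) t)
                  (trans (sym (pend-map {label = label (A ⇒ B)} {component} inj₂ t)) (proj₂ (T.D-pos d)))
      ; back  = λ o n → T.back (mapₘ inj₂ o) (to o n)
      ; hf    = λ o o′ n n′ → mapₘ-injective o o′ (T.hf (mapₘ inj₂ o) (mapₘ inj₂ o′) (to o n) (to o′ n′))
      ; hf-∃  = λ o n n′ p → from o (T.hf-∃ (mapₘ inj₂ o) (to o n) n′ (lift-pos p))
      ; self  = self
      }
    ; hf-[]  = λ o o′ n n′ → mapₘ-injective o o′ (T.hf-[] (mapₘ inj₂ o) (mapₘ inj₂ o′) (to o n) (to o′ n′))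
    ; odd    = λ {t} n → trans (sym (turn-lift t)) (T.odd n)
    ; D-even = λ {t} d → trans (sym (turn-lift t)) (T.D-even d)
    }
    where
    unmap : ∀ t → lift t ≡ [] → t ≡ []
    unmap [] _ = refl

  private
    module C = Combine LA LB test strategy

    initial : ∀ {o} → Reply T.N T.D o [] → o ≡ just (inj₂ b₁)
    initial {o} n = T.hf-[] o (just (inj₂ b₁)) n opening

    mutual

      -- By history-freeness `T` replies in the thread `i` as if nothing else had been played since
      -- `b₁`. Thus the thread alone, placed after `b₁`, is again a play of `T`.
      threads : ∀ {z} → T.N z → ∀ i → P i (left z ↾ i)
      threads {[]} n i = ⊥-elim (player≢opponent (sym (T.odd n)))
      threads {m ∷ []} n i with refl ← initial {just m} n = opening
      threads {b ∷ inj₁ (k , a) ∷ z} n i = lemma (next-thread LA LB (T.N-pos n) (opposite-adjoint (T.odd n))) n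
        where
        lemma : ∀ {b} → ∃[ b′ ] b ≡ inj₁ (k , b′) → T.N (b ∷ inj₁ (k , a) ∷ z) → P i (left (b ∷ inj₁ (k , a) ∷ z) ↾ i)
        lemma (b′ , refl) n = ↾-∷∷ P k a b′ (left z) (λ j _ → threads (T.back (just (inj₁ (k , b′))) n) j)
          (view₁-P n (T.back (just (inj₁ (k , b′))) n)) i
      threads {b ∷ inj₂ a ∷ z} n i = lemma (L.next-right (T.N-pos n) (opposite-adjoint (T.odd n))) n
        where
        lemma : ∀ {b} → ∃[ b′ ] b ≡ inj₂ b′ → T.N (b ∷ inj₂ a ∷ z) → P i (left (b ∷ inj₂ a ∷ z) ↾ i)
        lemma (b′ , refl) n = threads (T.back (just (inj₂ b′)) n) i

      view₁-P : ∀ {i a b z} → T.N (inj₁ (i , b) ∷ inj₁ (i , a) ∷ z) → T.N z → P i (b ∷ a ∷ left z ↾ i)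
      view₁-P {i} {a} {b} n m = T.hf-∃ (just (inj₁ (i , b))) n (threads m i)
        (opened-pos i (!A.!-pos-∷ (left-pos (L.init-⊸ (T.N-pos n)))))

    rights : ∀ {z} → T.N z → NB (right z)
    rights {[]} n = n
    rights {m ∷ []} n with refl ← initial {just m} n = n
    rights {b ∷ inj₁ (k , a) ∷ z} n = lemma (next-thread LA LB (T.N-pos n) (opposite-adjoint (T.odd n))) n
      where
      lemma : ∀ {b} → ∃[ b′ ] b ≡ inj₁ (k , b′) → T.N (b ∷ inj₁ (k , a) ∷ z) → NB (right (b ∷ inj₁ (k , a) ∷ z))
      lemma (b′ , refl) n = rights (T.back (just (inj₁ (k , b′))) n)
    rights {b ∷ inj₂ a ∷ z} n = lemma (L.next-right (T.N-pos n) (opposite-adjoint (T.odd n))) n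
      where
      lemma : ∀ {b} → ∃[ b′ ] b ≡ inj₂ b′ → T.N (b ∷ inj₂ a ∷ z) → NB (right (b ∷ inj₂ a ∷ z))
      lemma (b′ , refl) n = T.hf-∃ (just (inj₂ b′)) n (rights (T.back (just (inj₂ b′)) n))
        (lift-pos (right-pos (L.init-⊸ (T.N-pos n))))

    view₁ : ∀ o {i a z} → Reply T.N T.D o (inj₁ (i , a) ∷ z) → T.N z →
            ∃[ b ] o ≡ just (inj₁ (i , b)) × P i (b ∷ a ∷ left z ↾ i)
    -- `T` cannot stop after a move in `! A`: the left part would be of odd length, yet have nothing
    -- pending, against `turn-pend`.
    view₁ nothing {i} {a} {z} d m = ⊥-elim (player≢opponent (trans (sym (L.turn-left p (T.D-even d)))
        (trans (sym (turn-pend (Laws.ok !A.!-laws (left-pos p)))) (cong turn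
          (pend-restricts-[] _ _ _ _ (proj₁ (⊸-split p)) (L.restricts-left (inj₁ (i , a) ∷ z)) (proj₂ (T.D-pos d)))))))
      where p = proj₁ (T.D-pos d)
    view₁ (just m) {i} {a} {z} n mz = lemma (next-thread LA LB (T.N-pos n) (opposite-adjoint (T.odd n))) n
      where
      lemma : ∀ {m} → ∃[ b ] m ≡ inj₁ (i , b) → T.N (m ∷ inj₁ (i , a) ∷ z) →
              ∃[ b ] just m ≡ just (inj₁ (i , b)) × P i (b ∷ a ∷ left z ↾ i)
      lemma (b , refl) n = b , refl , view₁-P n mz

    view₂ : ∀ o {a z} → Reply T.N T.D o (inj₂ a ∷ z) → T.N z →
            ∃[ o′ ] o ≡ mapₘ inj₂ o′ × Reply NB DB o′ (a ∷ right z)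
    view₂ nothing d m = nothing , refl , T.hf-∃ nothing d (rights m) (lift-pos (right-pos (proj₁ (T.D-pos d))))
    view₂ (just m) {a} {z} n mz = lemma (L.next-right (T.N-pos n) (opposite-adjoint (T.odd n))) n
      where
      lemma : ∀ {m} → ∃[ b ] m ≡ inj₂ b → T.N (m ∷ inj₂ a ∷ z) →
              ∃[ o′ ] just m ≡ mapₘ inj₂ o′ × Reply NB DB o′ (a ∷ right z)
      lemma (b , refl) n = just b , refl , T.hf-∃ (just (inj₂ b)) n (rights mz)
        (lift-pos (right-pos (L.init-⊸ (T.N-pos n))))

    split : Split LA LB T.N T.D P NB DB
    split = record
      { N-pos   = T.N-pos
      ; threads = threads
      ; rights  = rights
      ; view₁   = view₁
      ; view₂   = view₂
      ; reply₁  = λ {i} {a} {b} m p n → T.hf-∃ (just (inj₁ (i , b))) n m p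
      ; reply₂  = λ o m p r → T.hf-∃ (mapₘ inj₂ o) (to o r) m p
      }

    first : ∀ o → Reply T.N T.D o [] → Reply C.N C.D o []
    first o n with refl ← initial {o} n = T.N-pos opening , refl , opening , λ _ → opening

    first⁻ : ∀ o → Reply C.N C.D o [] → Reply T.N T.D o []
    first⁻ o n with refl ← Test.hf-[] C.combine o (just (inj₂ b₁)) n (first (just (inj₂ b₁)) opening) = opening

  module _ (S : Strat (A ⇒ B)) where

    -- `P-sim` matches the thread `i` of `T` with the thread-0 strategy; on `B` both tests are the
    -- same, so self-equivalence of `test` suffices.
    conv-decompose : Conv {A ⇒ B} (Strat.N S) T.D → Conv {A ⇒ B} (Strat.N S) C.D
    conv-decompose = conv-sim L.⊸-laws S T C.combine first
      (split-sim LA LB split C.split (λ i _ → P-sim i 0) (Test.self test))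

    conv-decompose⁻ : Conv {A ⇒ B} (Strat.N S) C.D → Conv {A ⇒ B} (Strat.N S) T.D
    conv-decompose⁻ = conv-sim L.⊸-laws S C.combine T first⁻
      (split-sim LA LB C.split split (λ _ k → P-sim 0 k) (Test.self test))

indices : {M : Set} → List (ℕ × M) → List ℕ
indices = map proj₁

↾-∉ : {M : Set} → ∀ {k} (v : List (ℕ × M)) → k ∉ indices v → v ↾ k ≡ []
↾-∉ []            _   = refl
↾-∉ ((i , m) ∷ v) k∉  = trans (↾-miss m v (λ i≡k → k∉ (here (sym i≡k)))) (↾-∉ v (λ k∈ → k∉ (there k∈)))

-- Replacing copies

-- Replace, in a play of β against copies of Y, the copies by copies of Y′ one
-- at a time, the last opened first. In the intermediate stages the copies
-- opened during an initial part v₀ of the original play are Y, all others Y′.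
module Replace {B : RawGame} (B-game : IsGame B) (Y Y′ : Strat B)
  (Y≲Y′ : (γ : Test B) → Conv {B} (Strat.N Y) (Test.D γ) → Conv {B} (Strat.N Y′) (Test.D γ))
  (β : Test (! B)) where

  private
    LB = game-laws B-game
    module !B = Bang LB
    module β = Test β
    module Y = Strat Y
    module Y′ = Strat Y′
    MR = Move (! B)

    fill : ∀ {v : List MR} {i} → Dec (i ∈ indices v) → Strat B
    fill (yes _) = Y
    fill (no _)  = Y′

    F : List MR → ℕ → Strat B
    F v i = fill {v} (_∈?_ _≟_ i (indices v))

    fill-∈ : ∀ {v i} (d : Dec (i ∈ indices v)) → i ∈ indices v → fill {v} d ≡ Y
    fill-∈ (yes _)  _  = refl
    fill-∈ (no i∉) i∈ = ⊥-elim (i∉ i∈)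

    fill-∉ : ∀ {v i} (d : Dec (i ∈ indices v)) → i ∉ indices v → fill {v} d ≡ Y′
    fill-∉ (yes i∈) i∉ = ⊥-elim (i∉ i∈)
    fill-∉ (no _)   _  = refl

    F-∈ : ∀ {v i} → i ∈ indices v → F v i ≡ Y
    F-∈ {v} = fill-∈ {v} (_∈?_ _≟_ _ (indices v))

    F-∉ : ∀ {v i} → i ∉ indices v → F v i ≡ Y′
    F-∉ {v} = fill-∉ {v} (_∈?_ _≟_ _ (indices v))

    F-cong : ∀ {v v′ i i′} → (i ∈ indices v → i′ ∈ indices v′) → (i′ ∈ indices v′ → i ∈ indices v) → F v i ≡ F v′ i′
    F-cong {v} {v′} {i} {i′} f g = lemma (_∈?_ _≟_ i (indices v))
      where
      lemma : (d : Dec (i ∈ indices v)) → fill {v} d ≡ F v′ i′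
      lemma (yes i∈) = sym (F-∈ {v′} (f i∈))
      lemma (no i∉)  = sym (F-∉ {v′} (λ i′∈ → i∉ (g i′∈)))

    fixed : ∀ {π : ℕ → ℕ} (v : List MR) → map (π ∘′ proj₁) v ≡ indices v → ∀ {i} → i ∈ indices v → π i ≡ i
    fixed (_ ∷ v) eq (here refl) = ∷-injectiveˡ eq
    fixed {π} (_ ∷ v) eq (there i∈) = fixed {π} v (∷-injectiveʳ eq) i∈

    -- A permutation fixing every index of `v` cannot, being injective, bring another index into
    -- `v`.
    F-invariant : ∀ v (π : ℕ → ℕ) → (∀ {i k} → π i ≡ π k → i ≡ k) → map (π ∘′ proj₁) v ≡ indices v →
                  ∀ i → F v (π i) ≡ F v i
    F-invariant v π π-inj eq i = F-cong {v} {v}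
      (λ πi∈ → subst (_∈ indices v) (π-inj (fixed {π} v eq πi∈)) πi∈)
      (λ i∈ → subst (_∈ indices v) (sym (fixed {π} v eq i∈)) i∈)

    -- `v₀` is kept literally from the original play, so that a later section can start inside it;
    -- only the continuation `s` varies from stage to stage.
    Stage : List MR → Set
    Stage v₀ = ∃[ s ] β.D (s ++ v₀) × (∀ i → Strat.N (F v₀ i) ((s ++ v₀) ↾ i))

    filled : ∀ {v₀} → Threads Y.N v₀ → ∀ i → Strat.N (F v₀ i) (v₀ ↾ i)
    filled {v₀} ts i = lemma (_∈?_ _≟_ i (indices v₀))
      where
      lemma : (d : Dec (i ∈ indices v₀)) → Strat.N (fill {v₀} d) (v₀ ↾ i)
      lemma (yes _)  = ts i
      lemma (no i∉)  = subst Y′.N (sym (↾-∉ v₀ i∉)) Y′.nil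

    -- The copy `i` was opened earlier, so shortening `v` by this exchange leaves the set of opened
    -- copies unchanged.
    stage-∈ : ∀ {i a b} {v : List MR} → i ∈ indices v → Stage ((i , b) ∷ (i , a) ∷ v) → Stage v
    stage-∈ {i} {a} {b} {v} i∈ (s , d , fs) = s ++ (i , b) ∷ (i , a) ∷ [] ,
      subst β.D (sym (++-assoc s _ v)) d ,
      λ k → subst (λ u → Strat.N (F v k) (u ↾ k)) (sym (++-assoc s _ v))
        (subst (λ S → Strat.N S ((s ++ (i , b) ∷ (i , a) ∷ v) ↾ k))
          (F-cong {(i , b) ∷ (i , a) ∷ v} {v}
            (λ { (here refl) → i∈ ; (there (here refl)) → i∈ ; (there (there k∈)) → k∈ })
            (λ k∈ → there (there k∈))) (fs k))

    -- The move `(i , a)` opened the copy `i`, so `v` followed by it is the fixed beginning of the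
    -- section at `i`. Convergence of that section passes from `Y` to `Y′`, and `D-elim` yields an
    -- entirely new continuation.
    stage-∉ : ∀ {i a b} {v : List MR} → i ∉ indices v → β.N ((i , a) ∷ v) → Threads Y.N v →
              Stage ((i , b) ∷ (i , a) ∷ v) → Stage v
    stage-∉ {i} {a} {b} {v} i∉ n ts (s , d , fs) = replaced (Y≲Y′ S.test (_ , y , S.D-intro (s ++ (i , b) ∷ [])
        (subst β.D assoc d) (λ k k≢i → subst (λ u → Strat.N (F v k) (u ↾ k)) assoc (others k k≢i))))
      where
      module S = Section B-game β i a v n (↾-∉ v i∉) (F v) (λ k _ → filled {v} ts k) (F-invariant v)
      assoc : s ++ (i , b) ∷ (i , a) ∷ v ≡ (s ++ (i , b) ∷ []) ++ (i , a) ∷ v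
      assoc = sym (++-assoc s _ _)
      others : ∀ k → k ≢ i → Strat.N (F v k) ((s ++ (i , b) ∷ (i , a) ∷ v) ↾ k)
      others k k≢i = subst (λ S → Strat.N S ((s ++ (i , b) ∷ (i , a) ∷ v) ↾ k))
        (F-cong {(i , b) ∷ (i , a) ∷ v} {v}
          (λ { (here refl) → ⊥-elim (k≢i refl) ; (there (here refl)) → ⊥-elim (k≢i refl)
             ; (there (there k∈)) → k∈ })
          (λ k∈ → there (there k∈))) (fs k)
      y : Y.N (((s ++ (i , b) ∷ []) ++ (i , a) ∷ v) ↾ i)
      y = subst (λ u → Y.N (u ↾ i)) assoc
        (subst (λ S → Strat.N S ((s ++ (i , b) ∷ (i , a) ∷ v) ↾ i))
          (F-∈ {(i , b) ∷ (i , a) ∷ v} (here refl)) (fs i))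
      replaced : Conv {B} Y′.N (Test.D S.test) → Stage v
      replaced (t , y′ , d′) = conclude (S.D-elim d′)
        where
        conclude : ∃[ s ] β.D (s ++ (i , a) ∷ v) × (∀ k → S.Filled k ((s ++ (i , a) ∷ v) ↾ k)) ×
                     (s ++ (i , a) ∷ v) ↾ i ≡ t → Stage v
        conclude (s′ , d″ , fs′ , eq) = s′ ++ (i , a) ∷ [] , subst β.D assoc′ d″ ,
          λ k → subst (λ u → Strat.N (F v k) (u ↾ k)) assoc′ (thread k (k ≟ i))
          where
          assoc′ : s′ ++ (i , a) ∷ v ≡ (s′ ++ (i , a) ∷ []) ++ v
          assoc′ = sym (++-assoc s′ _ _)
          thread : ∀ k → Dec (k ≡ i) → Strat.N (F v k) ((s′ ++ (i , a) ∷ v) ↾ k)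
          thread k (no k≢i)   = fs′ k k≢i
          thread k (yes refl) = subst (λ S → Strat.N S ((s′ ++ (i , a) ∷ v) ↾ i)) (sym (F-∉ {v} i∉))
            (subst Y′.N (sym eq) y′)

    -- Recursion through the exchanges of the original play, latest one at the head; only an
    -- exchange that opened its copy causes a replacement.
    stages : ∀ v o → Reply β.N β.D o v → Position (! B) v → turn v ≡ opponent → Threads Y.N v → Stage v → Stage []
    stages [] _ _ _ _ _ st = st
    stages ((k , b) ∷ (i , a) ∷ v) o r p eq ts st =
      lemma (!B.next-! p (opposite-adjoint eq)) r ts st
      where
      lemma : k ≡ i → Reply β.N β.D o ((k , b) ∷ (i , a) ∷ v) → Threads Y.N ((k , b) ∷ (i , a) ∷ v) →
              Stage ((k , b) ∷ (i , a) ∷ v) → Stage []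
      lemma refl r ts st = stages v (just (i , a)) (β.back o r) (!B.init-! (!B.init-! p))
          (trans (sym (opposite-involutive _)) eq) ts′ (stage (_∈?_ _≟_ i (indices v)))
        where
        threads = ↾-∷∷⁻ (λ _ → Y.N) i a b v ts
        ts′ : Threads Y.N v
        ts′ c = thread c (c ≟ i)
          where
          thread : ∀ c → Dec (c ≡ i) → Y.N (v ↾ c)
          thread c (yes refl) = Y.back (just b) (proj₁ threads)
          thread c (no c≢i)   = proj₂ threads c c≢i
        stage : Dec (i ∈ indices v) → Stage v
        stage (yes i∈) = stage-∈ {v = v} i∈ st
        stage (no i∉)  = stage-∉ {v = v} i∉ (β.back o r) ts′ st

  replace : ∃[ v ] Threads Y.N v × β.D v → ∃[ v ] Threads Y′.N v × β.D v
  -- In the initial stage the fixed part is the whole play: the copies occurring in it are `Y`, and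
  -- every other thread is empty, hence a play of `Y′`.
  replace (v , ts , d) = finish (stages v nothing d (proj₁ (β.D-pos d)) (β.D-even d) ts ([] , d , filled {v} ts))
    where
    finish : Stage [] → ∃[ v ] Threads Y′.N v × β.D v
    finish (s , d , fs) = s , (λ i → subst (λ u → Y′.N (u ↾ i)) (++-identityʳ s)
        (subst (λ S → Strat.N S ((s ++ []) ↾ i)) (F-∉ {[]} {i} (λ ())) (fs i))) ,
      subst β.D (++-identityʳ s) d

module _ {G : RawGame} (LG : Laws G) (T : Test G) where

  private
    module T = Test T

  test⇒Str : Str (G ⊸ 𝕊)
  test⇒Str = strat⇒Str (test⇒strat LG T) (Lolli.⊸-laws LG 𝕊-laws)

  test⇒Str-D : ∀ {z} → Test.D (strat⇒test LG (Str⇒strat test⇒Str)) z → T.D z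
  test⇒Str-D {z} d = test⇒strat-D LG T (subst (Strat.N (test⇒strat LG T)) (reverse-involutive (inj₂ done ∷ asked LG z)) d)

  D⇒test⇒Str : ∀ {z} → T.D z → Test.D (strat⇒test LG (Str⇒strat test⇒Str)) z
  D⇒test⇒Str {z} d = subst (Strat.N (test⇒strat LG T)) (sym (reverse-involutive (inj₂ done ∷ asked LG z)))
    (D⇒test⇒strat LG T d)

-- Function extensionality

module Main (p : (ℕ × ℕ) ↣ ℕ) {A B : RawGame} (A-game : IsGame A) (B-game : IsGame B) where

  open Promotion p

  private
    LA = game-laws A-game
    LB = game-laws B-game
    L!A = Bang.!-laws LA
    L!B = Bang.!-laws LB
    LG = Lolli.⊸-laws L!A LB

  module _ (σ : Str (A ⇒ B)) (x : Str (𝟏 ⇒ A)) where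

    private
      S = Str⇒strat σ

    point-of : Strat A
    point-of = strat-from !𝟏-laws (λ ()) LA (Str⇒strat x)

    private
      module Ap = Apply LA B-game S point-of

    applied : Strat B
    applied = Ap.apply

    applied-conv : (γ : Test B) → Conv {B} (Strat.N applied) (Test.D γ) →
                   Conv {A ⇒ B} (Strat.N S) (Test.D (Combine.combine LA LB γ point-of))
    applied-conv γ (t , n , d) = conv-combine⁻ LA LB S γ point-of (t , Ap.N⇒hidden n , d)

    applied-conv⁻ : (γ : Test B) → Conv {A ⇒ B} (Strat.N S) (Test.D (Combine.combine LA LB γ point-of)) →
                    Conv {B} (Strat.N applied) (Test.D γ)
    applied-conv⁻ γ c = let t , h , d = conv-combine LA LB S γ point-of c in t , Ap.hidden⇒N h , d

    composite : (β : Str (B ⇒ 𝕊)) → raw β ∘ raw σ ∘ raw x ↓ →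
                ∃[ v ] Threads (Strat.N applied) v × Test.D (strat⇒test L!B (Str⇒strat β)) v
    composite = composite-converges p LA LB x σ applied Ap.N⇒hidden Ap.hidden⇒N

    composite⁻ : (β : Str (B ⇒ 𝕊)) →
                 ∃[ v ] Threads (Strat.N applied) v × Test.D (strat⇒test L!B (Str⇒strat β)) v →
                 raw β ∘ raw σ ∘ raw x ↓
    composite⁻ = composite-converges⁻ p LA LB x σ applied Ap.N⇒hidden Ap.hidden⇒N

  module _ (σ τ : Str (A ⇒ B)) where

    private
      Sσ = Str⇒strat σ
      Sτ = Str⇒strat τ

    ≲⇒test : σ ≲ τ → (T : Test (A ⇒ B)) → Conv {A ⇒ B} (Strat.N Sσ) (Test.D T) → Conv {A ⇒ B} (Strat.N Sτ) (Test.D T)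
    ≲⇒test σ≲τ T (z , n , d) = back (point-converges LG τ (test⇒Str LG T)
        (σ≲τ (test⇒Str LG T) (point-converges⁻ LG σ (test⇒Str LG T) (z , n , D⇒test⇒Str LG T d))))
      where
      back : Conv {A ⇒ B} (Strat.N Sτ) (Test.D (strat⇒test LG (Str⇒strat (test⇒Str LG T)))) →
             Conv {A ⇒ B} (Strat.N Sτ) (Test.D T)
      back (z , n , d) = z , n , test⇒Str-D LG T d

    -- Each linear test on `B` required by `Replace`, combined with copies of `x`, is one linear
    -- test on `A ⇒ B`, and there `σ ≲ τ` applies.
    forward : σ ≲ τ → (x : Str (𝟏 ⇒ A)) (β : Str (B ⇒ 𝕊)) →
              raw β ∘ raw σ ∘ raw x ↓ → raw β ∘ raw τ ∘ raw x ↓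
    forward σ≲τ x β c = composite⁻ τ x β (Replace.replace B-game (applied σ x) (applied τ x)
      (λ γ c → applied-conv⁻ τ x γ (≲⇒test σ≲τ (Combine.combine LA LB γ (point-of σ x)) (applied-conv σ x γ c)))
      (strat⇒test L!B (Str⇒strat β)) (composite σ x β c))

    module _ (below : (x : Str (𝟏 ⇒ A)) (β : Str (B ⇒ 𝕊)) →
                      raw β ∘ raw σ ∘ raw x ↓ → raw β ∘ raw τ ∘ raw x ↓) where

      private
        module _ (X : Strat A) (γ : Test B) where

          x : Str (𝟏 ⇒ A)
          x = strat⇒Str (strat-to !𝟏-laws (λ ()) LA X) (Lolli.⊸-laws !𝟏-laws LA)

          β : Str (B ⇒ 𝕊)
          β = test⇒Str L!B (dereliction LB γ)

          -- `X` after the passage to `Str` and back: its plays are the same up to a double reversal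
          -- and a retagging.
          X₁ : Strat A
          X₁ = point-of σ x

          eq : (z : List (Move A)) → right (reverse (reverse (map (inj₂ {A = Move (! 𝟏)}) z))) ≡ z
          eq z = trans (cong right (reverse-involutive (map inj₂ z))) (mapMaybeIsInj₂∘mapInj₂ z)

          X⇒X₁ : ∀ {z} → Strat.N X z → Strat.N X₁ z
          X⇒X₁ {z} = subst (Strat.N X) (sym (eq z))

          X₁⇒X : ∀ {z} → Strat.N X₁ z → Strat.N X z
          X₁⇒X {z} = subst (Strat.N X) (eq z)

          transfer : Conv {A ⇒ B} (Strat.N Sσ) (Combine.D LA LB γ X) → Conv {A ⇒ B} (Strat.N Sτ) (Combine.D LA LB γ X)
          transfer (z , n , pos , ev , d , ts) = result (applied-conv τ x γ (conv-dereliction⁻ LB γ (applied τ x)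
              (run (composite τ x β (below x β (composite⁻ σ x β (run⁻ (conv-dereliction LB γ (applied σ x)
                (applied-conv⁻ σ x γ (z , n , pos , ev , d , λ i → X⇒X₁ {left z ↾ i} (ts i)))))))))))
            where
            run : ∃[ v ] Threads (Strat.N (applied τ x)) v × Test.D (strat⇒test L!B (Str⇒strat β)) v →
                  ∃[ v ] Threads (Strat.N (applied τ x)) v × Test.D (dereliction LB γ) v
            run (v , ts , d) = v , ts , test⇒Str-D L!B (dereliction LB γ) d
            run⁻ : ∃[ v ] Threads (Strat.N (applied σ x)) v × Test.D (dereliction LB γ) v →
                   ∃[ v ] Threads (Strat.N (applied σ x)) v × Test.D (strat⇒test L!B (Str⇒strat β)) v
            run⁻ (v , ts , d) = v , ts , D⇒test⇒Str L!B (dereliction LB γ) d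
            result : Conv {A ⇒ B} (Strat.N Sτ) (Combine.D LA LB γ X₁) → Conv {A ⇒ B} (Strat.N Sτ) (Combine.D LA LB γ X)
            result (z , n , pos , ev , d , ts) = z , n , pos , ev , d , λ i → X₁⇒X {left z ↾ i} (ts i)

        -- A test is given by predicates, so its reply to `ask` is extracted from a play of it.
        first-move : (T : Test (A ⇒ B)) → ∀ z o → turn z ≡ opponent → Reply (Test.N T) (Test.D T) o z →
                     ∃[ o ] Reply (Test.N T) (Test.D T) o []
        first-move T []          o _  r = o , r
        first-move T (a ∷ b ∷ z) o eq r =
          first-move T z (just b) (trans (sym (opposite-involutive _)) eq) (Test.back T o r)

        test-transfer : (T : Test (A ⇒ B)) → ∃[ o ] Reply (Test.N T) (Test.D T) o [] →
                        Conv {A ⇒ B} (Strat.N Sσ) (Test.D T) → Conv {A ⇒ B} (Strat.N Sτ) (Test.D T)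
        -- A test that stops at once converges against every strategy.
        test-transfer T (nothing , d) _ = [] , Strat.nil Sτ , d
        test-transfer T (just m , n) c = opened (Lolli.first-right L!A LB (Test.N-pos T n)) n
          where
          opened : ∃[ b ] m ≡ inj₂ b → Test.N T (m ∷ []) → Conv {A ⇒ B} (Strat.N Sτ) (Test.D T)
          opened (b , refl) n = D.conv-decompose⁻ Sτ (transfer D.strategy D.test (D.conv-decompose Sσ c))
            where module D = Decompose LA LB T b n

      backward : σ ≲ τ
      backward α c = point-converges⁻ LG τ α (converted (point-converges LG σ α c))
        where
        T : Test (A ⇒ B)
        T = strat⇒test LG (Str⇒strat α)
        converted : Conv {A ⇒ B} (Strat.N Sσ) (Test.D T) → Conv {A ⇒ B} (Strat.N Sτ) (Test.D T)
        converted (z , n , d) = test-transfer T (first-move T z nothing (Test.D-even T {z} d) d) (z , n , d)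

lemma4p7 : (p : (ℕ × ℕ) ↣ ℕ) → let open Promotion p in
    (A B : RawGame) → IsGame A → IsGame B → (σ τ : Str (A ⇒ B)) →
    (σ ≲ τ) ⇔
    ((x : Str (𝟏 ⇒ A)) (β : Str (B ⇒ 𝕊)) →
    raw β ∘ raw σ ∘ raw x ↓ → raw β ∘ raw τ ∘ raw x ↓)
lemma4p7 p A B A-game B-game σ τ = mk⇔ (Main.forward p A-game B-game σ τ) (Main.backward p A-game B-game σ τ)
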